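{- Let $q$ be an odd prime power, $p$ its characteristic, $d\ge2$ an integer and $t\in\mathbb{F}_q^{\times}$. Let $\omega$ be a generator of the group of multiplicative characters of $\mathbb{F}_q^{\times}$, $\phi$ the unique character of order $2$, $\zeta_p$ a primitive $p$-th root of unity, and for a character $\chi$ let $g_q(\chi)=\sum_{x\in\mathbb{F}_q^{\times}}\chi(x)\zeta_p^{\mathrm{tr}(x)}$, where $\mathrm{tr}:\mathbb{F}_q\to\mathbb{F}_p$ is the trace. Define $$H_q(t)=\frac{(-1)^d}{1-q}\sum_{m=0}^{q-2}\left(\frac{g_q(\phi\omega^m)\,g_q(\omega^{ -m})}{g_q(\phi)}\right)^d\omega\big((-1)^dt\big)^m.$$ Then the number of points $(x_1,\dots,x_d)\in(\mathbb{F}_q^{\times})^d$ on the hypersurface $$X_t:\ \prod_{i=1}^d\left(x_i+2+x_i^{ -1}\right)=4^d t^{ -1}$$ equals $$\frac{(q-2)^d-(-1)^d}{q-1}-(-1)^dH_q(t).$$ -}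

module Defs where

open import Algebra.Apartness.Bundles using (HeytingField; HeytingCommutativeRing)
open import Algebra.Bundles using (Group; AbelianGroup; CommutativeRing)
open import Algebra.Morphism.Structures using (module GroupMorphisms)
open import Data.Fin using (Fin; toℕ)
open import Data.Fin.Properties using (any?) renaming (_≟_ to _≟ᶠ_)
open import Data.Integer as ℤ using (ℤ; -[1+_])
open import Data.List as List using (List; length; filter; mapMaybe; allFin; upTo; cartesianProductWith)
import Data.Maybe as Maybe
open import Data.Nat as ℕ using (ℕ; zero; suc; _∸_)
open import Data.Nat.Primality using (Prime; prime⇒nonTrivial)
import Data.Nat.Properties as ℕ
open import Data.Product using (Σ; ∃; _,_; proj₁; proj₂)
open import Data.Vec as Vec using (Vec)
open import Function using (_on_)
open import Function.Bundles using (Inverse)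
open import Level using (Level; _⊔_)
open import Relation.Binary.PropositionalEquality as ≡ using (_≡_; _≢_)
open import Relation.Nullary using (¬_; Dec; yes; no)
open import Relation.Nullary.Decidable using (map′; dec⇒maybe)
import Algebra.Apartness.Properties.HeytingCommutativeRing as HeytingProperties
import Algebra.Definitions.RawMonoid as RawMonoidDefinitions
import Algebra.Properties.AbelianGroup as AbelianGroupProperties
import Algebra.Properties.CommutativeSemigroup as CommutativeSemigroupProperties
import Algebra.Properties.Ring as RingProperties
import Algebra.Properties.Semiring.Exp as Exp
import Algebra.Properties.Semiring.Mult as Mult
import Relation.Binary.Construct.On as On
import Relation.Binary.Reasoning.Setoid as ≈-Reasoning

private variable
  c ℓ c′ ℓ′ r r′ : Level

record OddPrimePower (q : ℕ) : Set where
  field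
    p       : ℕ
    k       : ℕ
    p-prime : Prime p
    p-odd   : p ≢ 2
    k≥1     : 1 ℕ.≤ k
    q≡p^k   : q ≡ p ℕ.^ k

  1<q : 1 ℕ.< q
  1<q = ≡.subst (1 ℕ.<_) (≡.sym q≡p^k)
    (ℕ.^-monoʳ-< p (ℕ.nonTrivial⇒n>1 p {{prime⇒nonTrivial p-prime}}) k≥1)

module GroupNotions (G : Group c ℓ) where
  open Group G
  open RawMonoidDefinitions rawMonoid using () renaming (_×_ to _×ᴳ_)

  infixr 8 _^ℤ_
  _^ℤ_ : Carrier → ℤ → Carrier
  x ^ℤ (ℤ.+ n)  = n ×ᴳ x
  x ^ℤ -[1+ n ] = (suc n ×ᴳ x) ⁻¹

  IsGenerator : Carrier → Set (c ⊔ ℓ)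
  IsGenerator x = ∀ y → ∃ λ m → y ≈ x ^ℤ m

  record HasOrder (x : Carrier) (n : ℕ) : Set ℓ where
    field
      positive : 0 ℕ.< n
      xⁿ≈ε     : x ^ℤ (ℤ.+ n) ≈ ε
      minimal  : ∀ m → 0 ℕ.< m → m ℕ.< n → ¬ (x ^ℤ (ℤ.+ m) ≈ ε)

module _ (G : Group c ℓ) (A : AbelianGroup c′ ℓ′) where
  private
    module G = Group G
    module A = AbelianGroup A
  open GroupMorphisms G.rawGroup A.rawGroup using (IsGroupHomomorphism)
  open AbelianGroupProperties A using (⁻¹-∙-comm; ε⁻¹≈ε)
  open CommutativeSemigroupProperties A.commutativeSemigroup using (interchange)

  record Hom : Set (c ⊔ ℓ ⊔ c′ ⊔ ℓ′) where
    field
      ⟦_⟧                 : G.Carrier → A.Carrier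
      isGroupHomomorphism : IsGroupHomomorphism ⟦_⟧
    open IsGroupHomomorphism isGroupHomomorphism public

  private
    open Hom

    mkHom : (f : G.Carrier → A.Carrier) →
            (∀ {x y} → x G.≈ y → f x A.≈ f y) →
            (∀ x y → f (x G.∙ y) A.≈ f x A.∙ f y) →
            f G.ε A.≈ A.ε →
            (∀ x → f (x G.⁻¹) A.≈ f x A.⁻¹) → Hom
    mkHom f cong ∙-hom ε-hom ⁻¹-hom = record
      { ⟦_⟧ = f
      ; isGroupHomomorphism = record
        { isMonoidHomomorphism = record
          { isMagmaHomomorphism = record
            { isRelHomomorphism = record { cong = cong } ; homo = ∙-hom }
          ; ε-homo = ε-hom }
        ; ⁻¹-homo = ⁻¹-hom } }

    _·_ : Hom → Hom → Hom
    f · g = mkHom (λ x → ⟦ f ⟧ x A.∙ ⟦ g ⟧ x)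
      (λ x≈y → A.∙-cong (⟦⟧-cong f x≈y) (⟦⟧-cong g x≈y))
      (λ x y → A.trans (A.∙-cong (homo f x y) (homo g x y)) (interchange _ _ _ _))
      (A.trans (A.∙-cong (ε-homo f) (ε-homo g)) (A.identityˡ A.ε))
      (λ x → A.trans (A.∙-cong (⁻¹-homo f x) (⁻¹-homo g x)) (⁻¹-∙-comm _ _))

    𝟙 : Hom
    𝟙 = mkHom (λ _ → A.ε) (λ _ → A.refl) (λ _ _ → A.sym (A.identityˡ A.ε))
      A.refl (λ _ → A.sym ε⁻¹≈ε)

    inv : Hom → Hom
    inv f = mkHom (λ x → ⟦ f ⟧ x A.⁻¹)
      (λ x≈y → A.⁻¹-cong (⟦⟧-cong f x≈y))
      (λ x y → A.trans (A.⁻¹-cong (homo f x y)) (A.sym (⁻¹-∙-comm _ _)))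
      (A.trans (A.⁻¹-cong (ε-homo f)) ε⁻¹≈ε)
      (λ x → A.⁻¹-cong (⁻¹-homo f x))

  homGroup : AbelianGroup (c ⊔ ℓ ⊔ c′ ⊔ ℓ′) (c ⊔ ℓ′)
  homGroup = record
    { Carrier = Hom
    ; _≈_ = λ f g → ∀ x → ⟦ f ⟧ x A.≈ ⟦ g ⟧ x
    ; _∙_ = _·_
    ; ε   = 𝟙
    ; _⁻¹ = inv
    ; isAbelianGroup = record
      { isGroup = record
        { isMonoid = record
          { isSemigroup = record
            { isMagma = record
              { isEquivalence = record
                { refl  = λ _ → A.refl
                ; sym   = λ e x → A.sym (e x)
                ; trans = λ e e′ x → A.trans (e x) (e′ x) }
              ; ∙-cong = λ e e′ x → A.∙-cong (e x) (e′ x) }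
            ; assoc = λ f g h x → A.assoc _ _ _ }
          ; identity = (λ f x → A.identityˡ _) , (λ f x → A.identityʳ _) }
        ; inverse = (λ f x → A.inverseˡ _) , (λ f x → A.inverseʳ _)
        ; ⁻¹-cong = λ e x → A.⁻¹-cong (e x) }
      ; comm = λ f g x → A.comm _ _ } }

module FieldNotions (K : HeytingField c ℓ r) where
  open HeytingField K public
  open HeytingCommutativeRing heytingCommutativeRing public using (commutativeRing)
  open CommutativeRing commutativeRing public using (ring; semiring)
  open Exp semiring public using (_^_)
  open Mult semiring using () renaming (_×_ to _×ᴷ_)
  open HeytingProperties heytingCommutativeRing
  open RingProperties ring using (-‿distribˡ-*; -‿involutive)

  fromℕ : ℕ → Carrier
  fromℕ n = n ×ᴷ 1#

  CharacteristicZero : Set r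
  CharacteristicZero = ∀ n → fromℕ (suc n) # 0#

  Unit : Set (c ⊔ r)
  Unit = Σ Carrier (_# 0#)

  private
    *≈1⇒#0 : ∀ {x y} → y * x ≈ 1# → x # 0#
    *≈1⇒#0 {x} {y} yx≈1 = invertibleˡ⇒# (y , trans (*-congˡ (x-0≈x x)) yx≈1)

    inv : Unit → Carrier
    inv (x , x#0) = proj₁ (#⇒invertible x#0)

    inverseˡ : ∀ u → inv u * proj₁ u ≈ 1#
    inverseˡ (x , x#0) =
      trans (*-congˡ (sym (x-0≈x x))) (proj₁ (proj₂ (#⇒invertible x#0)))

    _∙ᵘ_ : Unit → Unit → Unit
    (x , x#0) ∙ᵘ (y , y#0) = x * y , x#0y#0→xy#0 x#0 y#0

    _⁻¹ᵘ : Unit → Unit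
    u ⁻¹ᵘ = inv u , *≈1⇒#0 (trans (*-comm (proj₁ u) (inv u)) (inverseˡ u))

    inverseʳ : ∀ u → proj₁ u * inv u ≈ 1#
    inverseʳ u = trans (*-comm _ _) (inverseˡ u)

    ⁻¹ᵘ-cong : ∀ {u v} → proj₁ u ≈ proj₁ v → inv u ≈ inv v
    ⁻¹ᵘ-cong {u} {v} u≈v = begin
      u′              ≈⟨ *-identityʳ u′ ⟨
      u′ * 1#         ≈⟨ *-congˡ (inverseʳ v) ⟨
      u′ * (proj₁ v * v′) ≈⟨ *-assoc _ _ _ ⟨
      u′ * proj₁ v * v′ ≈⟨ *-congʳ (*-congˡ u≈v) ⟨
      u′ * proj₁ u * v′ ≈⟨ *-congʳ (inverseˡ u) ⟩
      1# * v′         ≈⟨ *-identityˡ v′ ⟩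
      v′              ∎
      where
      open ≈-Reasoning setoid
      u′ = inv u
      v′ = inv v

  unitGroup : AbelianGroup (c ⊔ r) ℓ
  unitGroup = record
    { Carrier = Unit
    ; _≈_ = _≈_ on proj₁
    ; _∙_ = _∙ᵘ_
    ; ε   = 1# , 1#0
    ; _⁻¹ = _⁻¹ᵘ
    ; isAbelianGroup = record
      { isGroup = record
        { isMonoid = record
          { isSemigroup = record
            { isMagma = record
              { isEquivalence = On.isEquivalence proj₁ isEquivalence
              ; ∙-cong = *-cong }
            ; assoc = λ _ _ _ → *-assoc _ _ _ }
          ; identity = (λ _ → *-identityˡ _) , (λ _ → *-identityʳ _) }
        ; inverse = inverseˡ , inverseʳ
        ; ⁻¹-cong = λ {u} {v} → ⁻¹ᵘ-cong {u} {v} }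
      ; comm = λ _ _ → *-comm _ _ } }

  open AbelianGroup unitGroup public
    using (_⁻¹) renaming (_∙_ to _*ᵘ_; group to multiplicativeGroup)

  infixl 7 _/_
  _/_ : Carrier → Unit → Carrier
  x / u = x * proj₁ (u ⁻¹)

  -1-unit : Unit
  -1-unit = - 1# , *≈1⇒#0 (trans (sym (-‿distribˡ-* 1# (- 1#)))
    (trans (-‿cong (*-identityˡ _)) (-‿involutive 1#)))

  #⇒-#0 : ∀ {x y} → x # y → x - y # 0#
  #⇒-#0 x#y with #⇒invertible x#y
  ... | _ , yx≈1 , _ = *≈1⇒#0 yx≈1

  fromℕ#1 : CharacteristicZero → ∀ {q} → 1 ℕ.< q → fromℕ q # 1#
  fromℕ#1 char0 {suc (suc n)} _ =
    invertibleˡ⇒# (inv u , trans (*-congˡ cancel) (inverseˡ u))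
    where
    u = fromℕ (suc n) , char0 n

    cancel : (1# + fromℕ (suc n)) - 1# ≈ fromℕ (suc n)
    cancel = begin
      (1# + fromℕ (suc n)) - 1#  ≈⟨ +-congʳ (+-comm _ _) ⟩
      (fromℕ (suc n) + 1#) - 1#  ≈⟨ +-assoc _ _ _ ⟩
      fromℕ (suc n) + (1# - 1#)  ≈⟨ +-congˡ (-‿inverseʳ 1#) ⟩
      fromℕ (suc n) + 0#         ≈⟨ +-identityʳ _ ⟩
      fromℕ (suc n)              ∎
      where open ≈-Reasoning setoid
  fromℕ#1 char0 {suc zero} (ℕ.s≤s ())

  sumOver : ∀ {a} {A : Set a} → List A → (A → Carrier) → Carrier
  sumOver xs f = List.foldr (λ x s → f x + s) 0# xs

HasCardinality : HeytingField c ℓ r → ℕ → Set (c ⊔ ℓ)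
HasCardinality F n = Inverse (HeytingField.setoid F) (≡.setoid (Fin n))

module FiniteField (F : HeytingField c ℓ r) {q : ℕ} (card : HasCardinality F q) where
  open FieldNotions F
  open Inverse card using (to; from; to-cong; from-cong; inverseʳ)

  infix 4 _≟_
  _≟_ : ∀ x y → Dec (x ≈ y)
  x ≟ y = map′
    (λ e → trans (sym (inverseʳ ≡.refl)) (trans (from-cong e) (inverseʳ ≡.refl)))
    to-cong (to x ≟ᶠ to y)

  nonzero? : ∀ x → Dec (x # 0#)
  nonzero? x = map′
    (λ (i , e) → invertibleˡ⇒# (from i , trans (*-congˡ (x-0≈x x)) e))
    (λ x#0 → let (y , e , _) = #⇒invertible x#0 in
      to y , trans (*-cong (inverseʳ ≡.refl) (sym (x-0≈x x))) e)
    (any? λ i → from i * x ≟ 1#)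
    where open HeytingProperties heytingCommutativeRing

  units : List Unit
  units = mapMaybe (λ i → Maybe.map (from i ,_) (dec⇒maybe (nonzero? (from i)))) (allFin q)

  tuples : ∀ d → List (Vec Unit d)
  tuples zero    = List.[ Vec.[] ]
  tuples (suc d) = cartesianProductWith Vec._∷_ units (tuples d)

  product : ∀ {d} → Vec Carrier d → Carrier
  product = Vec.foldr _ _*_ 1#

  OnX : ∀ {d} → Unit → Vec Unit d → Set ℓ
  OnX {d} t xs =
    product (Vec.map (λ x → proj₁ x + fromℕ 2 + proj₁ (x ⁻¹)) xs) ≈ (fromℕ 4 ^ d) / t

  onX? : ∀ {d} (t : Unit) (xs : Vec Unit d) → Dec (OnX t xs)
  onX? t xs = _ ≟ _

  numberOfPoints : ℕ → Unit → ℕ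
  numberOfPoints d t = length (filter (onX? t) (tuples d))

  module Trace (p k : ℕ) where

    -- The trace from the field with pᵏ elements to its prime field,
    -- as an element of the large field.
    trace : Carrier → Carrier
    trace x = sumOver (upTo k) λ i → x ^ (p ℕ.^ i)

    -- The representative n < p of the residue class tr(x) ∈ 𝔽ₚ = ℤ/p.  When
    -- q = pᵏ the trace lies in the prime field, so the fallback value 0 is
    -- never reached.
    tr : Carrier → ℕ
    tr x with any? {n = p} (λ n → fromℕ (toℕ n) ≟ trace x)
    ... | yes (n , _) = toℕ n
    ... | no  _       = 0

-- K is the field of values of the characters, in place of ℂ: any field of
-- characteristic zero containing the roots of unity of order q − 1 and p has
-- the same characters and Gauss sums.
module Characters
  {q : ℕ} (qpp : OddPrimePower q)
  (F : HeytingField c ℓ r) (card : HasCardinality F q)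
  (K : HeytingField c′ ℓ′ r′) where

  open OddPrimePower qpp
  private
    module F = FieldNotions F
    module Fq = FiniteField F card
  open Fq.Trace p k using (tr)
  open FieldNotions K

  characterGroup : AbelianGroup _ _
  characterGroup = homGroup F.multiplicativeGroup unitGroup

  open AbelianGroup characterGroup
    public using () renaming (Carrier to Character; group to charGroup; _∙_ to _·_)
  open GroupNotions charGroup using (_^ℤ_)

  _⟨_⟩ : Character → F.Unit → Carrier
  χ ⟨ x ⟩ = proj₁ (Hom.⟦ χ ⟧ x)

  gaussSum : Unit → Character → Carrier
  gaussSum ζ χ = sumOver Fq.units λ x → χ ⟨ x ⟩ * proj₁ ζ ^ tr (proj₁ x)

  module _ (char0 : CharacteristicZero) where

    q-1 : Unit
    q-1 = fromℕ q - 1# , #⇒-#0 (fromℕ#1 char0 1<q)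

    1-q : Unit
    1-q = 1# - fromℕ q , #⇒-#0 (#-sym (fromℕ#1 char0 1<q))

    -- g(φ) ≠ 0 is needed for the definition to make sense, and is an argument.
    H : (ζ : Unit) (ω φ : Character) → gaussSum ζ φ # 0# → (d : ℕ) → F.Unit → Carrier
    H ζ ω φ gφ#0 d t =
      ((- 1#) ^ d) / 1-q * sumOver (upTo (q ∸ 1)) λ m →
        (g (φ · (ω ^ℤ (ℤ.+ m))) * g (ω ^ℤ (ℤ.- (ℤ.+ m))) / (g φ , gφ#0)) ^ d
          * (ω ⟨ [-1]^d F.*ᵘ t ⟩) ^ m
      where
      g = gaussSum ζ
      [-1]^d = GroupNotions._^ℤ_ F.multiplicativeGroup F.-1-unit (ℤ.+ d)

{-# OPTIONS --safe #-}
module Submission where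

open import Defs
open import Algebra.Apartness.Bundles using (HeytingField)
open import Algebra.Bundles using (AbelianGroup; CommutativeMonoid; CommutativeRing)
open import Algebra.Solver.Ring.AlmostCommutativeRing using (fromCommutativeRing; _-Raw-AlmostCommutative⟶_)
open import Data.Fin as Fin using (Fin; toℕ; punchIn)
open import Data.Fin.Permutation using (Permutation; permutation)
import Data.Fin.Properties as Fin
open import Data.Integer as ℤ using (ℤ; -[1+_]; _⊖_; _◃_; sign; ∣_∣)
import Data.Integer.Properties as ℤ
open import Data.List as List using (List; []; _∷_)
open import Data.List.Relation.Unary.All using (All; []; _∷_)
import Data.Maybe as Maybe
open import Data.Nat as ℕ using (ℕ; zero; suc; _≤_; _∸_; _!; NonZero)
open import Data.Nat.Combinatorics using (_C_; nCn≡1; nCk≡n!/k![n-k]!; k![n∸k]!∣n!)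
open import Data.Nat.Coprimality as Coprime using (Coprime; coprime-Bézout; coprime-divisor)
open import Data.Nat.Divisibility as ∣ using (_∣_; _∤_; divides; ∣⇒≤; m∣m*n)
open import Data.Nat.DivMod using (m/n*n≡m)
open import Data.Nat.GCD using (module Bézout)
open import Data.Nat.Induction using (<-wellFounded)
open import Data.Nat.ListAction using (product)
open import Data.Nat.Primality
open import Data.Nat.Primality.Factorisation using (factorise; PrimeFactorisation)
import Data.Nat.Properties as ℕ
open import Data.Product using (Σ; ∃; _,_; proj₁; proj₂; _×_)
open import Data.Sign as Sign using (Sign)
open import Data.Sum using (_⊎_; inj₁; inj₂; [_,_]; [_,_]′)
open import Data.Vec as Vec using (Vec; []; _∷_; zipWith)
open import Function using (_∘_)
open import Function.Bundles using (Inverse)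
open import Induction.WellFounded using (Acc; acc)
open import Level using (Level)
open import Relation.Binary.Bundles using (Setoid)
open import Relation.Binary.PropositionalEquality as ≡ using (_≡_; _≢_)
open import Relation.Nullary using (¬_; Dec; yes; no; contradiction)
open import Relation.Nullary.Decidable using (¬?; decidable-stable; dec⇒maybe)
open import Relation.Unary using (Pred; Decidable)
import Algebra.Apartness.Properties.HeytingCommutativeRing as HeytingProperties
import Algebra.Properties.AbelianGroup as AbelianGroupProperties
import Algebra.Properties.CommutativeMonoid.Sum as CommutativeMonoidSum
import Algebra.Properties.CommutativeSemiring.Binomial as Binomial
import Algebra.Properties.CommutativeSemiring.Exp as CommutativeExp
import Algebra.Properties.Group as GroupProperties
import Algebra.Properties.Monoid.Mult as MonoidMult
import Algebra.Properties.Ring as RingProperties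
import Algebra.Properties.Semiring.Exp as Exp
import Algebra.Properties.Semiring.Mult as Mult
import Algebra.Properties.Semiring.Mult.TCOptimised as MultTCO
import Algebra.Properties.Semiring.Sum as SemiringSum
import Algebra.Solver.Ring as RingSolver
import Relation.Binary.Reasoning.Setoid as ≈-Reasoning

-- Summing the relation ∏ hᵢ = 4ᵈ/t, where h(x) = x + 2 + x⁻¹ = (x + 1)²/x,
-- against all characters χ = ωᵐ gives (q − 1) N = Σ_χ χ(t) S(χ)ᵈ with
-- S(χ) = Σ_x χ(h(x)/4).  The substitution y = (x − 1)/(x + 1) turns S(χ) into
-- Σ_y χ⁻¹(1 − y²) = Σ_w (1 + φ(w)) χ⁻¹(1 − w), a Jacobi sum for χ ≠ 1, and
-- a change of variables in the double sum for g(φχ) g(χ⁻¹) shows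
-- g(φ) Σ_w φ(w) χ⁻¹(1 − w) = χ(−1) g(φχ) g(χ⁻¹).  For χ = 1 the two sides of
-- S(χ) = χ(−1) g(φχ) g(χ⁻¹) / g(φ) are q − 2 and −1, whence the correction term.
-- The orthogonality relations need a generator ω of the character group to be
-- faithful, for which a primitive root of 𝔽_q is constructed; g(φ) ≠ 0 follows
-- from g(φ)² = φ(−1) q, which needs the trace to be nonzero.
-- Equality in K is not decidable: tightness of the apartness is used instead.

-- The convention χ(0) = 0 holds for every character, the trivial one included. A tuple with some xᵢ
-- = -1 has product 0 and lies off the hypersurface; orthogonality then discards it without a case
-- distinction. Each factor is divided by 4 because 1 - y² = 4x/(x + 1)² is the inverse of h(x)/4,
-- and the same division absorbs the constant 4ᵈ. Odd characteristic enters here, through 1/4 and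
-- the substitution, and in the fact that y and -y are distinct square roots. That ω generates the
-- character group says little by itself, as a field K with few roots of unity has few characters.
-- The element η of order q - 1 supplies a character with value η at a primitive root; being a power
-- of ω, it forces ω to be faithful. A nontrivial character comes without an element at which it
-- differs from 1. Sums are therefore shown to vanish by refuting that they are apart from 0: such a
-- sum could be cancelled, and the character would be trivial.

private variable
  c ℓ r c′ ℓ′ r′ : Level

-- Ring solver with integer coefficients over a commutative ring.

module IntegerCoefficients (R : CommutativeRing c ℓ) where
  open CommutativeRing R
  open MultTCO semiring using (×-homo-+; ×1-homo-*; 1+×) renaming (_×_ to _×ᴹ_)
  open RingProperties ring using (-‿involutive; -0#≈0#; -1*x≈-x)
  open AbelianGroupProperties +-abelianGroup using (⁻¹-∙-comm)
  open ≈-Reasoning setoid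

  -- These multiples are the ones for which `1 ×ᴹ 1#` computes to `1#`, so `con (ℤ.+ 1)` in a solver
  -- call matches a literal `1#` in the goal.
  ι : ℤ → Carrier
  ι (ℤ.+ n)  = n ×ᴹ 1#
  ι -[1+ n ] = - (suc n ×ᴹ 1#)

  private
    cancelˡ : ∀ x y → (1# + x) - (1# + y) ≈ x - y
    cancelˡ x y = begin
      (1# + x) - (1# + y)      ≈⟨ +-cong (+-comm 1# x) (sym (⁻¹-∙-comm 1# y)) ⟩
      (x + 1#) + (- 1# - y)    ≈⟨ +-assoc x 1# _ ⟩
      x + (1# + (- 1# - y))    ≈⟨ +-congˡ (+-assoc 1# (- 1#) _) ⟨
      x + ((1# - 1#) - y)      ≈⟨ +-congˡ (+-congʳ (-‿inverseʳ 1#)) ⟩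
      x + (0# - y)             ≈⟨ +-congˡ (+-identityˡ _) ⟩
      x - y                    ∎

    ι-⊖ : ∀ m n → ι (m ⊖ n) ≈ m ×ᴹ 1# - n ×ᴹ 1#
    ι-⊖ m       zero    = sym (trans (+-congˡ -0#≈0#) (+-identityʳ _))
    ι-⊖ zero    (suc n) = sym (+-identityˡ _)
    ι-⊖ (suc m) (suc n) = begin
      ι (suc m ⊖ suc n)              ≡⟨ ≡.cong ι (ℤ.[1+m]⊖[1+n]≡m⊖n m n) ⟩
      ι (m ⊖ n)                      ≈⟨ ι-⊖ m n ⟩
      m ×ᴹ 1# - n ×ᴹ 1#                ≈⟨ cancelˡ _ _ ⟨
      (1# + m ×ᴹ 1#) - (1# + n ×ᴹ 1#)  ≈⟨ +-cong (1+× m 1#) (-‿cong (1+× n 1#)) ⟨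
      suc m ×ᴹ 1# - suc n ×ᴹ 1#        ∎

    ι-+ : ∀ i j → ι (i ℤ.+ j) ≈ ι i + ι j
    ι-+ (ℤ.+ m)  (ℤ.+ n)  = ×-homo-+ 1# m n
    ι-+ (ℤ.+ m)  -[1+ n ] = ι-⊖ m (suc n)
    ι-+ -[1+ m ] (ℤ.+ n)  = trans (ι-⊖ n (suc m)) (+-comm _ _)
    ι-+ -[1+ m ] -[1+ n ] = begin
      - (suc (suc (m ℕ.+ n)) ×ᴹ 1#)       ≡⟨ ≡.cong (λ k → - (suc k ×ᴹ 1#)) (ℕ.+-suc m n) ⟨
      - ((suc m ℕ.+ suc n) ×ᴹ 1#)         ≈⟨ -‿cong (×-homo-+ 1# (suc m) (suc n)) ⟩
      - (suc m ×ᴹ 1# + suc n ×ᴹ 1#)        ≈⟨ ⁻¹-∙-comm _ _ ⟨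
      - (suc m ×ᴹ 1#) - suc n ×ᴹ 1#        ∎

    ι-neg : ∀ i → ι (ℤ.- i) ≈ - ι i
    ι-neg (ℤ.+ zero)  = sym -0#≈0#
    ι-neg (ℤ.+ suc n) = refl
    ι-neg -[1+ n ]    = sym (-‿involutive _)

    σ : Sign → Carrier
    σ Sign.+ = 1#
    σ Sign.- = - 1#

    σ-* : ∀ s t → σ (s Sign.* t) ≈ σ s * σ t
    σ-* Sign.+ t      = sym (*-identityˡ _)
    σ-* Sign.- Sign.+ = sym (*-identityʳ _)
    σ-* Sign.- Sign.- = sym (trans (-1*x≈-x (- 1#)) (-‿involutive 1#))

    ι-◃ : ∀ s n → ι (s ◃ n) ≈ σ s * n ×ᴹ 1#
    ι-◃ s      zero    = sym (zeroʳ _)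
    ι-◃ Sign.+ (suc n) = sym (*-identityˡ _)
    ι-◃ Sign.- (suc n) = sym (-1*x≈-x _)

    ι-sign : ∀ i → ι i ≈ σ (sign i) * ∣ i ∣ ×ᴹ 1#
    ι-sign (ℤ.+ n)  = sym (*-identityˡ _)
    ι-sign -[1+ n ] = sym (-1*x≈-x _)

    ι-* : ∀ i j → ι (i ℤ.* j) ≈ ι i * ι j
    ι-* i j = begin
      ι (i ℤ.* j)                        ≈⟨ ι-◃ (sign i Sign.* sign j) (∣ i ∣ ℕ.* ∣ j ∣) ⟩
      σ (sign i Sign.* sign j) * (∣ i ∣ ℕ.* ∣ j ∣) ×ᴹ 1#
        ≈⟨ *-cong (σ-* (sign i) (sign j)) (×1-homo-* ∣ i ∣ ∣ j ∣) ⟩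
      (s * t) * (a * b)                  ≈⟨ *-assoc s t _ ⟩
      s * (t * (a * b))                  ≈⟨ *-congˡ (*-assoc t a b) ⟨
      s * (t * a * b)                    ≈⟨ *-congˡ (*-congʳ (*-comm t a)) ⟩
      s * (a * t * b)                    ≈⟨ *-congˡ (*-assoc a t b) ⟩
      s * (a * (t * b))                  ≈⟨ *-assoc s a _ ⟨
      (s * a) * (t * b)                  ≈⟨ *-cong (ι-sign i) (ι-sign j) ⟨
      ι i * ι j                          ∎
      where
      s = σ (sign i)
      t = σ (sign j)
      a = ∣ i ∣ ×ᴹ 1#
      b = ∣ j ∣ ×ᴹ 1#

    morphism : ℤ.+-*-rawRing -Raw-AlmostCommutative⟶ fromCommutativeRing R
    morphism = record
      { ⟦_⟧ = ι ; +-homo = ι-+ ; *-homo = ι-* ; -‿homo = ι-neg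
      ; 0-homo = refl ; 1-homo = refl }

    -- Coefficients are compared as integers, since equality of their images in the ring need not be
    -- decidable.
    weakly-decide : ∀ i j → Maybe.Maybe (ι i ≈ ι j)
    weakly-decide i j = Maybe.map (reflexive ∘ ≡.cong ι) (dec⇒maybe (i ℤ.≟ j))

  open RingSolver ℤ.+-*-rawRing (fromCommutativeRing R) morphism
    weakly-decide public
    using (solve; _:=_; con; _:+_; _:*_; _:-_; :-_)


-- Arithmetic and polynomial functions over a Heyting field.

module FieldProperties (K : HeytingField c ℓ r) where
  open FieldNotions K
  open CommutativeRing commutativeRing using (commutativeSemiring; +-abelianGroup)
  open HeytingProperties heytingCommutativeRing using (invertibleˡ⇒#; x-0≈x; 1#0) public
  open Exp semiring using (^-congˡ; ^-homo-*; ^-assocʳ) public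
  open CommutativeExp commutativeSemiring using (^-distrib-*) public
  open Mult semiring using (×1-homo-*; ×-homo-+; ×-assoc-*) renaming (_×_ to _×ᴹ_)
  open RingProperties ring using (-‿involutive; -0#≈0#) public
  open IntegerCoefficients commutativeRing using (solve; _:=_; con; _:+_; _:*_; _:-_; :-_) public
  open ≈-Reasoning setoid

  ≈-stable : ∀ {x y} → ¬ (x # y) → x ≈ y
  ≈-stable {x} {y} = proj₁ (tight x y)

  #⇒≉ : ∀ {x y} → x # y → ¬ (x ≈ y)
  #⇒≉ {x} {y} x#y x≈y = proj₂ (tight x y) x≈y x#y

  1≉0 : ¬ (1# ≈ 0#)
  1≉0 = #⇒≉ 1#0

  *≈1⇒#0 : ∀ {x y} → y * x ≈ 1# → x # 0#
  *≈1⇒#0 {x} {y} yx≈1 = invertibleˡ⇒# (y , trans (*-congˡ (x-0≈x x)) yx≈1)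

  *-inverseʳ : ∀ u → proj₁ u * proj₁ (u ⁻¹) ≈ 1#
  *-inverseʳ u = AbelianGroup.inverseʳ unitGroup u

  *-cancelˡ : ∀ u {x y} → proj₁ u * x ≈ proj₁ u * y → x ≈ y
  *-cancelˡ u {x} {y} ux≈uy = begin
    x                ≈⟨ cancel x ⟨
    v * (proj₁ u * x) ≈⟨ *-congˡ ux≈uy ⟩
    v * (proj₁ u * y) ≈⟨ cancel y ⟩
    y                ∎
    where
    v = proj₁ (u ⁻¹)

    cancel : ∀ z → v * (proj₁ u * z) ≈ z
    cancel z = begin
      v * (proj₁ u * z) ≈⟨ *-assoc v _ z ⟨
      v * proj₁ u * z   ≈⟨ *-congʳ (AbelianGroup.inverseˡ unitGroup u) ⟩
      1# * z            ≈⟨ *-identityˡ z ⟩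
      z                 ∎

  -- Tightness of # replaces the decidability of equality.
  x≉0⇒xy≈0⇒y≈0 : ∀ {x y} → ¬ (x ≈ 0#) → x * y ≈ 0# → y ≈ 0#
  x≉0⇒xy≈0⇒y≈0 {x} {y} x≉0 xy≈0 = ≈-stable λ y#0 → x≉0
    (*-cancelˡ (y , y#0) (trans (*-comm y x) (trans xy≈0 (sym (zeroʳ y)))))

  x-y≈0⇒x≈y : ∀ {x y} → x - y ≈ 0# → x ≈ y
  x-y≈0⇒x≈y {x} {y} = AbelianGroupProperties.x∙y⁻¹≈ε⇒x≈y +-abelianGroup x y

  x≈y⇒x-y≈0 : ∀ {x y} → x ≈ y → x - y ≈ 0#
  x≈y⇒x-y≈0 = AbelianGroupProperties.x≈y⇒x∙y⁻¹≈ε +-abelianGroup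

  -- From (a - 1) x = 0. Applied to sums that get multiplied by some a ≠ 1 when their index is
  -- shifted: additive character sums and geometric sums.
  ax≈x⇒x≈0 : ∀ {a x} → ¬ (a ≈ 1#) → a * x ≈ x → x ≈ 0#
  ax≈x⇒x≈0 {a} {x} a≉1 ax≈x = x≉0⇒xy≈0⇒y≈0 (a≉1 ∘ x-y≈0⇒x≈y) (begin
    (a - 1#) * x  ≈⟨ solve 2 (λ a x → (a :- con (ℤ.+ 1)) :* x := a :* x :- x) refl a x ⟩
    a * x - x     ≈⟨ x≈y⇒x-y≈0 ax≈x ⟩
    0#            ∎)

  fromℕ-+ : ∀ m n → fromℕ (m ℕ.+ n) ≈ fromℕ m + fromℕ n
  fromℕ-+ = ×-homo-+ 1#

  fromℕ-* : ∀ m n → fromℕ (m ℕ.* n) ≈ fromℕ m * fromℕ n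
  fromℕ-* = ×1-homo-*

  fromℕ-^ : ∀ m n → fromℕ (m ℕ.^ n) ≈ fromℕ m ^ n
  fromℕ-^ m zero    = +-identityʳ 1#
  fromℕ-^ m (suc n) = trans (fromℕ-* m (m ℕ.^ n)) (*-congˡ (fromℕ-^ m n))

  ×≈fromℕ* : ∀ n x → n ×ᴹ x ≈ fromℕ n * x
  ×≈fromℕ* n x = sym (trans (×-assoc-* n 1# x) (Mult.×-congʳ semiring n (*-identityˡ x)))

  fromℕ2≈1+1 : fromℕ 2 ≈ 1# + 1#
  fromℕ2≈1+1 = +-congˡ (+-identityʳ 1#)

  1^n≈1 : ∀ n → 1# ^ n ≈ 1#
  1^n≈1 zero    = refl
  1^n≈1 (suc n) = trans (*-identityˡ _) (1^n≈1 n)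

  xⁿ≈0⇒x≈0 : ∀ n {x} → x ^ n ≈ 0# → x ≈ 0#
  xⁿ≈0⇒x≈0 zero    1≈0 = contradiction 1≈0 1≉0
  xⁿ≈0⇒x≈0 (suc n) {x} xxⁿ≈0 = ≈-stable λ x#0 →
    #⇒≉ x#0 (xⁿ≈0⇒x≈0 n (x≉0⇒xy≈0⇒y≈0 (#⇒≉ x#0) xxⁿ≈0))

  ^#0 : ∀ n {x} → x # 0# → x ^ n # 0#
  ^#0 zero    _   = 1#0
  ^#0 (suc n) x#0 = HeytingProperties.x#0y#0→xy#0 heytingCommutativeRing x#0 (^#0 n x#0)

  xᵐ≈1⇒xᵐⁿ≈1 : ∀ {x} m n → x ^ m ≈ 1# → x ^ (m ℕ.* n) ≈ 1#
  xᵐ≈1⇒xᵐⁿ≈1 {x} m n xᵐ≈1 =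
    trans (sym (^-assocʳ x m n)) (trans (^-congˡ n xᵐ≈1) (1^n≈1 n))

  ^-comm : ∀ x m n → (x ^ m) ^ n ≈ (x ^ n) ^ m
  ^-comm x m n = trans (^-assocʳ x m n) (trans (reflexive (≡.cong (x ^_) (ℕ.*-comm m n)))
    (sym (^-assocʳ x n m)))

  -- Horner evaluation of l Xⁿ + vₙ₋₁ Xⁿ⁻¹ + ⋯ + v₀.
  eval : Carrier → ∀ {n} → Vec Carrier n → Carrier → Carrier
  eval l []      x = l
  eval l (a ∷ v) x = a + x * eval l v x

  eval-+ : ∀ l l′ {n} (v v′ : Vec Carrier n) x →
           eval (l + l′) (zipWith _+_ v v′) x ≈ eval l v x + eval l′ v′ x
  eval-+ l l′ []      []        x = refl
  eval-+ l l′ (a ∷ v) (a′ ∷ v′) x = trans (+-congˡ (*-congˡ (eval-+ l l′ v v′ x)))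
    (solve 5 (λ a a′ x e e′ → (a :+ a′) :+ x :* (e :+ e′) := (a :+ x :* e) :+ (a′ :+ x :* e′))
      refl a a′ x _ _)

  -- Formal degree n with coefficient l at Xⁿ. The case `l = 0#` is allowed and expresses degree
  -- below n, so that lower terms can be added to a monic term of degree n.
  HasLeading : ∀ n → Carrier → (Carrier → Carrier) → Set _
  HasLeading n l f = Σ (Vec Carrier n) λ v → ∀ x → f x ≈ eval l v x

  leading-+ : ∀ {n l l′ f g} → HasLeading n l f → HasLeading n l′ g →
              HasLeading n (l + l′) (λ x → f x + g x)
  leading-+ (v , f≈) (v′ , g≈) =
    zipWith _+_ v v′ , λ x → trans (+-cong (f≈ x) (g≈ x)) (sym (eval-+ _ _ v v′ x))

  leading-0 : ∀ n → HasLeading n 0# (λ _ → 0#)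
  leading-0 zero    = [] , λ _ → refl
  leading-0 (suc n) with v , 0≈ ← leading-0 n =
    0# ∷ v , λ x → sym (trans (+-identityˡ _) (trans (*-congˡ (sym (0≈ x))) (zeroʳ x)))

  leading-cong : ∀ {n l l′ f g} → l ≈ l′ → (∀ x → f x ≈ g x) →
                 HasLeading n l f → HasLeading n l′ g
  leading-cong l≈ f≈g (v , f≈) =
    v , λ x → trans (sym (f≈g x)) (trans (f≈ x) (eval-congˡ v x))
    where
    eval-congˡ : ∀ {n} (v : Vec Carrier n) x → eval _ v x ≈ eval _ v x
    eval-congˡ []      x = l≈
    eval-congˡ (a ∷ v) x = +-congˡ (*-congˡ (eval-congˡ v x))

  leading-X* : ∀ {n l f} → HasLeading n l f → HasLeading (suc n) l (λ x → x * f x)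
  leading-X* (v , f≈) = 0# ∷ v , λ x → trans (*-congˡ (f≈ x)) (sym (+-identityˡ _))

  leading-const : ∀ n a → HasLeading (suc n) 0# (λ _ → a)
  leading-const n a with v , 0≈ ← leading-0 n =
    a ∷ v , λ x → sym (trans (+-congˡ (trans (*-congˡ (sym (0≈ x))) (zeroʳ x))) (+-identityʳ a))

  leading-^ : ∀ n → HasLeading n 1# (_^ n)
  leading-^ zero    = [] , λ _ → refl
  leading-^ (suc n) = leading-X* (leading-^ n)

  lower-^ : ∀ {m n} → m ℕ.< n → HasLeading n 0# (_^ m)
  lower-^ {zero}  {suc n} _           = leading-const n 1#
  lower-^ {suc m} {suc n} (ℕ.s≤s m<n) = leading-X* (lower-^ m<n)

  -- Synthetic division by X - a. The quotient keeps the leading coefficient l, so a monic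
  -- polynomial stays monic.
  divide : ∀ l {n} (v : Vec Carrier (suc n)) a → Σ (Vec Carrier n) λ w →
           ∀ x → eval l v x - eval l v a ≈ (x - a) * eval l w x
  divide l (b ∷ [])    a = [] , λ x →
    solve 4 (λ b x l a → (b :+ x :* l) :- (b :+ a :* l) := (x :- a) :* l) refl b x l a
  divide l (b ∷ v@(_ ∷ _)) a with w , e ← divide l v a = eval l v a ∷ w , λ x → begin
    (b + x * eval l v x) - (b + a * eval l v a)
      ≈⟨ solve 5 (λ b x a f g → (b :+ x :* f) :- (b :+ a :* g)
                   := (x :- a) :* g :+ x :* (f :- g)) refl b x a _ _ ⟩
    (x - a) * eval l v a + x * (eval l v x - eval l v a)
      ≈⟨ +-congˡ (*-congˡ (e x)) ⟩
    (x - a) * eval l v a + x * ((x - a) * eval l w x)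
      ≈⟨ solve 4 (λ d g x h → d :* g :+ x :* (d :* h) := d :* (g :+ x :* h)) refl (x - a) _ x _ ⟩
    (x - a) * (eval l v a + x * eval l w x)  ∎

  -- Dividing by X minus the first root leaves a monic polynomial of one degree less. It vanishes at
  -- the remaining roots because they differ from the first; in degree 0 this says 1 ≈ 0.
  roots≤degree : ∀ {n f} → HasLeading n 1# f → (ρ : Fin (suc n) → Carrier) →
                 (∀ {i j} → ρ i ≈ ρ j → i ≡ j) → ¬ (∀ i → f (ρ i) ≈ 0#)
  roots≤degree {n} (v , f≈) ρ ρ-injective zeros =
    go v ρ ρ-injective λ i → trans (sym (f≈ (ρ i))) (zeros i)
    where
    go : ∀ {n} (v : Vec Carrier n) (ρ : Fin (suc n) → Carrier) →
         (∀ {i j} → ρ i ≈ ρ j → i ≡ j) → ¬ (∀ i → eval 1# v (ρ i) ≈ 0#)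
    go []        ρ inj zeros = 1≉0 (zeros Fin.zero)
    go v@(_ ∷ _) ρ inj zeros with w , e ← divide 1# v (ρ Fin.zero) =
      go w (ρ ∘ Fin.suc) (Fin.suc-injective ∘ inj) λ i → x≉0⇒xy≈0⇒y≈0
        (λ z → contradiction (inj (x-y≈0⇒x≈y z)) λ ())
        (trans (sym (e _)) (x≈y⇒x-y≈0 (trans (zeros (Fin.suc i)) (sym (zeros Fin.zero)))))

-- Functions on the units, extended to the whole finite field.

module ExtendFromUnits (F : HeytingField c ℓ r) {n} (card : HasCardinality F n)
                       (S : Setoid c′ ℓ′) where
  private module F = FieldNotions F
  open FiniteField F card
  open FieldProperties F using (#⇒≉)
  open Setoid S

  opaque
    -- Sums over the units become sums over the whole field, which can be reindexed by translations
    -- and other bijections that move 0. The value z is 0 for summands and 1 for factors.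
    extend : Carrier → (F.Unit → Carrier) → F.Carrier → Carrier
    extend z f x with nonzero? x
    ... | yes x#0 = f (x , x#0)
    ... | no  _   = z

  module _ (z : Carrier) {f : F.Unit → Carrier}
           (f-cong : ∀ {u v} → proj₁ u F.≈ proj₁ v → f u ≈ f v) where
    opaque
      unfolding extend

      extend-unit : ∀ u → extend z f (proj₁ u) ≈ f u
      extend-unit (x , x#0) with nonzero? x
      ... | yes _    = f-cong F.refl
      ... | no  ¬x#0 = contradiction x#0 ¬x#0

      extend-0 : ∀ {x} → x F.≈ F.0# → extend z f x ≈ z
      extend-0 {x} x≈0 with nonzero? x
      ... | yes x#0 = contradiction x≈0 (#⇒≉ x#0)
      ... | no  _   = refl

    extend-cong : ∀ {x y} → x F.≈ y → extend z f x ≈ extend z f y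
    extend-cong {x} {y} x≈y with nonzero? x
    ... | yes x#0 = trans (extend-unit (x , x#0)) (trans (f-cong x≈y)
      (sym (extend-unit (y , HeytingProperties.#-congʳ F.heytingCommutativeRing x≈y x#0))))
    ... | no ¬x#0 = trans (extend-0 x≈0) (sym (extend-0 (F.trans (F.sym x≈y) x≈0)))
      where x≈0 = proj₁ (F.tight x F.0#) ¬x#0

-- Sums and products over a finite field.

module FiniteFieldSum (F : HeytingField c ℓ r) {n} (card : HasCardinality F (suc n))
                      (M : CommutativeMonoid c′ ℓ′) where
  private module F = FieldNotions F
  open FiniteField F card
  open Inverse card using (to; from; inverseˡ; inverseʳ)
  open CommutativeMonoid M
  open CommutativeMonoidSum M
  open MonoidMult monoid using () renaming (_×_ to _×ᴹ_)
  open ≈-Reasoning setoid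

  opaque
    -- A general commutative monoid serves both the sums with values in F or K and the product in
    -- Fermat's theorem.
    Σᶠ : (F.Carrier → Carrier) → Carrier
    Σᶠ f = sum (f ∘ from)

    Σᶠ≈sum : ∀ f → Σᶠ f ≈ sum (f ∘ from)
    Σᶠ≈sum f = refl

    Σᶠ-cong : ∀ {f g} → (∀ x → f x ≈ g x) → Σᶠ f ≈ Σᶠ g
    Σᶠ-cong f≈g = sum-cong-≋ (f≈g ∘ from)

    Σᶠ-∙ : ∀ f g → Σᶠ (λ x → f x ∙ g x) ≈ Σᶠ f ∙ Σᶠ g
    Σᶠ-∙ f g = ∑-distrib-+ (f ∘ from) (g ∘ from)

    Σᶠ-comm : ∀ (f : F.Carrier → F.Carrier → Carrier) → Σᶠ (λ x → Σᶠ λ y → f x y) ≈ Σᶠ (λ y → Σᶠ λ x → f x y)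
    Σᶠ-comm f = ∑-comm {suc n} {suc n} λ i j → f (from i) (from j)

    Σᶠ-const : ∀ a → Σᶠ (λ _ → a) ≈ suc n ×ᴹ a
    Σᶠ-const a = sum-replicate (suc n)

    Σᶠ-reindex : ∀ {f} (π π⁻¹ : F.Carrier → F.Carrier) →
                 (∀ {x y} → x F.≈ y → f x ≈ f y) →
                 (∀ {x y} → x F.≈ y → π x F.≈ π y) →
                 (∀ {x y} → x F.≈ y → π⁻¹ x F.≈ π⁻¹ y) →
                 (∀ x → π (π⁻¹ x) F.≈ x) → (∀ x → π⁻¹ (π x) F.≈ x) →
                 Σᶠ f ≈ Σᶠ (f ∘ π)
    Σᶠ-reindex {f} π π⁻¹ f-cong π-cong π⁻¹-cong ππ⁻¹ π⁻¹π = begin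
      Σᶠ f                                  ≈⟨ sum-permute (f ∘ from) ϖ ⟩
      sum (λ i → f (from (to (π (from i)))))
        ≈⟨ sum-cong-≋ {suc n} (λ i → f-cong {_} {π (from i)} (inverseʳ ≡.refl)) ⟩
      Σᶠ (f ∘ π)                            ∎
      where
      ϖ : Permutation (suc n) (suc n)
      ϖ = permutation (to ∘ π ∘ from) (to ∘ π⁻¹ ∘ from)
        (λ i → inverseˡ (F.trans (π-cong (inverseʳ ≡.refl)) (ππ⁻¹ _)))
        (λ i → inverseˡ (F.trans (π⁻¹-cong (inverseʳ ≡.refl)) (π⁻¹π _)))

  nonzero : Fin n → F.Carrier
  nonzero = from ∘ punchIn (to F.0#)

  nonzero-injective : ∀ {i j} → nonzero i F.≈ nonzero j → i ≡ j
  nonzero-injective {i} {j} e = Fin.punchIn-injective (to F.0#) i j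
    (≡.trans (≡.sym (inverseˡ F.refl)) (inverseˡ e))

  nonzero≉0 : ∀ i → ¬ (nonzero i F.≈ F.0#)
  nonzero≉0 i e = Fin.punchInᵢ≢i (to F.0#) i
    (≡.sym (inverseˡ (F.sym e)))

  Σᶠ-split : ∀ {f} → (∀ {x y} → x F.≈ y → f x ≈ f y) →
             Σᶠ f ≈ f F.0# ∙ sum (f ∘ nonzero)
  Σᶠ-split {f} f-cong = begin
    Σᶠ f   ≈⟨ Σᶠ≈sum f ⟩
    sum (f ∘ from) ≈⟨ sum-remove {i = to F.0#} (f ∘ from) ⟩
    f (from (to F.0#)) ∙ sum (f ∘ nonzero) ≈⟨ ∙-congʳ (f-cong (inverseʳ ≡.refl)) ⟩
    f F.0# ∙ sum (f ∘ nonzero)  ∎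

  Σᶠ-split-const : ∀ {f a} → (∀ {x y} → x F.≈ y → f x ≈ f y) →
                   (∀ x → ¬ (x F.≈ F.0#) → f x ≈ a) → Σᶠ f ≈ f F.0# ∙ n ×ᴹ a
  Σᶠ-split-const {f} {a} f-cong f≈a = begin
    Σᶠ f                        ≈⟨ Σᶠ-split f-cong ⟩
    f F.0# ∙ sum (f ∘ nonzero)  ≈⟨ ∙-congˡ (sum-cong-≋ λ i → f≈a _ (nonzero≉0 i)) ⟩
    f F.0# ∙ sum {n} (λ _ → a)  ≈⟨ ∙-congˡ (sum-replicate n) ⟩
    f F.0# ∙ n ×ᴹ a              ∎

-- Characteristic and Fermat's little theorem.

module FiniteFieldProperties (F : HeytingField c ℓ r) {n} (card : HasCardinality F (suc n)) where
  open FieldNotions F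
  open FieldProperties F
  open FiniteField F card
  open Inverse card using (from)
  open CommutativeRing commutativeRing using (+-commutativeMonoid; *-commutativeMonoid)
  open ≈-Reasoning setoid
  private
    module Sum = FiniteFieldSum F card +-commutativeMonoid
    module Prod = FiniteFieldSum F card *-commutativeMonoid

  ≉0⇒#0 : ∀ {x} → ¬ (x ≈ 0#) → x # 0#
  ≉0⇒#0 {x} x≉0 with nonzero? x
  ... | yes x#0  = x#0
  ... | no  ¬x#0 = contradiction (≈-stable ¬x#0) x≉0

  -- Translation by 1 permutes the field, so the sum of all x equals the sum of all 1 + x, which
  -- exceeds it by q · 1.
  fromℕ-card : fromℕ (suc n) ≈ 0#
  fromℕ-card = begin
    fromℕ (suc n)            ≈⟨ Sum.Σᶠ-const 1# ⟨
    Sum.Σᶠ (λ _ → 1#)        ≈⟨ +-identityʳ _ ⟨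
    Sum.Σᶠ (λ _ → 1#) + 0#   ≈⟨ +-congˡ (-‿inverseʳ S) ⟨
    Sum.Σᶠ (λ _ → 1#) + (S - S)  ≈⟨ +-assoc _ _ _ ⟨
    (Sum.Σᶠ (λ _ → 1#) + S) - S  ≈⟨ +-congʳ (Sum.Σᶠ-∙ _ _) ⟨
    Sum.Σᶠ (λ x → 1# + x) - S    ≈⟨ +-congʳ (Sum.Σᶠ-reindex (1# +_) (λ x → x - 1#) (λ e → e) +-congˡ +-congʳ
      (λ x → solve 1 (λ x → con (ℤ.+ 1) :+ (x :- con (ℤ.+ 1)) := x) refl x)
      (λ x → solve 1 (λ x → (con (ℤ.+ 1) :+ x) :- con (ℤ.+ 1) := x) refl x)) ⟨
    S - S  ≈⟨ -‿inverseʳ S ⟩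
    0# ∎
    where S = Sum.Σᶠ (λ x → x)

  private module Ext = ExtendFromUnits F card setoid

  ≈0∨unit : ∀ x → x ≈ 0# ⊎ x # 0#
  ≈0∨unit x with nonzero? x
  ... | yes x#0  = inj₂ x#0
  ... | no  ¬x#0 = inj₁ (≈-stable ¬x#0)

  open HeytingProperties heytingCommutativeRing using (#-congʳ)

  product#0 : ∀ {m} (f : Fin m → Carrier) → (∀ i → f i # 0#) →
              CommutativeMonoidSum.sum *-commutativeMonoid f # 0#
  product#0 {zero}  f f#0 = 1#0
  product#0 {suc m} f f#0 = HeytingProperties.x#0y#0→xy#0 heytingCommutativeRing
    (f#0 Fin.zero) (product#0 (f ∘ Fin.suc) (f#0 ∘ Fin.suc))

  -- Multiplication by x permutes the nonzero elements, hence fixes their product.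
  fermat : ∀ {x} → x # 0# → x ^ n ≈ 1#
  fermat {x} x#0 = *-cancelˡ (P , P#0) (begin
    P * x ^ n                ≈⟨ *-comm P _ ⟩
    x ^ n * P                ≈⟨ *-congʳ (*-identityˡ _) ⟨
    1# * x ^ n * P
      ≈⟨ *-congʳ (trans (Prod.Σᶠ-split-const factor-cong λ y y≉0 → Ext.extend-unit 1# (λ _ → refl) (y , ≉0⇒#0 y≉0))
                        (*-congʳ (Ext.extend-0 1# (λ _ → refl) refl))) ⟨
    Prod.Σᶠ factor * P       ≈⟨ Prod.Σᶠ-∙ _ _ ⟨
    Prod.Σᶠ (λ y → factor y * value y)  ≈⟨ Prod.Σᶠ-cong value-* ⟨
    Prod.Σᶠ (λ y → value (x * y))       ≈⟨ Prod.Σᶠ-reindex (x *_) (x⁻¹ *_) value-cong *-congˡ *-congˡ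
      (λ y → trans (sym (*-assoc _ _ _)) (trans (*-congʳ (*-inverseʳ u)) (*-identityˡ y)))
      (λ y → trans (sym (*-assoc _ _ _)) (trans (*-congʳ (trans (*-comm _ _) (*-inverseʳ u))) (*-identityˡ y))) ⟨
    P                        ≈⟨ *-identityʳ P ⟨
    P * 1# ∎)
    where
    u : Unit
    u = x , x#0

    x⁻¹ = proj₁ (u ⁻¹)

    -- Both take the value 1 at 0, so products over the whole field are products over the units, and
    -- the product of `factor` is x ^ n.
    value factor : Carrier → Carrier
    value  = Ext.extend 1# proj₁
    factor = Ext.extend 1# (λ _ → x)

    value-cong : ∀ {y z} → y ≈ z → value y ≈ value z
    value-cong = Ext.extend-cong 1# (λ e → e)

    factor-cong : ∀ {y z} → y ≈ z → factor y ≈ factor z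
    factor-cong = Ext.extend-cong 1# (λ _ → refl)

    P = Prod.Σᶠ value

    value#0 : ∀ y → value y # 0#
    value#0 y with ≈0∨unit y
    ... | inj₁ y≈0 = #-congʳ (sym (Ext.extend-0 1# (λ e → e) y≈0)) 1#0
    ... | inj₂ y#0 = #-congʳ (sym (Ext.extend-unit 1# (λ e → e) (y , y#0))) y#0

    P#0 : P # 0#
    P#0 = #-congʳ (sym (Prod.Σᶠ≈sum value)) (product#0 (value ∘ from) (value#0 ∘ from))

    value-* : ∀ y → value (x * y) ≈ factor y * value y
    value-* y with ≈0∨unit y
    ... | inj₁ y≈0 = begin
      value (x * y)       ≈⟨ Ext.extend-0 1# (λ e → e) (trans (*-congˡ y≈0) (zeroʳ x)) ⟩
      1#                  ≈⟨ *-identityˡ 1# ⟨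
      1# * 1#             ≈⟨ *-cong (Ext.extend-0 1# (λ _ → refl) y≈0) (Ext.extend-0 1# (λ e → e) y≈0) ⟨
      factor y * value y  ∎
    ... | inj₂ y#0 = begin
      value (x * y)       ≈⟨ Ext.extend-unit 1# (λ e → e) (u *ᵘ (y , y#0)) ⟩
      x * y               ≈⟨ *-cong (Ext.extend-unit 1# (λ _ → refl) (y , y#0)) (Ext.extend-unit 1# (λ e → e) (y , y#0)) ⟨
      factor y * value y  ∎

-- Binomial coefficients modulo a prime.

prime∤⇒coprime : ∀ {p m} → Prime p → p ∤ m → Coprime p m
prime∤⇒coprime p-prime p∤m (d∣p , d∣m) with prime⇒irreducible p-prime d∣p
... | inj₁ d≡1 = d≡1
... | inj₂ ≡.refl = contradiction d∣m p∤m

prime∤! : ∀ {p} → Prime p → ∀ {j} → j ℕ.< p → p ∤ j !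
prime∤! p-prime {zero}  1<p p∣1 = ℕ.<-irrefl ≡.refl
  (ℕ.≤-trans (ℕ.nonTrivial⇒n>1 _ {{prime⇒nonTrivial p-prime}}) (∣⇒≤ p∣1))
prime∤! p-prime {suc j} j<p p∣ with euclidsLemma (suc j) (j !) p-prime p∣
... | inj₁ p∣1+j = ℕ.<⇒≱ j<p (∣⇒≤ p∣1+j)
... | inj₂ p∣j!  = prime∤! p-prime (ℕ.<⇒≤ j<p) p∣j!

-- p divides p! = C(p, j) · j! · (p - j)! but neither of the two factorials on the right, all of
-- whose factors are below p.
prime∣C : ∀ {p} → Prime p → ∀ {j} → 0 ℕ.< j → j ℕ.< p → p ∣ p C j
prime∣C {p@(suc p′)} p-prime {j@(suc j′)} _ j<p
  with euclidsLemma (p C j) (j ! ℕ.* (p ∸ j) !) p-prime (≡.subst (p ∣_) (≡.sym C*≡!) (m∣m*n (p′ !)))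
  where
  instance
    _ : NonZero (j ! ℕ.* (p ∸ j) !)
    _ = j ℕ.!* (p ∸ j) !≢0
  C*≡! : (p C j) ℕ.* (j ! ℕ.* (p ∸ j) !) ≡ p !
  C*≡! = ≡.trans (≡.cong (ℕ._* (j ! ℕ.* (p ∸ j) !)) (nCk≡n!/k![n-k]! (ℕ.<⇒≤ j<p)))
                 (m/n*n≡m (k![n∸k]!∣n! (ℕ.<⇒≤ j<p)))
... | inj₁ p∣C = p∣C
... | inj₂ p∣! with euclidsLemma (j !) ((p ∸ j) !) p-prime p∣!
...   | inj₁ p∣j! = contradiction p∣j! (prime∤! p-prime j<p)
...   | inj₂ p∣[p-j]! = contradiction p∣[p-j]! (prime∤! p-prime (ℕ.s≤s (ℕ.m∸n≤m p′ j′)))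

module ListSum (K : HeytingField c ℓ r) where
  open FieldNotions K
  open SemiringSum semiring using (sum)

  sumOver-applyUpTo : ∀ {a} {A : Set a} (h : ℕ → A) (f : A → Carrier) n →
                      sumOver (List.applyUpTo h n) f ≡ sum {n} (f ∘ h ∘ toℕ)
  sumOver-applyUpTo h f zero    = ≡.refl
  sumOver-applyUpTo h f (suc n) = ≡.cong (f (h 0) +_) (sumOver-applyUpTo (h ∘ suc) f n)

  sumOver-upTo : ∀ (f : ℕ → Carrier) n → sumOver (List.upTo n) f ≡ sum {n} (f ∘ toℕ)
  sumOver-upTo = sumOver-applyUpTo (λ i → i)

-- Frobenius and the prime field.

module PrimeCharacteristic (F : HeytingField c ℓ r) {p} (p-prime : Prime p)
                           (fromℕp≈0 : FieldNotions._≈_ F (FieldNotions.fromℕ F p) (FieldNotions.0# F)) where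
  open FieldNotions F
  open FieldProperties F
  open CommutativeRing commutativeRing using (commutativeSemiring)
  open SemiringSum semiring using (sum; sum-cong-≋; sum-init-last; sum-replicate-zero)
  open ≈-Reasoning setoid

  1<p : 1 ℕ.< p
  1<p = ℕ.nonTrivial⇒n>1 p {{prime⇒nonTrivial p-prime}}

  p∣m⇒fromℕm≈0 : ∀ {m} → p ∣ m → fromℕ m ≈ 0#
  p∣m⇒fromℕm≈0 (divides k ≡.refl) = trans (fromℕ-* k p) (trans (*-congˡ fromℕp≈0) (zeroʳ _))

  private
    0≉1+0 : ∀ {a b} x y → fromℕ a ≈ 0# → fromℕ b ≈ 0# → ¬ (1 ℕ.+ x ℕ.* a ≡ y ℕ.* b)
    0≉1+0 {a} {b} x y a≈0 b≈0 e = 1≉0 (begin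
      1#                         ≈⟨ +-identityʳ 1# ⟨
      1# + 0#                    ≈⟨ +-congˡ (trans (fromℕ-* x a) (trans (*-congˡ a≈0) (zeroʳ _))) ⟨
      fromℕ (1 ℕ.+ x ℕ.* a)      ≡⟨ ≡.cong fromℕ e ⟩
      fromℕ (y ℕ.* b)            ≈⟨ trans (fromℕ-* y b) (trans (*-congˡ b≈0) (zeroʳ _)) ⟩
      0#                         ∎)

  -- If p ∤ m, a Bézout identity between p and m makes 1 a combination of two numbers that both
  -- vanish in F.
  fromℕm≈0⇒p∣m : ∀ {m} → fromℕ m ≈ 0# → p ∣ m
  fromℕm≈0⇒p∣m {m} m≈0 with p ∣.∣? m
  ... | yes p∣m = p∣m
  ... | no  p∤m with coprime-Bézout (prime∤⇒coprime p-prime p∤m)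
  ...   | Bézout.+- x y e = contradiction e (0≉1+0 y x m≈0 fromℕp≈0)
  ...   | Bézout.-+ x y e = contradiction e (0≉1+0 x y fromℕp≈0 m≈0)

  fromℕ-congruent : ∀ {a b} → a ≤ b → fromℕ a ≈ fromℕ b → ∃ λ m → b ≡ a ℕ.+ p ℕ.* m
  fromℕ-congruent {a} {b} a≤b a≈b with fromℕm≈0⇒p∣m {b ∸ a} (begin
      fromℕ (b ∸ a)                      ≈⟨ solve 2 (λ a d → d := (d :+ a) :- a) refl (fromℕ a) _ ⟩
      (fromℕ (b ∸ a) + fromℕ a) - fromℕ a  ≈⟨ +-congʳ (fromℕ-+ (b ∸ a) a) ⟨
      fromℕ (b ∸ a ℕ.+ a) - fromℕ a      ≡⟨ ≡.cong (λ k → fromℕ k - fromℕ a) (ℕ.m∸n+n≡m a≤b) ⟩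
      fromℕ b - fromℕ a                  ≈⟨ x≈y⇒x-y≈0 (sym a≈b) ⟩
      0# ∎)
  ... | divides m e = m , ≡.trans (≡.sym (ℕ.m+[n∸m]≡n a≤b))
                                  (≡.cong (a ℕ.+_) (≡.trans e (ℕ.*-comm m p)))

  private
    congruent<⇒≡ : ∀ {a b} → b ℕ.< p → (∃ λ m → b ≡ a ℕ.+ p ℕ.* m) → a ≡ b
    congruent<⇒≡ {a} b<p (zero , ≡.refl) =
      ≡.sym (≡.trans (≡.cong (a ℕ.+_) (ℕ.*-zeroʳ p)) (ℕ.+-identityʳ a))
    congruent<⇒≡ {a} b<p (suc m , ≡.refl) = contradiction
      (ℕ.≤-trans (ℕ.m≤m*n p (suc m)) (ℕ.m≤n+m (p ℕ.* suc m) a)) (ℕ.<⇒≱ b<p)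

  fromℕ-injective : ∀ {a b} → a ℕ.< p → b ℕ.< p → fromℕ a ≈ fromℕ b → a ≡ b
  fromℕ-injective {a} {b} a<p b<p a≈b with ℕ.≤-total a b
  ... | inj₁ a≤b = congruent<⇒≡ b<p (fromℕ-congruent a≤b a≈b)
  ... | inj₂ b≤a = ≡.sym (congruent<⇒≡ a<p (fromℕ-congruent b≤a (sym a≈b)))

  -- All terms of the binomial expansion except the two outer ones carry a coefficient divisible by
  -- p.
  frobenius-+ : ∀ x y → (x + y) ^ p ≈ x ^ p + y ^ p
  frobenius-+ x y = go p ≡.refl
    where
    module B = Binomial commutativeSemiring

    -- The copy m of p exposes the successor needed to split the expansion into first, middle and
    -- last terms.
    go : ∀ m → m ≡ p → (x + y) ^ m ≈ x ^ m + y ^ m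
    go zero ≡.refl = contradiction p-prime ¬prime[0]
    go (suc m) e = begin
      (x + y) ^ suc m                            ≈⟨ B.theorem (suc m) x y ⟩
      t Fin.zero + sum (t ∘ Fin.suc)             ≈⟨ +-congˡ (sum-init-last (t ∘ Fin.suc)) ⟩
      t Fin.zero + (sum (λ i → t (Fin.suc (Fin.inject₁ i))) + t (Fin.suc (Fin.fromℕ m)))
        ≈⟨ +-cong first (+-cong middle final) ⟩
      y ^ suc m + (0# + x ^ suc m)               ≈⟨ trans (+-congˡ (+-identityˡ _)) (+-comm _ _) ⟩
      x ^ suc m + y ^ suc m                      ∎
      where
      t = B.binomialTerm x y (suc m)

      first : t Fin.zero ≈ y ^ suc m
      first = trans (+-identityʳ _) (*-identityˡ _)

      final : t (Fin.suc (Fin.fromℕ m)) ≈ x ^ suc m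
      final rewrite Fin.toℕ-fromℕ m | nCn≡1 (suc m) | ℕ.n∸n≡0 m =
        trans (+-identityʳ _) (*-identityʳ _)

      middle : sum (λ i → t (Fin.suc (Fin.inject₁ i))) ≈ 0#
      middle = trans (sum-cong-≋ λ i → trans (×≈fromℕ* (suc m C suc (toℕ (Fin.inject₁ i))) _) (trans (*-congʳ (p∣m⇒fromℕm≈0
          (≡.subst (λ z → p ∣ z C suc (toℕ (Fin.inject₁ i))) (≡.sym e)
            (prime∣C p-prime (ℕ.s≤s ℕ.z≤n)
              (≡.subst₂ (λ a b → suc a ℕ.< b) (≡.sym (Fin.toℕ-inject₁ i)) e (ℕ.s≤s (Fin.toℕ<n i)))))))
          (zeroˡ _)))
        (sum-replicate-zero m)

  frobenius^-+ : ∀ i x y → (x + y) ^ (p ℕ.^ i) ≈ x ^ (p ℕ.^ i) + y ^ (p ℕ.^ i)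
  frobenius^-+ zero    x y = trans (*-identityʳ _) (sym (+-cong (*-identityʳ _) (*-identityʳ _)))
  frobenius^-+ (suc i) x y = begin
    (x + y) ^ (p ℕ.* p ℕ.^ i)                  ≈⟨ ^-assocʳ _ p _ ⟨
    ((x + y) ^ p) ^ (p ℕ.^ i)                  ≈⟨ ^-congˡ (p ℕ.^ i) (frobenius-+ x y) ⟩
    (x ^ p + y ^ p) ^ (p ℕ.^ i)                ≈⟨ frobenius^-+ i _ _ ⟩
    (x ^ p) ^ (p ℕ.^ i) + (y ^ p) ^ (p ℕ.^ i)  ≈⟨ +-cong (^-assocʳ x p _) (^-assocʳ y p _) ⟩
    x ^ (p ℕ.^ suc i) + y ^ (p ℕ.^ suc i)      ∎

  0^p≈0 : 0# ^ p ≈ 0#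
  0^p≈0 = go 1<p
    where
    go : ∀ {m} → 1 ℕ.< m → 0# ^ m ≈ 0#
    go {suc m} _ = zeroˡ _

  frobenius-sum : ∀ {n} (f : Fin n → Carrier) → sum f ^ p ≈ sum (λ i → f i ^ p)
  frobenius-sum {zero}  f = 0^p≈0
  frobenius-sum {suc n} f = trans (frobenius-+ _ _) (+-congˡ (frobenius-sum (f ∘ Fin.suc)))

  frobenius-fromℕ : ∀ m → fromℕ m ^ p ≈ fromℕ m
  frobenius-fromℕ zero    = 0^p≈0
  frobenius-fromℕ (suc m) = trans (frobenius-+ _ _) (+-cong (1^n≈1 p) (frobenius-fromℕ m))

  -- The p elements of the prime field exhaust the roots of Xᵖ − X.
  frobenius-fixed : ∀ {y} → y ^ p ≈ y → ¬ (∀ (i : Fin p) → ¬ (fromℕ (toℕ i) ≈ y))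
  frobenius-fixed {y} yᵖ≈y y≉ = roots≤degree leading ρ ρ-injective zeros
    where
    leading : HasLeading p 1# (λ x → x ^ p + x * - 1#)
    leading = leading-cong (+-identityʳ 1#) (λ _ → refl) (leading-+ (leading-^ p)
      (go p 1<p))
      where
      go : ∀ m → 1 ℕ.< m → HasLeading m 0# (λ x → x * - 1#)
      go (suc (suc m)) _ = leading-X* (leading-const m (- 1#))
      go (suc zero) (ℕ.s≤s ())

    ρ : Fin (suc p) → Carrier
    ρ Fin.zero    = y
    ρ (Fin.suc i) = fromℕ (toℕ i)

    ρ-injective : ∀ {i j} → ρ i ≈ ρ j → i ≡ j
    ρ-injective {Fin.zero}  {Fin.zero}  e = ≡.refl
    ρ-injective {Fin.zero}  {Fin.suc j} e = contradiction (sym e) (y≉ j)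
    ρ-injective {Fin.suc i} {Fin.zero}  e = contradiction e (y≉ i)
    ρ-injective {Fin.suc i} {Fin.suc j} e =
      ≡.cong Fin.suc (Fin.toℕ-injective (fromℕ-injective (Fin.toℕ<n i) (Fin.toℕ<n j) e))

    fixed⇒zero : ∀ {x} → x ^ p ≈ x → x ^ p + x * - 1# ≈ 0#
    fixed⇒zero {x} e = trans (+-congʳ e) (solve 1 (λ x → x :+ x :* (:- con (ℤ.+ 1)) := con (ℤ.+ 0)) refl x)

    zeros : ∀ i → ρ i ^ p + ρ i * - 1# ≈ 0#
    zeros Fin.zero    = fixed⇒zero yᵖ≈y
    zeros (Fin.suc i) = fixed⇒zero (frobenius-fromℕ (toℕ i))

-- The trace to the prime field.

module TraceProperties (F : HeytingField c ℓ r) {n} (card : HasCardinality F (suc n))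
                       {p k} (p-prime : Prime p) (q≡p^1+k : suc n ≡ p ℕ.^ suc k) where
  open FieldNotions F
  open FieldProperties F
  open FiniteField F card
  open FiniteFieldProperties F card
  open Trace p (suc k)
  open Inverse card using (from; inverseˡ)
  open ListSum F
  open SemiringSum semiring using (sum; sum-cong-≋; sum-init-last; ∑-distrib-+)
  open ≈-Reasoning setoid

  -- A power of p, namely q, vanishes in F, and a field has no nilpotent elements other than 0.
  fromℕp≈0 : fromℕ p ≈ 0#
  fromℕp≈0 = xⁿ≈0⇒x≈0 (suc k) (trans (sym (fromℕ-^ p (suc k)))
    (trans (reflexive (≡.cong fromℕ (≡.sym q≡p^1+k))) fromℕ-card))

  open PrimeCharacteristic F p-prime fromℕp≈0 public

  private
    conjugates : Carrier → Fin (suc k) → Carrier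
    conjugates x i = x ^ (p ℕ.^ toℕ i)

    trace≈sum : ∀ x → trace x ≈ sum (conjugates x)
    trace≈sum x = reflexive (sumOver-upTo (λ i → x ^ (p ℕ.^ i)) (suc k))

  trace-cong : ∀ {x y} → x ≈ y → trace x ≈ trace y
  trace-cong {x} {y} x≈y = trans (trace≈sum x) (trans
    (sum-cong-≋ {suc k} λ i → ^-congˡ (p ℕ.^ toℕ i) x≈y) (sym (trace≈sum y)))

  trace-+ : ∀ x y → trace (x + y) ≈ trace x + trace y
  trace-+ x y = begin
    trace (x + y)                              ≈⟨ trace≈sum (x + y) ⟩
    sum (conjugates (x + y))                   ≈⟨ sum-cong-≋ {suc k} (λ i → frobenius^-+ (toℕ i) x y) ⟩
    sum (λ i → conjugates x i + conjugates y i) ≈⟨ ∑-distrib-+ (conjugates x) (conjugates y) ⟩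
    sum (conjugates x) + sum (conjugates y)    ≈⟨ +-cong (trace≈sum x) (trace≈sum y) ⟨
    trace x + trace y                          ∎

  x^q≈x : ∀ x → x ^ suc n ≈ x
  x^q≈x x with ≈0∨unit x
  ... | inj₁ x≈0 = trans (*-congʳ x≈0) (trans (zeroˡ _) (sym x≈0))
  ... | inj₂ x#0 = trans (*-congˡ (fermat x#0)) (*-identityʳ x)

  -- Raising to the power p permutes the conjugates cyclically.
  trace^p : ∀ x → trace x ^ p ≈ trace x
  trace^p x = begin
    trace x ^ p                                      ≈⟨ ^-congˡ p (trace≈sum x) ⟩
    sum (conjugates x) ^ p                           ≈⟨ frobenius-sum (conjugates x) ⟩
    sum (λ i → conjugates x i ^ p)                   ≈⟨ sum-cong-≋ {suc k} (λ i → step (toℕ i)) ⟩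
    sum {suc k} (λ i → x ^ (p ℕ.^ suc (toℕ i)))      ≈⟨ sum-init-last {k} (λ i → x ^ (p ℕ.^ suc (toℕ i))) ⟩
    sum {k} (λ i → x ^ (p ℕ.^ suc (toℕ (Fin.inject₁ i)))) + x ^ (p ℕ.^ suc (toℕ (Fin.fromℕ k)))
      ≈⟨ +-cong (sum-cong-≋ {k} λ i → reflexive (≡.cong (λ j → x ^ (p ℕ.^ suc j)) (Fin.toℕ-inject₁ i)))
                (trans (reflexive (≡.cong (λ j → x ^ (p ℕ.^ suc j)) (Fin.toℕ-fromℕ k))) last) ⟩
    sum {k} (λ i → x ^ (p ℕ.^ suc (toℕ i))) + x ^ 1  ≈⟨ +-comm _ _ ⟩
    sum (conjugates x)                               ≈⟨ trace≈sum x ⟨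
    trace x                                          ∎
    where
    step : ∀ i → (x ^ (p ℕ.^ i)) ^ p ≈ x ^ (p ℕ.^ suc i)
    step i = trans (^-assocʳ x (p ℕ.^ i) p) (reflexive (≡.cong (x ^_) (ℕ.*-comm (p ℕ.^ i) p)))

    last : x ^ (p ℕ.^ suc k) ≈ x ^ 1
    last = trans (reflexive (≡.cong (x ^_) (≡.sym q≡p^1+k))) (trans (x^q≈x x) (sym (*-identityʳ x)))

  -- Being fixed by Frobenius, the trace lies in the prime field, so the default branch of `tr` is
  -- contradictory.
  fromℕ-tr : ∀ x → fromℕ (tr x) ≈ trace x
  fromℕ-tr x with Fin.any? {n = p} (λ i → fromℕ (toℕ i) ≟ trace x)
  ... | yes (_ , e) = e
  ... | no  ∄i      = contradiction (λ i e → ∄i (i , e)) (frobenius-fixed (trace^p x))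

  tr<p : ∀ x → tr x ℕ.< p
  tr<p x with Fin.any? {n = p} (λ i → fromℕ (toℕ i) ≟ trace x)
  ... | yes (i , _) = Fin.toℕ<n i
  -- The default value of `tr` is 0, and `1 ≤ p` is the required `0 < p`.
  ... | no  _       = ℕ.<⇒≤ 1<p

  -- With q = pᵏ⁺¹ the highest conjugate is x ^ (p ^ k), of degree below q. A monic polynomial of
  -- that degree cannot vanish on the whole field.
  leading-trace : HasLeading (p ℕ.^ k) 1# trace
  leading-trace = leading-cong (+-identityˡ 1#) (λ x → sym (begin
      trace x             ≈⟨ trace≈sum x ⟩
      sum (conjugates x)  ≈⟨ sum-init-last (conjugates x) ⟩
      sum {k} (λ i → x ^ (p ℕ.^ toℕ (Fin.inject₁ i))) + x ^ (p ℕ.^ toℕ (Fin.fromℕ k))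
        ≡⟨ ≡.cong (λ j → sum {k} (λ i → x ^ (p ℕ.^ toℕ (Fin.inject₁ i))) + x ^ (p ℕ.^ j)) (Fin.toℕ-fromℕ k) ⟩
      sum {k} (λ i → x ^ (p ℕ.^ toℕ (Fin.inject₁ i))) + x ^ (p ℕ.^ k) ∎))
    (leading-+ (lower k (λ i → p ℕ.^ toℕ (Fin.inject₁ i)) (λ i → ℕ.^-monoʳ-< p 1<p
        (≡.subst (ℕ._< k) (≡.sym (Fin.toℕ-inject₁ i)) (Fin.toℕ<n i))))
      (leading-^ (p ℕ.^ k)))
    where
    lower : ∀ m {N} (e : Fin m → ℕ) → (∀ i → e i ℕ.< N) → HasLeading N 0# (λ x → sum (λ i → x ^ e i))
    lower zero    {N} e e< = leading-0 N
    lower (suc m)     e e< = leading-cong (+-identityˡ 0#) (λ _ → refl)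
      (leading-+ (lower-^ (e< Fin.zero)) (lower m (e ∘ Fin.suc) (e< ∘ Fin.suc)))

  trace≉0 : ∃ λ x → ¬ (trace x ≈ 0#)
  trace≉0 with Fin.any? {n = suc n} (λ i → ¬? (trace (from i) ≟ 0#))
  ... | yes (i , e) = from i , e
  ... | no  ∄i      = contradiction
      (λ i → decidable-stable (trace (ρ i) ≟ 0#) λ e → ∄i (_ , e))
      (roots≤degree leading-trace ρ λ {i} {j} e → Fin.inject≤-injective p^k<q p^k<q i j
        (≡.trans (≡.sym (inverseˡ refl)) (inverseˡ e)))
    where
    p^k<q : p ℕ.^ k ℕ.< suc n
    p^k<q = ≡.subst (p ℕ.^ k ℕ.<_) (≡.sym q≡p^1+k) (ℕ.^-monoʳ-< p 1<p (ℕ.n<1+n k))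

    ρ : Fin (suc (p ℕ.^ k)) → Carrier
    ρ i = from (Fin.inject≤ i p^k<q)

-- Powers of a prime in divisibility.

valuation : ∀ {p} → Prime p → ∀ m → m ≢ 0 → ∃ λ i → ∃ λ m′ → m ≡ p ℕ.^ i ℕ.* m′ × p ∤ m′
valuation {p} p-prime m = go m (<-wellFounded m)
  where
  go : ∀ m → Acc ℕ._<_ m → m ≢ 0 → ∃ λ i → ∃ λ m′ → m ≡ p ℕ.^ i ℕ.* m′ × p ∤ m′
  go m (acc rec) m≢0 with p ∣.∣? m
  ... | no p∤m = 0 , m , ≡.sym (ℕ.*-identityˡ m) , p∤m
  ... | yes (divides zero m≡0) = contradiction m≡0 m≢0
  ... | yes (divides d@(suc _) ≡.refl)
    with i , m′ , d≡ , p∤m′ ← go d (rec (ℕ.m<m*n d p (ℕ.nonTrivial⇒n>1 p {{prime⇒nonTrivial p-prime}}))) (λ ())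
    = suc i , m′ , ≡.trans (ℕ.*-comm d p) (≡.trans (≡.cong (p ℕ.*_) d≡) (≡.sym (ℕ.*-assoc p (p ℕ.^ i) m′))) , p∤m′

prime^∣-cancelʳ : ∀ {p} → Prime p → ∀ i {k m} → p ∤ m → p ℕ.^ i ∣ k ℕ.* m → p ℕ.^ i ∣ k
prime^∣-cancelʳ p-prime zero {k} p∤m _ = ∣.1∣ k
prime^∣-cancelʳ {p} p-prime (suc i) {k} {m} p∤m d
  with euclidsLemma k m p-prime (∣.∣-trans (m∣m*n (p ℕ.^ i)) d)
... | inj₂ p∣m = contradiction p∣m p∤m
... | inj₁ (divides k′ ≡.refl) = ≡.subst (p ℕ.^ suc i ∣_) (ℕ.*-comm p k′)
  (∣.*-monoʳ-∣ p (prime^∣-cancelʳ p-prime i p∤m (∣.*-cancelˡ-∣ p {{prime⇒nonZero p-prime}}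
    (≡.subst (p ℕ.* p ℕ.^ i ∣_) (≡.trans (≡.cong (ℕ._* m) (ℕ.*-comm k′ p)) (ℕ.*-assoc p k′ m)) d))))

∣-cancel-prime^ : ∀ {p} → Prime p → ∀ i {k m} → p ∤ m → m ∣ p ℕ.^ i ℕ.* k → m ∣ k
∣-cancel-prime^ p-prime zero {k} {m} p∤m d = ≡.subst (m ∣_) (ℕ.*-identityˡ k) d
∣-cancel-prime^ {p} p-prime (suc i) {k} {m} p∤m d = ∣-cancel-prime^ p-prime i p∤m
  (coprime-divisor (Coprime.sym (prime∤⇒coprime p-prime p∤m))
    (≡.subst (m ∣_) (ℕ.*-assoc p (p ℕ.^ i) k) d))

-- Multiplicative orders.

module OrderProperties (F : HeytingField c ℓ r) where
  open FieldNotions F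
  open FieldProperties F
  open ≈-Reasoning setoid

  -- Minimality is divisibility here, not the comparison used in `HasOrder`: the order of a product
  -- is assembled from coprime divisors of an exponent.
  record IsOrder (x : Carrier) (e : ℕ) : Set ℓ where
    field
      xᵉ≈1    : x ^ e ≈ 1#
      minimal : ∀ {m} → x ^ m ≈ 1# → e ∣ m
  open IsOrder

  xᵐ≈1⇒xᵏ≈1 : ∀ {x m k} → m ∣ k → x ^ m ≈ 1# → x ^ k ≈ 1#
  xᵐ≈1⇒xᵏ≈1 {x} {m} (divides d ≡.refl) e =
    trans (reflexive (≡.cong (x ^_) (ℕ.*-comm d m))) (xᵐ≈1⇒xᵐⁿ≈1 m d e)

  private
    bézout-power≈1 : ∀ {x a b} i j → 1 ℕ.+ i ℕ.* a ≡ j ℕ.* b → x ^ a ≈ 1# → x ^ b ≈ 1# → x ≈ 1#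
    bézout-power≈1 {x} {a} {b} i j e xᵃ≈1 xᵇ≈1 = begin
      x                      ≈⟨ *-identityʳ x ⟨
      x * 1#                 ≈⟨ *-congˡ (xᵐ≈1⇒xᵏ≈1 (∣.n∣m*n i) xᵃ≈1) ⟨
      x ^ (1 ℕ.+ i ℕ.* a)    ≡⟨ ≡.cong (x ^_) e ⟩
      x ^ (j ℕ.* b)          ≈⟨ xᵐ≈1⇒xᵏ≈1 (∣.n∣m*n j) xᵇ≈1 ⟩
      1#                     ∎

  coprime-powers≈1 : ∀ {a b x} → Coprime a b → x ^ a ≈ 1# → x ^ b ≈ 1# → x ≈ 1#
  coprime-powers≈1 {a} {b} {x} a⊥b xᵃ≈1 xᵇ≈1 with coprime-Bézout a⊥b
  ... | Bézout.+- i j e = bézout-power≈1 j i e xᵇ≈1 xᵃ≈1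
  ... | Bézout.-+ i j e = bézout-power≈1 i j e xᵃ≈1 xᵇ≈1

  -- Write an exponent m with x ^ m ≈ 1 as pᵃ m′ with p ∤ m′. If a ≤ i, then x ^ (p ^ i) is killed
  -- by the coprime exponents p and m′, so it would be 1.
  prime-power-order : ∀ {p x} → Prime p → ∀ i → ¬ (x ^ (p ℕ.^ i) ≈ 1#) → x ^ (p ℕ.^ suc i) ≈ 1# →
                      IsOrder x (p ℕ.^ suc i)
  prime-power-order {p} {x} p-prime i x^≉1 x^≈1 = record { xᵉ≈1 = x^≈1 ; minimal = λ {m} → go m }
    where
    go : ∀ m → x ^ m ≈ 1# → p ℕ.^ suc i ∣ m
    go zero _ = _ ∣.∣0
    go m@(suc _) xᵐ≈1 with a , m′ , m≡ , p∤m′ ← valuation p-prime m (λ ()) with a ℕ.≤? i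
    ... | no  a≰i = ≡.subst (p ℕ.^ suc i ∣_) (≡.sym m≡) (∣.∣-trans
          (≡.subst (λ z → p ℕ.^ suc i ∣ p ℕ.^ z) (ℕ.m+[n∸m]≡n (ℕ.≰⇒> a≰i))
            (≡.subst (p ℕ.^ suc i ∣_) (≡.sym (ℕ.^-distribˡ-+-* p (suc i) (a ∸ suc i))) (m∣m*n _)))
          (m∣m*n m′))
    ... | yes a≤i = contradiction (coprime-powers≈1 (prime∤⇒coprime p-prime p∤m′)
          (trans (^-assocʳ x (p ℕ.^ i) p) (trans (reflexive (≡.cong (x ^_) (ℕ.*-comm (p ℕ.^ i) p))) x^≈1))
          (trans (^-assocʳ x (p ℕ.^ i) m′) (xᵐ≈1⇒xᵏ≈1 (≡.subst (_∣ p ℕ.^ i ℕ.* m′) (≡.sym m≡)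
            (∣.*-monoˡ-∣ m′ (≡.subst (λ z → p ℕ.^ a ∣ p ℕ.^ z) (ℕ.m+[n∸m]≡n a≤i)
              (≡.subst (p ℕ.^ a ∣_) (≡.sym (ℕ.^-distribˡ-+-* p a (i ∸ a))) (m∣m*n _))))) xᵐ≈1)))
          x^≉1

  -- The prime factors of n are applied to y one by one; just before the power first becomes 1 it
  -- has prime order.
  prime-order-power : ∀ (_≟_ : ∀ x y → Dec (x ≈ y)) {y n} → .{{NonZero n}} → y ^ n ≈ 1# → ¬ (y ≈ 1#) →
                      ∃ λ m → ∃ λ p → Prime p × ¬ (y ^ m ≈ 1#) × y ^ (m ℕ.* p) ≈ 1#
  prime-order-power _≟_ {y} {n} yⁿ≈1 y≉1 =
    go factors factorsPrime y (trans (reflexive (≡.cong (y ^_) (≡.sym isFactorisation))) yⁿ≈1) y≉1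
    where
    open PrimeFactorisation (factorise n)

    go : ∀ ps → All Prime ps → ∀ y → y ^ product ps ≈ 1# → ¬ (y ≈ 1#) →
         ∃ λ m → ∃ λ p → Prime p × ¬ (y ^ m ≈ 1#) × y ^ (m ℕ.* p) ≈ 1#
    go [] [] y y¹≈1 y≉1 = contradiction (trans (sym (*-identityʳ y)) y¹≈1) y≉1
    go (p ∷ ps) (p-prime ∷ primes) y yᵖ≈1 y≉1 with (y ^ p) ≟ 1#
    ... | yes e = 1 , p , p-prime , (λ y¹≈1 → y≉1 (trans (sym (*-identityʳ y)) y¹≈1)) ,
                  trans (reflexive (≡.cong (y ^_) (ℕ.*-identityˡ p))) e
    ... | no ne with m , p′ , p′-prime , yᵐ≉1 , yᵐᵖ≈1 ← go ps primes (y ^ p) (trans (^-assocʳ y p _) yᵖ≈1) ne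
      = p ℕ.* m , p′ , p′-prime , (λ e → yᵐ≉1 (trans (^-assocʳ y p m) e)) ,
        trans (reflexive (≡.cong (y ^_) (ℕ.*-assoc p m p′))) (trans (sym (^-assocʳ y p _)) yᵐᵖ≈1)

  -- If z ^ e has prime order p and e = pⁱ e′, then z ^ e′ has order pⁱ⁺¹ and
  -- g ^ pⁱ has the coprime order e′; their product has order p e.
  enlarge-order : ∀ {g z p e} → e ≢ 0 → Prime p → IsOrder g e →
                  ¬ (z ^ e ≈ 1#) → z ^ (e ℕ.* p) ≈ 1# → z # 0# → g # 0# →
                  ∃ λ h → h # 0# × IsOrder h (p ℕ.* e)
  enlarge-order {g} {z} {p} e≢0 p-prime g-order zᵉ≉1 zᵉᵖ≈1 z#0 g#0
    with i , e′ , ≡.refl , p∤e′ ← valuation p-prime _ e≢0 =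
    h , proj₂ ((w , ^#0 e′ z#0) *ᵘ (v , ^#0 (p ℕ.^ i) g#0)) ,
    record { xᵉ≈1 = h-power ; minimal = h-minimal }
    where
    w = z ^ e′
    v = g ^ (p ℕ.^ i)
    h = w * v

    w^pⁱ : ∀ m → w ^ m ≈ z ^ (m ℕ.* e′)
    w^pⁱ m = trans (^-assocʳ z e′ m) (reflexive (≡.cong (z ^_) (ℕ.*-comm e′ m)))

    w-order : IsOrder w (p ℕ.^ suc i)
    w-order = prime-power-order p-prime i (λ e → zᵉ≉1 (trans (sym (w^pⁱ (p ℕ.^ i))) e))
      (trans (w^pⁱ (p ℕ.^ suc i)) (trans (reflexive (≡.cong (z ^_)
        (≡.trans (ℕ.*-assoc p (p ℕ.^ i) e′) (ℕ.*-comm p _)))) zᵉᵖ≈1))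

    v^e′≈1 : v ^ e′ ≈ 1#
    v^e′≈1 = trans (^-assocʳ g (p ℕ.^ i) e′) (xᵉ≈1 g-order)

    h-power : h ^ (p ℕ.* (p ℕ.^ i ℕ.* e′)) ≈ 1#
    h-power = begin
      h ^ E          ≈⟨ ^-distrib-* w v E ⟩
      w ^ E * v ^ E  ≈⟨ *-cong (xᵐ≈1⇒xᵏ≈1 (≡.subst (p ℕ.^ suc i ∣_) (ℕ.*-assoc p _ e′) (m∣m*n e′)) (xᵉ≈1 w-order))
                               (xᵐ≈1⇒xᵏ≈1 (∣.∣-trans (∣.n∣m*n (p ℕ.^ i)) (∣.n∣m*n p)) v^e′≈1) ⟩
      1# * 1#        ≈⟨ *-identityˡ 1# ⟩
      1#             ∎
      where E = p ℕ.* (p ℕ.^ i ℕ.* e′)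

    h-minimal : ∀ {k} → h ^ k ≈ 1# → p ℕ.* (p ℕ.^ i ℕ.* e′) ∣ k
    -- Raising h ^ k ≈ 1 to the e′ removes v, so p ^ (i + 1) divides k e′ and hence k. Then w ^ k ≈
    -- 1, so v ^ k ≈ 1, and e′ divides k.
    h-minimal {k} hᵏ≈1 with prime^∣-cancelʳ p-prime (suc i) {k} p∤e′ (minimal w-order (begin
        w ^ (k ℕ.* e′)                   ≈⟨ *-identityʳ _ ⟨
        w ^ (k ℕ.* e′) * 1#              ≈⟨ *-congˡ (xᵐ≈1⇒xᵏ≈1 (∣.n∣m*n k) v^e′≈1) ⟨
        w ^ (k ℕ.* e′) * v ^ (k ℕ.* e′)  ≈⟨ ^-distrib-* w v (k ℕ.* e′) ⟨
        h ^ (k ℕ.* e′)                   ≈⟨ xᵐ≈1⇒xᵏ≈1 {h} {k} (m∣m*n e′) hᵏ≈1 ⟩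
        1# ∎))
    ... | p^∣k@(divides c k≡) = ≡.subst₂ _∣_ (ℕ.*-assoc p (p ℕ.^ i) e′) (≡.trans (ℕ.*-comm _ c) (≡.sym k≡))
      (∣.*-monoʳ-∣ (p ℕ.^ suc i) (∣-cancel-prime^ p-prime (suc i) p∤e′
        (≡.subst (e′ ∣_) (≡.trans k≡ (ℕ.*-comm c _)) e′∣k)))
      where
      e′∣k : e′ ∣ k
      e′∣k = ∣.*-cancelˡ-∣ (p ℕ.^ i) {{ℕ.m^n≢0 p i {{prime⇒nonZero p-prime}}}} (minimal g-order (begin
        g ^ (p ℕ.^ i ℕ.* k)  ≈⟨ ^-assocʳ g (p ℕ.^ i) k ⟨
        v ^ k                ≈⟨ *-identityˡ _ ⟨
        1# * v ^ k           ≈⟨ *-congʳ (xᵐ≈1⇒xᵏ≈1 p^∣k (xᵉ≈1 w-order)) ⟨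
        w ^ k * v ^ k        ≈⟨ ^-distrib-* w v k ⟨
        h ^ k                ≈⟨ hᵏ≈1 ⟩
        1# ∎))

-- Existence of a primitive root, and discrete logarithms.

module PrimitiveRoot (F : HeytingField c ℓ r) {n} (card : HasCardinality F (suc n)) (n≢0 : n ≢ 0) where
  open FieldNotions F
  open FieldProperties F
  open FiniteField F card
  open FiniteFieldProperties F card
  open FiniteFieldSum F card (CommutativeRing.+-commutativeMonoid commutativeRing)
    using (nonzero; nonzero-injective; nonzero≉0)
  open OrderProperties F
  open IsOrder
  open ≈-Reasoning setoid

  leading-Xᵉ-1 : ∀ {e} → e ≢ 0 → HasLeading e 1# (λ x → x ^ e - 1#)
  leading-Xᵉ-1 {zero}  e≢0 = contradiction ≡.refl e≢0
  leading-Xᵉ-1 {suc e} _   = leading-cong (+-identityʳ 1#) (λ _ → refl)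
    (leading-+ (leading-^ (suc e)) (leading-const e (- 1#)))

  private
    -- `prime-order-power` applied to x ^ e yields z = x ^ m whose e-th power has prime order p,
    -- which is what `enlarge-order` asks for.
    enlarge-by : ∀ {g e x} → g # 0# → e ≢ 0 → IsOrder g e → x # 0# → ¬ (x ^ e ≈ 1#) →
                 ∃ λ h → ∃ λ e′ → h # 0# × e ℕ.< e′ × IsOrder h e′
    enlarge-by {g} {e} {x} g#0 e≢0 g-order x#0 xᵉ≉1 =
      let m , p , p-prime , yᵐ≉1 , yᵐᵖ≈1 =
            prime-order-power _≟_ {x ^ e} {n} {{ℕ.≢-nonZero n≢0}} (fermat (^#0 e x#0)) xᵉ≉1
          h , h#0 , h-order = enlarge-order {g} {x ^ m} e≢0 p-prime g-order
            (λ eq → yᵐ≉1 (trans (^-comm x e m) eq))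
            (trans (sym (^-assocʳ (x ^ m) e p)) (trans (^-congˡ p (sym (^-comm x e m)))
              (trans (^-assocʳ (x ^ e) m p) yᵐᵖ≈1)))
            (^#0 m x#0) g#0
          1<p = ℕ.nonTrivial⇒n>1 p {{prime⇒nonTrivial p-prime}}
      in h , p ℕ.* e , h#0 ,
         ≡.subst (e ℕ.<_) (ℕ.*-comm e p) (ℕ.m<m*n e p {{ℕ.≢-nonZero e≢0}} 1<p) , h-order

    -- Xᵉ - 1 cannot have e + 1 distinct roots, and e < n supplies that many nonzero elements.
    exponent≥n : ∀ {e} → e ≢ 0 → e ℕ.< n → ¬ (∀ i → nonzero i ^ e ≈ 1#)
    exponent≥n {e} e≢0 e<n all = roots≤degree (leading-Xᵉ-1 e≢0) ρ
      (λ {i} {j} eq → Fin.inject≤-injective e<n e<n i j (nonzero-injective eq))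
      (λ i → x≈y⇒x-y≈0 (all (Fin.inject≤ i e<n)))
      where
      ρ : Fin (suc e) → Carrier
      ρ i = nonzero (Fin.inject≤ i e<n)

    order≤n : ∀ {g e} → g # 0# → IsOrder g e → e ≤ n
    order≤n g#0 g-order = ∣⇒≤ {{ℕ.≢-nonZero n≢0}} (minimal g-order (fermat g#0))

    enlarge : ∀ {g e} → g # 0# → e ≢ 0 → IsOrder g e → e ≢ n →
              ∃ λ h → ∃ λ e′ → h # 0# × e ℕ.< e′ × IsOrder h e′
    enlarge {g} {e} g#0 e≢0 g-order e≢n =
      go (Fin.¬∀⟶∃¬ n (λ i → nonzero i ^ e ≈ 1#) (λ i → nonzero i ^ e ≟ 1#)
           (exponent≥n e≢0 (ℕ.≤∧≢⇒< (order≤n g#0 g-order) e≢n)))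
      where
      go : (∃ λ i → ¬ (nonzero i ^ e ≈ 1#)) → ∃ λ h → ∃ λ e′ → h # 0# × e ℕ.< e′ × IsOrder h e′
      go (i , xᵉ≉1) = enlarge-by g#0 e≢0 g-order (≉0⇒#0 (nonzero≉0 i)) xᵉ≉1

    -- An order other than n can be enlarged, and no order exceeds n; `fuel` bounds the gap n - e
    -- and makes the recursion structural.
    search : ∀ fuel {g e} → n ≤ fuel ℕ.+ e → g # 0# → e ≢ 0 → IsOrder g e →
             ∃ λ h → h # 0# × IsOrder h n
    search zero {g} {e} n≤e g#0 e≢0 g-order =
      g , g#0 , ≡.subst (IsOrder g) (ℕ.≤-antisym (order≤n g#0 g-order) n≤e) g-order
    search (suc fuel) {g} {e} n≤ g#0 e≢0 g-order = go (e ℕ.≟ n)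
      where
      go : Dec (e ≡ n) → ∃ λ h → h # 0# × IsOrder h n
      go (yes e≡n) = g , g#0 , ≡.subst (IsOrder g) e≡n g-order
      go (no e≢n)  =
        let h , e′ , h#0 , e<e′ , h-order = enlarge g#0 e≢0 g-order e≢n in
        search fuel (ℕ.≤-trans n≤ (≡.subst (ℕ._≤ fuel ℕ.+ e′) (ℕ.+-suc fuel e) (ℕ.+-monoʳ-≤ fuel e<e′)))
          h#0 (ℕ.m<n⇒n≢0 e<e′) h-order

  primitive-root : ∃ λ g → g # 0# × IsOrder g n
  primitive-root = search n {1#} {1} (ℕ.m≤m+n n 1) 1#0 (λ ())
    record { xᵉ≈1 = *-identityʳ 1# ; minimal = λ {m} _ → ∣.1∣ m }

  module _ {g} (g#0 : g # 0#) (g-order : IsOrder g n) where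

    gᵃ≈gᵇ⇒n∣b∸a : ∀ {a b} → a ≤ b → g ^ a ≈ g ^ b → n ∣ b ∸ a
    gᵃ≈gᵇ⇒n∣b∸a {a} {b} a≤b gᵃ≈gᵇ = minimal g-order (*-cancelˡ (g ^ a , ^#0 a g#0) (begin
      g ^ a * g ^ (b ∸ a)    ≈⟨ ^-homo-* g a (b ∸ a) ⟨
      g ^ (a ℕ.+ (b ∸ a))    ≡⟨ ≡.cong (g ^_) (ℕ.m+[n∸m]≡n a≤b) ⟩
      g ^ b                  ≈⟨ gᵃ≈gᵇ ⟨
      g ^ a                  ≈⟨ *-identityʳ _ ⟨
      g ^ a * 1#             ∎))

    private
      ≤-injective : ∀ {a b} → b ℕ.< n → a ≤ b → g ^ a ≈ g ^ b → a ≡ b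
      ≤-injective {a} {b} b<n a≤b gᵃ≈gᵇ with b ∸ a in eq | gᵃ≈gᵇ⇒n∣b∸a a≤b gᵃ≈gᵇ
      ... | zero  | _ = ℕ.≤-antisym a≤b (ℕ.m∸n≡0⇒m≤n eq)
      ... | suc k | n∣ = contradiction (ℕ.≤-trans (∣⇒≤ n∣) (ℕ.≤-trans (ℕ.≤-reflexive (≡.sym eq)) (ℕ.m∸n≤m b a)))
                           (ℕ.<⇒≱ b<n)

    gᵃ≈gᵇ⇒a≡b : ∀ {a b} → a ℕ.< n → b ℕ.< n → g ^ a ≈ g ^ b → a ≡ b
    gᵃ≈gᵇ⇒a≡b {a} {b} a<n b<n e with ℕ.≤-total a b
    ... | inj₁ a≤b = ≤-injective b<n a≤b e
    ... | inj₂ b≤a = ≡.sym (≤-injective a<n b≤a (sym e))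

    -- If x were not among the n distinct powers of g, then Xⁿ - 1 would have n + 1 roots.
    discrete-log : ∀ {x} → x # 0# → ∃ λ i → i ℕ.< n × x ≈ g ^ i
    discrete-log {x} x#0 with Fin.any? {n = n} (λ i → x ≟ g ^ toℕ i)
    ... | yes (i , e) = toℕ i , Fin.toℕ<n i , e
    ... | no  ∄i = contradiction zeros (roots≤degree (leading-Xᵉ-1 n≢0) ρ ρ-injective)
      where
      ρ : Fin (suc n) → Carrier
      ρ Fin.zero    = x
      ρ (Fin.suc i) = g ^ toℕ i

      ρ-injective : ∀ {i j} → ρ i ≈ ρ j → i ≡ j
      ρ-injective {Fin.zero}  {Fin.zero}  e = ≡.refl
      ρ-injective {Fin.zero}  {Fin.suc j} e = contradiction (j , e) ∄i
      ρ-injective {Fin.suc i} {Fin.zero}  e = contradiction (i , sym e) ∄i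
      ρ-injective {Fin.suc i} {Fin.suc j} e =
        ≡.cong Fin.suc (Fin.toℕ-injective (gᵃ≈gᵇ⇒a≡b (Fin.toℕ<n i) (Fin.toℕ<n j) e))

      zeros : ∀ i → ρ i ^ n - 1# ≈ 0#
      zeros Fin.zero    = x≈y⇒x-y≈0 (fermat x#0)
      zeros (Fin.suc i) = x≈y⇒x-y≈0 (fermat (^#0 (toℕ i) g#0))

-- Sums over lists.

module ListSumProperties (K : HeytingField c ℓ r) where
  open FieldNotions K
  open FieldProperties K
  open SemiringSum semiring using (sum)
  open ≈-Reasoning setoid

  private variable
    a b e : Level
    A : Set a
    B : Set b

  sumOver-cong : ∀ (xs : List A) {f g : A → Carrier} → (∀ x → f x ≈ g x) → sumOver xs f ≈ sumOver xs g
  sumOver-cong []       f≈g = refl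
  sumOver-cong (x ∷ xs) f≈g = +-cong (f≈g x) (sumOver-cong xs f≈g)

  sumOver-++ : ∀ (xs ys : List A) f → sumOver (xs List.++ ys) f ≈ sumOver xs f + sumOver ys f
  sumOver-++ []       ys f = sym (+-identityˡ _)
  sumOver-++ (x ∷ xs) ys f = trans (+-congˡ (sumOver-++ xs ys f)) (sym (+-assoc _ _ _))

  sumOver-map : ∀ (h : A → B) xs f → sumOver (List.map h xs) f ≡ sumOver xs (f ∘ h)
  sumOver-map h []       f = ≡.refl
  sumOver-map h (x ∷ xs) f = ≡.cong (f (h x) +_) (sumOver-map h xs f)

  *-distribˡ-sumOver : ∀ x (ys : List A) f → x * sumOver ys f ≈ sumOver ys (λ y → x * f y)
  *-distribˡ-sumOver x []       f = zeroʳ x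
  *-distribˡ-sumOver x (y ∷ ys) f = trans (distribˡ x _ _) (+-congˡ (*-distribˡ-sumOver x ys f))

  *-distribʳ-sumOver : ∀ x (ys : List A) f → sumOver ys f * x ≈ sumOver ys (λ y → f y * x)
  *-distribʳ-sumOver x ys f = trans (*-comm _ x) (trans (*-distribˡ-sumOver x ys f)
    (sumOver-cong ys λ y → *-comm x (f y)))

  sumOver-sum : ∀ {n} (xs : List A) (f : A → Fin n → Carrier) →
                sumOver xs (λ x → sum (f x)) ≈ sum (λ i → sumOver xs (λ x → f x i))
  sumOver-sum {n = n} []       f = sym (SemiringSum.sum-replicate-zero semiring n)
  sumOver-sum (x ∷ xs) f = trans (+-congˡ (sumOver-sum xs f))
    (sym (SemiringSum.∑-distrib-+ semiring (f x) _))

  sumOver-cartesianProductWith : ∀ {c} {C : Set c} (h : A → B → C) xs ys f →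
    sumOver (List.cartesianProductWith h xs ys) f ≈ sumOver xs (λ x → sumOver ys (λ y → f (h x y)))
  sumOver-cartesianProductWith h []       ys f = refl
  sumOver-cartesianProductWith h (x ∷ xs) ys f =
    trans (sumOver-++ (List.map (h x) ys) _ f)
      (+-cong (reflexive (sumOver-map (h x) ys f)) (sumOver-cartesianProductWith h xs ys f))

  sumOver-mapMaybe : ∀ (h : A → Maybe.Maybe B) xs f →
    sumOver (List.mapMaybe h xs) f ≈ sumOver xs (λ x → Maybe.maybe f 0# (h x))
  sumOver-mapMaybe h []       f = refl
  sumOver-mapMaybe h (x ∷ xs) f with h x
  ... | Maybe.just y  = +-congˡ (sumOver-mapMaybe h xs f)
  ... | Maybe.nothing = trans (sumOver-mapMaybe h xs f) (sym (+-identityˡ _))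

  sumOver-tabulate : ∀ {n} (h : Fin n → A) f → sumOver (List.tabulate h) f ≡ sum (f ∘ h)
  sumOver-tabulate {n = zero}  h f = ≡.refl
  sumOver-tabulate {n = suc n} h f = ≡.cong (f (h Fin.zero) +_) (sumOver-tabulate (h ∘ Fin.suc) f)

  indicator : ∀ {P : Set e} → Dec P → Carrier
  indicator (yes _) = 1#
  indicator (no  _) = 0#

  fromℕ-length-filter : ∀ {P : Pred A e} (P? : Decidable P) xs →
    fromℕ (List.length (List.filter P? xs)) ≈ sumOver xs (indicator ∘ P?)
  fromℕ-length-filter P? []       = refl
  fromℕ-length-filter P? (x ∷ xs) with P? x
  ... | yes _ = +-congˡ (fromℕ-length-filter P? xs)
  ... | no  _ = trans (fromℕ-length-filter P? xs) (sym (+-identityˡ _))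

-- Multiplicative characters and their sums over the field.

module CharacterSums (F : HeytingField c ℓ r) {n} (card : HasCardinality F (suc n))
                     (K : HeytingField c′ ℓ′ r′) where
  private
    module F where
      open FieldNotions F public
      open FieldProperties F public
    module Fq where
      open FiniteField F card public
      open FiniteFieldProperties F card public
    module Ext = ExtendFromUnits F card (HeytingField.setoid K)
  open FieldNotions K
  open FieldProperties K
  open ListSumProperties K
  open CommutativeRing commutativeRing using (+-commutativeMonoid)
  open FiniteFieldSum F card +-commutativeMonoid public
  open Inverse card using (from)
  open SemiringSum semiring using (*-distribˡ-sum)
  open ≈-Reasoning setoid

  characterGroup : AbelianGroup _ _
  characterGroup = homGroup F.multiplicativeGroup unitGroup

  open AbelianGroup characterGroup using () renaming (Carrier to Character; _∙_ to _·_; _⁻¹ to conj)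

  Congruent : (F.Carrier → Carrier) → Set _
  Congruent f = ∀ {x y} → x F.≈ y → f x ≈ f y

  opaque
    unfolding Σᶠ

    Σᶠ-*ˡ : ∀ a f → a * Σᶠ f ≈ Σᶠ (λ x → a * f x)
    Σᶠ-*ˡ a f = *-distribˡ-sum a (f ∘ from)

  Σᶠ-*ʳ : ∀ a f → Σᶠ f * a ≈ Σᶠ (λ x → f x * a)
  Σᶠ-*ʳ a f = trans (*-comm _ a) (trans (Σᶠ-*ˡ a f) (Σᶠ-cong λ x → *-comm a (f x)))

  Σᶠ-0 : Σᶠ (λ _ → 0#) ≈ 0#
  Σᶠ-0 = trans (Σᶠ-cong λ _ → sym (zeroˡ 0#)) (trans (sym (Σᶠ-*ˡ 0# _)) (zeroˡ _))

  opaque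
    unfolding Σᶠ Ext.extend

    sumOver-units : ∀ f → sumOver Fq.units f ≈ Σᶠ (Ext.extend 0# f)
    sumOver-units f = begin
      sumOver Fq.units f  ≈⟨ sumOver-mapMaybe unit? (List.allFin (suc n)) f ⟩
      sumOver (List.allFin (suc n)) (Maybe.maybe f 0# ∘ unit?)
        ≈⟨ sumOver-cong (List.allFin (suc n)) pointwise ⟩
      sumOver (List.allFin (suc n)) (Ext.extend 0# f ∘ from)
        ≡⟨ sumOver-tabulate (λ i → i) (Ext.extend 0# f ∘ from) ⟩
      Σᶠ (Ext.extend 0# f) ∎
      where
      unit? : Fin (suc n) → Maybe.Maybe F.Unit
      unit? i = Maybe.map (from i ,_) (dec⇒maybe (Fq.nonzero? (from i)))

      pointwise : ∀ i → Maybe.maybe f 0# (unit? i) ≈ Ext.extend 0# f (from i)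
      pointwise i with Fq.nonzero? (from i)
      ... | yes _ = refl
      ... | no  _ = refl

  Σᶠ-translate : ∀ {f} → Congruent f → ∀ a → Σᶠ f ≈ Σᶠ (λ x → f (x F.+ a))
  Σᶠ-translate f-cong a = Σᶠ-reindex (F._+ a) (F._- a) f-cong F.+-congʳ F.+-congʳ
    (λ x → F.solve 2 (λ x a → (x F.:- a) F.:+ a F.:= x) F.refl x a)
    (λ x → F.solve 2 (λ x a → (x F.:+ a) F.:- a F.:= x) F.refl x a)

  Σᶠ-scale : ∀ {f} → Congruent f → ∀ u → Σᶠ f ≈ Σᶠ (λ x → f (proj₁ u F.* x))
  Σᶠ-scale f-cong u = Σᶠ-reindex (proj₁ u F.*_) (proj₁ (u F.⁻¹) F.*_) f-cong F.*-congˡ F.*-congˡ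
    (λ x → F.trans (F.sym (F.*-assoc _ _ _)) (F.trans (F.*-congʳ (F.*-inverseʳ u)) (F.*-identityˡ x)))
    (λ x → F.trans (F.sym (F.*-assoc _ _ _)) (F.trans (F.*-congʳ
      (F.trans (F.*-comm _ _) (F.*-inverseʳ u))) (F.*-identityˡ x)))

  Σᶠ-single : ∀ {f} → Congruent f → ∀ a → (∀ x → ¬ (x F.≈ a) → f x ≈ 0#) → Σᶠ f ≈ f a
  Σᶠ-single {f} f-cong a f≈0 = begin
    Σᶠ f                      ≈⟨ Σᶠ-translate f-cong a ⟩
    Σᶠ (λ x → f (x F.+ a))    ≈⟨ Σᶠ-split-const (λ e → f-cong (F.+-congʳ e))
      (λ x x≉0 → f≈0 _ λ e → x≉0 (F.trans (F.solve 2 (λ x a → x F.:= (x F.:+ a) F.:- a) F.refl x a)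
                                   (F.x≈y⇒x-y≈0 e))) ⟩
    f (F.0# F.+ a) + n ×ᴷ 0#  ≈⟨ +-cong (f-cong (F.+-identityˡ a)) (trans (×≈fromℕ* n 0#) (zeroʳ _)) ⟩
    f a + 0#                  ≈⟨ +-identityʳ _ ⟩
    f a                       ∎
    where open Mult semiring using () renaming (_×_ to _×ᴷ_)

  _⟨_⟩ : Character → F.Unit → Carrier
  χ ⟨ u ⟩ = proj₁ (Hom.⟦ χ ⟧ u)

  -- The convention χ(0) = 0 also applies to the trivial character.
  _^∧_ : Character → F.Carrier → Carrier
  χ ^∧ x = Ext.extend 0# (χ ⟨_⟩) x

  private
    ⟨⟩-cong : ∀ χ {u v} → proj₁ u F.≈ proj₁ v → χ ⟨ u ⟩ ≈ χ ⟨ v ⟩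
    ⟨⟩-cong χ {u} {v} = Hom.⟦⟧-cong χ {u} {v}

  ^∧-unit : ∀ χ u → χ ^∧ proj₁ u ≈ χ ⟨ u ⟩
  ^∧-unit χ = Ext.extend-unit 0# (λ {u} {v} → ⟨⟩-cong χ {u} {v})

  ^∧-0 : ∀ χ {x} → x F.≈ F.0# → χ ^∧ x ≈ 0#
  ^∧-0 χ = Ext.extend-0 0# (λ {u} {v} → ⟨⟩-cong χ {u} {v})

  ^∧-cong : ∀ χ → Congruent (χ ^∧_)
  ^∧-cong χ = Ext.extend-cong 0# (λ {u} {v} → ⟨⟩-cong χ {u} {v})

  ^∧-1 : ∀ χ {x} → x F.≈ F.1# → χ ^∧ x ≈ 1#
  ^∧-1 χ x≈1 = trans (^∧-cong χ x≈1) (trans (^∧-unit χ (F.1# , F.1#0)) (Hom.ε-homo χ))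

  ^∧-* : ∀ χ x y → χ ^∧ (x F.* y) ≈ χ ^∧ x * χ ^∧ y
  ^∧-* χ x y with Fq.≈0∨unit x | Fq.≈0∨unit y
  ... | inj₁ x≈0 | _ = trans (^∧-0 χ (F.trans (F.*-congʳ x≈0) (F.zeroˡ y)))
                         (sym (trans (*-congʳ (^∧-0 χ x≈0)) (zeroˡ _)))
  ... | inj₂ _ | inj₁ y≈0 = trans (^∧-0 χ (F.trans (F.*-congˡ y≈0) (F.zeroʳ x)))
                              (sym (trans (*-congˡ (^∧-0 χ y≈0)) (zeroʳ _)))
  ... | inj₂ x#0 | inj₂ y#0 = begin
    χ ^∧ (x F.* y)         ≈⟨ ^∧-unit χ (u F.*ᵘ v) ⟩
    χ ⟨ u F.*ᵘ v ⟩         ≈⟨ Hom.homo χ u v ⟩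
    χ ⟨ u ⟩ * χ ⟨ v ⟩      ≈⟨ *-cong (^∧-unit χ u) (^∧-unit χ v) ⟨
    χ ^∧ x * χ ^∧ y        ∎
    where
    u v : F.Unit
    u = x , x#0
    v = y , y#0

  ^∧-^ : ∀ χ x i → χ ^∧ (x F.^ i) ≈ (χ ^∧ x) ^ i
  ^∧-^ χ x zero    = ^∧-1 χ F.refl
  ^∧-^ χ x (suc i) = trans (^∧-* χ x (x F.^ i)) (*-congˡ (^∧-^ χ x i))

  ^∧-ext : ∀ {χ χ′} → (∀ u → χ ⟨ u ⟩ ≈ χ′ ⟨ u ⟩) → ∀ x → χ ^∧ x ≈ χ′ ^∧ x
  ^∧-ext {χ} {χ′} e x with Fq.≈0∨unit x
  ... | inj₁ x≈0 = trans (^∧-0 χ x≈0) (sym (^∧-0 χ′ x≈0))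
  ... | inj₂ x#0 = trans (^∧-unit χ (x , x#0)) (trans (e (x , x#0)) (sym (^∧-unit χ′ (x , x#0))))

  ^∧-· : ∀ χ χ′ x → (χ · χ′) ^∧ x ≈ χ ^∧ x * χ′ ^∧ x
  ^∧-· χ χ′ x with Fq.≈0∨unit x
  ... | inj₁ x≈0 = trans (^∧-0 (χ · χ′) x≈0) (sym (trans (*-congʳ (^∧-0 χ x≈0)) (zeroˡ _)))
  ... | inj₂ x#0 = trans (^∧-unit (χ · χ′) (x , x#0))
                     (sym (*-cong (^∧-unit χ (x , x#0)) (^∧-unit χ′ (x , x#0))))

  -- The inverse is specified by x y ≈ 1, so that it may be any expression and need not have the
  -- form of `_⁻¹`.
  ^∧-conj : ∀ χ {x y} → x F.* y F.≈ F.1# → conj χ ^∧ x ≈ χ ^∧ y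
  ^∧-conj χ {x} {y} xy≈1 = begin
    conj χ ^∧ x                         ≈⟨ *-identityʳ _ ⟨
    conj χ ^∧ x * 1#                    ≈⟨ *-congˡ (^∧-1 χ xy≈1) ⟨
    conj χ ^∧ x * χ ^∧ (x F.* y)        ≈⟨ *-congˡ (^∧-* χ x y) ⟩
    conj χ ^∧ x * (χ ^∧ x * χ ^∧ y)     ≈⟨ *-assoc _ _ _ ⟨
    conj χ ^∧ x * χ ^∧ x * χ ^∧ y       ≈⟨ *-congʳ (*-cong (^∧-unit (conj χ) u) (^∧-unit χ u)) ⟩
    conj χ ⟨ u ⟩ * χ ⟨ u ⟩ * χ ^∧ y     ≈⟨ *-congʳ (AbelianGroup.inverseˡ unitGroup (Hom.⟦ χ ⟧ u)) ⟩
    1# * χ ^∧ y                         ≈⟨ *-identityˡ _ ⟩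
    χ ^∧ y                              ∎
    where
    u : F.Unit
    u = x , F.*≈1⇒#0 (F.trans (F.*-comm y x) xy≈1)

  Σᶠ-𝟙 : ∀ {χ} → (∀ u → χ ⟨ u ⟩ ≈ 1#) → Σᶠ (χ ^∧_) ≈ fromℕ n
  Σᶠ-𝟙 {χ} trivial = begin
    Σᶠ (χ ^∧_)              ≈⟨ Σᶠ-split-const (^∧-cong χ)
      (λ x x≉0 → trans (^∧-unit χ (x , Fq.≉0⇒#0 x≉0)) (trivial _)) ⟩
    χ ^∧ F.0# + fromℕ n     ≈⟨ +-congʳ (^∧-0 χ F.refl) ⟩
    0# + fromℕ n            ≈⟨ +-identityˡ _ ⟩
    fromℕ n                 ∎

  -- Scaling the index by u gives χ(u) Σ = Σ. If Σ were apart from 0, it could be cancelled for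
  -- every u, and χ would be trivial.
  Σᶠ-nontrivial : ∀ {χ} → ¬ (∀ u → χ ⟨ u ⟩ ≈ 1#) → Σᶠ (χ ^∧_) ≈ 0#
  Σᶠ-nontrivial {χ} nontrivial = ≈-stable λ Σ#0 → nontrivial λ u →
    *-cancelˡ (Σᶠ (χ ^∧_) , Σ#0) (begin
      Σᶠ (χ ^∧_) * χ ⟨ u ⟩              ≈⟨ *-comm _ _ ⟩
      χ ⟨ u ⟩ * Σᶠ (χ ^∧_)              ≈⟨ *-congʳ (^∧-unit χ u) ⟨
      χ ^∧ proj₁ u * Σᶠ (χ ^∧_)         ≈⟨ Σᶠ-*ˡ _ _ ⟩
      Σᶠ (λ x → χ ^∧ proj₁ u * χ ^∧ x)  ≈⟨ Σᶠ-cong (λ x → ^∧-* χ (proj₁ u) x) ⟨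
      Σᶠ (λ x → χ ^∧ (proj₁ u F.* x))   ≈⟨ Σᶠ-scale (^∧-cong χ) u ⟨
      Σᶠ (χ ^∧_)                        ≈⟨ *-identityʳ _ ⟨
      Σᶠ (χ ^∧_) * 1#                   ∎)

-- Gauss sums for a nontrivial additive character.

module GaussSums (F : HeytingField c ℓ r) {n} (card : HasCardinality F (suc n))
                 (K : HeytingField c′ ℓ′ r′)
                 (ψ : HeytingField.Carrier F → HeytingField.Carrier K) where
  private
    module F where
      open FieldNotions F public
      open FieldProperties F public
    module Fq where
      open FiniteField F card public
      open FiniteFieldProperties F card public
  open FieldNotions K
  open FieldProperties K
  open CharacterSums F card K
  open AbelianGroup characterGroup using () renaming (Carrier to Character; _∙_ to _·_; _⁻¹ to conj)
  open ≈-Reasoning setoid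

  G : Character → Carrier
  G χ = Σᶠ (λ x → χ ^∧ x * ψ x)

  module _ (ψ-cong : Congruent ψ) (ψ-+ : ∀ x y → ψ (x F.+ y) ≈ ψ x * ψ y)
           (ψ-0 : ψ F.0# ≈ 1#) {x₀} (ψ-nontrivial : ¬ (ψ x₀ ≈ 1#)) where

    private
      G-term-cong : ∀ χ → Congruent (λ x → χ ^∧ x * ψ x)
      G-term-cong χ e = *-cong (^∧-cong χ e) (ψ-cong e)

    Σψ≈0 : Σᶠ ψ ≈ 0#
    Σψ≈0 = ax≈x⇒x≈0 ψ-nontrivial (begin
      ψ x₀ * Σᶠ ψ                ≈⟨ Σᶠ-*ˡ _ ψ ⟩
      Σᶠ (λ x → ψ x₀ * ψ x)      ≈⟨ Σᶠ-cong (λ x → trans (ψ-+ x x₀) (*-comm _ _)) ⟨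
      Σᶠ (λ x → ψ (x F.+ x₀))    ≈⟨ Σᶠ-translate ψ-cong x₀ ⟨
      Σᶠ ψ                       ∎)

    Σψ-scaled≈0 : ∀ {a} → a F.# F.0# → Σᶠ (λ x → ψ (a F.* x)) ≈ 0#
    Σψ-scaled≈0 {a} a#0 = trans (sym (Σᶠ-scale ψ-cong (a , a#0))) Σψ≈0

    -- The trivial character drops from Σ ψ = 0 only the term ψ(0) = 1.
    G-trivial : ∀ {χ} → (∀ u → χ ⟨ u ⟩ ≈ 1#) → G χ ≈ - 1#
    G-trivial {χ} trivial = begin
      G χ                                         ≈⟨ Σᶠ-split (G-term-cong χ) ⟩
      χ ^∧ F.0# * ψ F.0# + sum (λ i → χ ^∧ nonzero i * ψ (nonzero i))
        ≈⟨ +-cong (trans (*-congʳ (^∧-0 χ F.refl)) (zeroˡ _)) (sum-cong-≋ λ i →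
             trans (*-congʳ (trans (^∧-unit χ (nonzero i , Fq.≉0⇒#0 (nonzero≉0 i))) (trivial _)))
                   (*-identityˡ _)) ⟩
      0# + sum (ψ ∘ nonzero)                      ≈⟨ solve 1 (λ s → con (ℤ.+ 0) :+ s
                                                       := (con (ℤ.+ 1) :+ s) :- con (ℤ.+ 1)) refl _ ⟩
      (1# + sum (ψ ∘ nonzero)) - 1#               ≈⟨ +-congʳ (trans (Σᶠ-split ψ-cong) (+-congʳ ψ-0)) ⟨
      Σᶠ ψ - 1#                                   ≈⟨ +-congʳ Σψ≈0 ⟩
      0# - 1#                                     ≈⟨ +-identityˡ _ ⟩
      - 1#                                        ∎
      where open SemiringSum semiring using (sum; sum-cong-≋)

    module _ {φ} (φ-nontrivial : ¬ (∀ u → φ ⟨ u ⟩ ≈ 1#)) (φ²≈1 : ∀ u → φ ⟨ u ⟩ * φ ⟨ u ⟩ ≈ 1#) where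

      -- For w ≠ 0 scale a by w and use φ(w)⁻¹ = φ(w). For w = 0 the left side is the sum of the
      -- nontrivial character φ, which is 0 as well; so w may run over the whole field in the double
      -- sums.
      G-twist : ∀ w → Σᶠ (λ a → φ ^∧ a * ψ (a F.* w)) ≈ φ ^∧ w * G φ
      G-twist w with Fq.≈0∨unit w
      ... | inj₁ w≈0 = begin
        Σᶠ (λ a → φ ^∧ a * ψ (a F.* w))  ≈⟨ Σᶠ-cong (λ a → trans (*-congˡ (trans
          (ψ-cong (F.trans (F.*-congˡ w≈0) (F.zeroʳ a))) ψ-0)) (*-identityʳ _)) ⟩
        Σᶠ (φ ^∧_)                       ≈⟨ Σᶠ-nontrivial {φ} φ-nontrivial ⟩
        0#                               ≈⟨ zeroˡ _ ⟨
        0# * G φ                         ≈⟨ *-congʳ (^∧-0 φ w≈0) ⟨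
        φ ^∧ w * G φ                     ∎
      ... | inj₂ w#0 = begin
        Σᶠ (λ a → φ ^∧ a * ψ (a F.* w))  ≈⟨ *-identityˡ _ ⟨
        1# * Σᶠ (λ a → φ ^∧ a * ψ (a F.* w))
          ≈⟨ *-congʳ (trans (*-cong (^∧-unit φ (w , w#0)) (^∧-unit φ (w , w#0))) (φ²≈1 (w , w#0))) ⟨
        (φ ^∧ w * φ ^∧ w) * Σᶠ (λ a → φ ^∧ a * ψ (a F.* w))  ≈⟨ *-assoc _ _ _ ⟩
        φ ^∧ w * (φ ^∧ w * Σᶠ (λ a → φ ^∧ a * ψ (a F.* w)))  ≈⟨ *-congˡ (Σᶠ-*ˡ _ _) ⟩
        φ ^∧ w * Σᶠ (λ a → φ ^∧ w * (φ ^∧ a * ψ (a F.* w)))  ≈⟨ *-congˡ (Σᶠ-cong λ a → begin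
          φ ^∧ (w F.* a) * ψ (w F.* a)       ≈⟨ *-cong (^∧-* φ w a) (ψ-cong (F.*-comm w a)) ⟩
          φ ^∧ w * φ ^∧ a * ψ (a F.* w)      ≈⟨ *-assoc _ _ _ ⟩
          φ ^∧ w * (φ ^∧ a * ψ (a F.* w))    ∎) ⟨
        φ ^∧ w * Σᶠ (λ a → φ ^∧ (w F.* a) * ψ (w F.* a))
          ≈⟨ *-congˡ (Σᶠ-scale (G-term-cong φ) (w , w#0)) ⟨
        φ ^∧ w * G φ                     ∎

      -- `G-twist` turns one factor into a sum over a. After the exchange of sums, the inner sum
      -- over b of ψ((a + 1) b) is q for a = -1 and 0 otherwise.
      G-square : G φ * G φ ≈ φ ^∧ (F.- F.1#) * fromℕ (suc n)
      G-square = begin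
        G φ * G φ                                             ≈⟨ Σᶠ-*ʳ _ _ ⟩
        Σᶠ (λ b → φ ^∧ b * ψ b * G φ)                         ≈⟨ Σᶠ-cong (λ b → begin
          φ ^∧ b * ψ b * G φ                      ≈⟨ trans (*-congʳ (*-comm _ _)) (*-assoc _ _ _) ⟩
          ψ b * (φ ^∧ b * G φ)                    ≈⟨ *-congˡ (G-twist b) ⟨
          ψ b * Σᶠ (λ a → φ ^∧ a * ψ (a F.* b))   ≈⟨ Σᶠ-*ˡ _ _ ⟩
          Σᶠ (λ a → ψ b * (φ ^∧ a * ψ (a F.* b))) ∎) ⟩
        Σᶠ (λ b → Σᶠ λ a → ψ b * (φ ^∧ a * ψ (a F.* b)))      ≈⟨ Σᶠ-comm (λ b a → ψ b * (φ ^∧ a * ψ (a F.* b))) ⟩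
        Σᶠ (λ a → Σᶠ λ b → ψ b * (φ ^∧ a * ψ (a F.* b)))      ≈⟨ Σᶠ-cong (λ a → trans (Σᶠ-cong (inner a)) (sym (Σᶠ-*ˡ _ _))) ⟩
        Σᶠ (λ a → φ ^∧ a * Σᶠ (λ b → ψ ((a F.+ F.1#) F.* b))) ≈⟨ Σᶠ-single
          (λ e → *-cong (^∧-cong φ e) (Σᶠ-cong λ b → ψ-cong (F.*-congʳ (F.+-congʳ e)))) (F.- F.1#)
          (λ a a≉-1 → trans (*-congˡ (Σψ-scaled≈0 (Fq.≉0⇒#0 λ e → a≉-1 (a+1≈0⇒a≈-1 a e)))) (zeroʳ _)) ⟩
        φ ^∧ (F.- F.1#) * Σᶠ (λ b → ψ ((F.- F.1# F.+ F.1#) F.* b)) ≈⟨ *-congˡ (begin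
          Σᶠ (λ b → ψ ((F.- F.1# F.+ F.1#) F.* b)) ≈⟨ Σᶠ-cong (λ b → trans (ψ-cong
            (F.trans (F.*-congʳ (F.-‿inverseˡ F.1#)) (F.zeroˡ b))) ψ-0) ⟩
          Σᶠ (λ _ → 1#)                            ≈⟨ Σᶠ-const 1# ⟩
          fromℕ (suc n)                            ∎) ⟩
        φ ^∧ (F.- F.1#) * fromℕ (suc n)                       ∎
        where
        a+1≈0⇒a≈-1 : ∀ a → a F.+ F.1# F.≈ F.0# → a F.≈ F.- F.1#
        a+1≈0⇒a≈-1 a e = F.x-y≈0⇒x≈y (F.trans (F.+-congˡ (F.-‿involutive F.1#)) e)

        inner : ∀ a b → ψ b * (φ ^∧ a * ψ (a F.* b)) ≈ φ ^∧ a * ψ ((a F.+ F.1#) F.* b)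
        inner a b = begin
          ψ b * (φ ^∧ a * ψ (a F.* b))     ≈⟨ solve 3 (λ x y z → x :* (y :* z) := y :* (z :* x)) refl _ _ _ ⟩
          φ ^∧ a * (ψ (a F.* b) * ψ b)     ≈⟨ *-congˡ (ψ-+ _ _) ⟨
          φ ^∧ a * ψ (a F.* b F.+ b)       ≈⟨ *-congˡ (ψ-cong (F.solve 2 (λ a b →
            a F.:* b F.:+ b F.:= (a F.:+ F.con (ℤ.+ 1)) F.:* b) F.refl a b)) ⟩
          φ ^∧ a * ψ ((a F.+ F.1#) F.* b)  ∎

      -- Substitute b = a (w − 1) in the double sum over a and b.
      G-product : ∀ χ → G (φ · χ) * G (conj χ) ≈ G φ * Σᶠ (λ w → conj χ ^∧ (w F.- F.1#) * φ ^∧ w)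
      G-product χ = begin
        G (φ · χ) * G (conj χ)                                   ≈⟨ Σᶠ-*ʳ _ _ ⟩
        Σᶠ (λ a → (φ · χ) ^∧ a * ψ a * G (conj χ))               ≈⟨ Σᶠ-cong substitute ⟩
        Σᶠ (λ a → Σᶠ λ w → conj χ ^∧ (w F.- F.1#) * (φ ^∧ a * ψ (a F.* w)))
          ≈⟨ Σᶠ-comm (λ a w → conj χ ^∧ (w F.- F.1#) * (φ ^∧ a * ψ (a F.* w))) ⟩
        Σᶠ (λ w → Σᶠ λ a → conj χ ^∧ (w F.- F.1#) * (φ ^∧ a * ψ (a F.* w)))
          ≈⟨ Σᶠ-cong (λ w → begin
            Σᶠ (λ a → conj χ ^∧ (w F.- F.1#) * (φ ^∧ a * ψ (a F.* w)))  ≈⟨ Σᶠ-*ˡ _ _ ⟨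
            conj χ ^∧ (w F.- F.1#) * Σᶠ (λ a → φ ^∧ a * ψ (a F.* w))    ≈⟨ *-congˡ (G-twist w) ⟩
            conj χ ^∧ (w F.- F.1#) * (φ ^∧ w * G φ)
              ≈⟨ solve 3 (λ x y z → x :* (y :* z) := z :* (x :* y)) refl _ _ _ ⟩
            G φ * (conj χ ^∧ (w F.- F.1#) * φ ^∧ w)                     ∎) ⟩
        Σᶠ (λ w → G φ * (conj χ ^∧ (w F.- F.1#) * φ ^∧ w))       ≈⟨ Σᶠ-*ˡ _ _ ⟨
        G φ * Σᶠ (λ w → conj χ ^∧ (w F.- F.1#) * φ ^∧ w)         ∎
        where
        substitute : ∀ a → (φ · χ) ^∧ a * ψ a * G (conj χ)
                           ≈ Σᶠ (λ w → conj χ ^∧ (w F.- F.1#) * (φ ^∧ a * ψ (a F.* w)))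
        substitute a with Fq.≈0∨unit a
        -- The substitution is not invertible at a = 0, but there the factors (φχ)(a) and φ(a) make
        -- both sides 0.
        ... | inj₁ a≈0 = begin
          (φ · χ) ^∧ a * ψ a * G (conj χ)  ≈⟨ *-congʳ (trans (*-congʳ (^∧-0 (φ · χ) a≈0)) (zeroˡ _)) ⟩
          0# * G (conj χ)                  ≈⟨ zeroˡ _ ⟩
          0#                               ≈⟨ Σᶠ-0 ⟨
          Σᶠ (λ _ → 0#)                    ≈⟨ Σᶠ-cong (λ w → trans (*-congˡ
            (trans (*-congʳ (^∧-0 φ a≈0)) (zeroˡ _))) (zeroʳ _)) ⟨
          Σᶠ (λ w → conj χ ^∧ (w F.- F.1#) * (φ ^∧ a * ψ (a F.* w)))  ∎
        ... | inj₂ a#0 = begin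
          (φ · χ) ^∧ a * ψ a * G (conj χ)
            ≈⟨ *-congˡ (trans (Σᶠ-scale (G-term-cong (conj χ)) (a , a#0)) (Σᶠ-translate
                 (λ e → G-term-cong (conj χ) (F.*-congˡ e)) (F.- F.1#))) ⟩
          (φ · χ) ^∧ a * ψ a * Σᶠ (λ w → conj χ ^∧ (a F.* (w F.- F.1#)) * ψ (a F.* (w F.- F.1#)))
            ≈⟨ Σᶠ-*ˡ _ _ ⟩
          Σᶠ (λ w → (φ · χ) ^∧ a * ψ a * (conj χ ^∧ (a F.* (w F.- F.1#)) * ψ (a F.* (w F.- F.1#))))
            ≈⟨ Σᶠ-cong term ⟩
          Σᶠ (λ w → conj χ ^∧ (w F.- F.1#) * (φ ^∧ a * ψ (a F.* w)))  ∎
          where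
          χχ̄ : χ ^∧ a * conj χ ^∧ a ≈ 1#
          χχ̄ = trans (*-cong (^∧-unit χ (a , a#0)) (^∧-unit (conj χ) (a , a#0)))
                     (*-inverseʳ (Hom.⟦ χ ⟧ (a , a#0)))

          term : ∀ w → (φ · χ) ^∧ a * ψ a * (conj χ ^∧ (a F.* (w F.- F.1#)) * ψ (a F.* (w F.- F.1#)))
                       ≈ conj χ ^∧ (w F.- F.1#) * (φ ^∧ a * ψ (a F.* w))
          term w = begin
            (φ · χ) ^∧ a * ψ a * (conj χ ^∧ (a F.* v) * ψ (a F.* v))
              ≈⟨ *-cong (*-congʳ (^∧-· φ χ a)) (*-congʳ (^∧-* (conj χ) a v)) ⟩
            (φ ^∧ a * χ ^∧ a) * ψ a * ((conj χ ^∧ a * conj χ ^∧ v) * ψ (a F.* v))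
              ≈⟨ solve 6 (λ f x p y z s → f :* x :* p :* ((y :* z) :* s)
                           := (x :* y) :* (z :* (f :* (p :* s)))) refl _ _ _ _ _ _ ⟩
            (χ ^∧ a * conj χ ^∧ a) * (conj χ ^∧ v * (φ ^∧ a * (ψ a * ψ (a F.* v))))
              ≈⟨ *-cong χχ̄ (*-congˡ (*-congˡ (sym (ψ-+ a (a F.* v))))) ⟩
            1# * (conj χ ^∧ v * (φ ^∧ a * ψ (a F.+ a F.* v)))
              ≈⟨ *-identityˡ _ ⟩
            conj χ ^∧ v * (φ ^∧ a * ψ (a F.+ a F.* v))
              ≈⟨ *-congˡ (*-congˡ (ψ-cong (F.solve 2 (λ a w →
                   a F.:+ a F.:* (w F.:- F.con (ℤ.+ 1)) F.:= a F.:* w) F.refl a w))) ⟩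
            conj χ ^∧ v * (φ ^∧ a * ψ (a F.* w))  ∎
            where v = w F.- F.1#

-- The quadratic character, square roots, and the substitution for h.

module QuadraticCharacter (F : HeytingField c ℓ r) {n} (card : HasCardinality F (suc n))
                          (K : HeytingField c′ ℓ′ r′) where
  private
    module F where
      open FieldNotions F public
      open FieldProperties F public
    module Fq where
      open FiniteField F card public
      open FiniteFieldProperties F card public
    module Ext = ExtendFromUnits F card (HeytingField.setoid K)
    module ExtF = ExtendFromUnits F card (HeytingField.setoid F)
  open FieldNotions K
  open FieldProperties K
  open ListSumProperties K
  open CharacterSums F card K
  open AbelianGroup characterGroup using () renaming (Carrier to Character; _⁻¹ to conj)
  open Inverse card using (from; to; inverseʳ)
  open ≈-Reasoning setoid

  δ : F.Carrier → F.Carrier → Carrier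
  δ x y = indicator (x Fq.≟ y)

  δ-≈ : ∀ {x y} → x F.≈ y → δ x y ≈ 1#
  δ-≈ {x} {y} e with x Fq.≟ y
  ... | yes _ = refl
  ... | no ne = contradiction e ne

  δ-≉ : ∀ {x y} → ¬ (x F.≈ y) → δ x y ≈ 0#
  δ-≉ {x} {y} ne with x Fq.≟ y
  ... | yes e = contradiction e ne
  ... | no  _ = refl

  δ-cong : ∀ {x x′ y y′} → x F.≈ x′ → y F.≈ y′ → δ x y ≈ δ x′ y′
  δ-cong {x} {x′} {y} {y′} ex ey with x Fq.≟ y
  ... | yes e = sym (δ-≈ (F.trans (F.sym ex) (F.trans e ey)))
  ... | no ne = sym (δ-≉ λ e → ne (F.trans ex (F.trans e (F.sym ey))))

  Σδ : ∀ a → Σᶠ (λ x → δ x a) ≈ 1#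
  Σδ a = trans (Σᶠ-single (λ e → δ-cong e F.refl) a (λ x → δ-≉)) (δ-≈ F.refl)

  module _ {g} (φ : Character) (g-generates : ∀ {x} → x F.# F.0# → ∃ λ i → x F.≈ g F.^ i) (g#0 : g F.# F.0#)
           (φ-nontrivial : ¬ (∀ u → φ ⟨ u ⟩ ≈ 1#)) (φ²≈1 : ∀ u → φ ⟨ u ⟩ * φ ⟨ u ⟩ ≈ 1#) where

    φ-square : ∀ {x} → x F.# F.0# → φ ^∧ x * φ ^∧ x ≈ 1#
    φ-square {x} x#0 = trans (*-cong (^∧-unit φ (x , x#0)) (^∧-unit φ (x , x#0))) (φ²≈1 (x , x#0))

    -- The value squares to 1 and is not 1: every unit is a power of g, so φ would be trivial.
    φ-generator : φ ^∧ g ≈ - 1#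
    φ-generator = x-y≈0⇒x≈y (x≉0⇒xy≈0⇒y≈0 {φ ^∧ g - 1#} (λ e → φg≉1 (x-y≈0⇒x≈y e)) (begin
      (φ ^∧ g - 1#) * (φ ^∧ g - - 1#)  ≈⟨ solve 1 (λ x → (x :- con (ℤ.+ 1)) :* (x :- (:- con (ℤ.+ 1)))
                                            := x :* x :- con (ℤ.+ 1)) refl (φ ^∧ g) ⟩
      φ ^∧ g * φ ^∧ g - 1#             ≈⟨ x≈y⇒x-y≈0 (φ-square g#0) ⟩
      0#                               ∎))
      where
      φg≉1 : ¬ (φ ^∧ g ≈ 1#)
      φg≉1 φg≈1 = φ-nontrivial λ u → let i , u≈gⁱ = g-generates (proj₂ u) in begin
        φ ⟨ u ⟩            ≈⟨ ^∧-unit φ u ⟨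
        φ ^∧ proj₁ u       ≈⟨ ^∧-cong φ u≈gⁱ ⟩
        φ ^∧ (g F.^ i)     ≈⟨ ^∧-^ φ g i ⟩
        (φ ^∧ g) ^ i       ≈⟨ ^-congˡ i φg≈1 ⟩
        1# ^ i             ≈⟨ 1^n≈1 i ⟩
        1#                 ∎

    -- The parity of the exponent in x = gⁱ decides: even powers are squares, and φ(g) = -1 settles
    -- the odd ones.
    square∨φ≈-1 : ∀ {x} → x F.# F.0# → (∃ λ y → y F.* y F.≈ x) ⊎ φ ^∧ x ≈ - 1#
    square∨φ≈-1 {x} x#0 = let i , x≈gⁱ = g-generates x#0 in
      [ (λ (y , e) → inj₁ (y , F.trans e (F.sym x≈gⁱ))) , (λ e → inj₂ (trans (^∧-cong φ x≈gⁱ) e)) ] (go i)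
      where
      go : ∀ i → (∃ λ y → y F.* y F.≈ g F.^ i) ⊎ φ ^∧ (g F.^ i) ≈ - 1#
      go zero          = inj₁ (F.1# , F.*-identityˡ F.1#)
      go (suc zero)    = inj₂ (trans (^∧-cong φ (F.*-identityʳ g)) φ-generator)
      go (suc (suc i)) = [ (λ (y , e) → inj₁ (g F.* y , F.trans
          (F.solve 2 (λ g y → (g F.:* y) F.:* (g F.:* y) F.:= g F.:* (g F.:* (y F.:* y))) F.refl g y)
          (F.*-congˡ (F.*-congˡ e))))
        , (λ e → inj₂ (begin
            φ ^∧ (g F.* (g F.* g F.^ i))       ≈⟨ trans (^∧-* φ g _) (*-congˡ (^∧-* φ g _)) ⟩
            φ ^∧ g * (φ ^∧ g * φ ^∧ (g F.^ i)) ≈⟨ *-assoc _ _ _ ⟨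
            φ ^∧ g * φ ^∧ g * φ ^∧ (g F.^ i)   ≈⟨ *-cong (φ-square g#0) e ⟩
            1# * - 1#                          ≈⟨ *-identityˡ _ ⟩
            - 1#                               ∎)) ] (go i)

    module _ (2#0 : F.1# F.+ F.1# F.# F.0#) where

      -- Zero has one root; a nonsquare has none, and φ is -1 there; a nonzero square y₀² has
      -- exactly the roots y₀ and -y₀, which differ because 2 is invertible.
      square-count : ∀ w → Σᶠ (λ y → δ (y F.* y) w) ≈ 1# + φ ^∧ w
      square-count w with Fq.≈0∨unit w
      ... | inj₁ w≈0 = begin
        Σᶠ (λ y → δ (y F.* y) w)  ≈⟨ Σᶠ-single (λ e → δ-cong (F.*-cong e e) F.refl) F.0#
          (λ y y≉0 → δ-≉ λ e → y≉0 (F.x≉0⇒xy≈0⇒y≈0 y≉0 (F.trans e w≈0))) ⟩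
        δ (F.0# F.* F.0#) w       ≈⟨ δ-≈ (F.trans (F.zeroˡ _) (F.sym w≈0)) ⟩
        1#                        ≈⟨ +-identityʳ 1# ⟨
        1# + 0#                   ≈⟨ +-congˡ (^∧-0 φ w≈0) ⟨
        1# + φ ^∧ w               ∎
      ... | inj₂ w#0 = go (Fin.any? (λ i → from i F.* from i Fq.≟ w))
        where
        go : Dec (∃ λ i → from i F.* from i F.≈ w) → Σᶠ (λ y → δ (y F.* y) w) ≈ 1# + φ ^∧ w
        go (no ∄i) = begin
          Σᶠ (λ y → δ (y F.* y) w)  ≈⟨ Σᶠ-cong (λ y → δ-≉ (nonsquare y)) ⟩
          Σᶠ (λ _ → 0#)             ≈⟨ Σᶠ-0 ⟩
          0#                        ≈⟨ -‿inverseʳ 1# ⟨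
          1# - 1#                   ≈⟨ +-congˡ ([ (λ (y , e) → contradiction e (nonsquare y)) , sym ]
                                         (square∨φ≈-1 w#0)) ⟩
          1# + φ ^∧ w               ∎
          where
          nonsquare : ∀ y → ¬ (y F.* y F.≈ w)
          nonsquare y e = ∄i (to y , F.trans (F.*-cong (inverseʳ ≡.refl) (inverseʳ ≡.refl)) e)
        go (yes (i , y₀²≈w)) = begin
          Σᶠ (λ y → δ (y F.* y) w)                       ≈⟨ Σᶠ-cong pair ⟩
          Σᶠ (λ y → δ y y₀ + δ y (F.- y₀))               ≈⟨ Σᶠ-∙ (λ y → δ y y₀) (λ y → δ y (F.- y₀)) ⟩
          Σᶠ (λ y → δ y y₀) + Σᶠ (λ y → δ y (F.- y₀))    ≈⟨ +-cong (Σδ y₀) (Σδ (F.- y₀)) ⟩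
          1# + 1#                                        ≈⟨ +-congˡ (φ-square y₀#0) ⟨
          1# + φ ^∧ y₀ * φ ^∧ y₀                         ≈⟨ +-congˡ (^∧-* φ y₀ y₀) ⟨
          1# + φ ^∧ (y₀ F.* y₀)                          ≈⟨ +-congˡ (^∧-cong φ y₀²≈w) ⟩
          1# + φ ^∧ w                                    ∎
          where
          y₀ = from i

          y₀≉0 : ¬ (y₀ F.≈ F.0#)
          y₀≉0 e = F.#⇒≉ w#0 (F.trans (F.sym y₀²≈w) (F.trans (F.*-congʳ e) (F.zeroˡ _)))

          y₀#0 = Fq.≉0⇒#0 y₀≉0

          y₀≉-y₀ : ¬ (y₀ F.≈ F.- y₀)
          y₀≉-y₀ e = y₀≉0 (F.x≉0⇒xy≈0⇒y≈0 (F.#⇒≉ 2#0) (F.trans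
            (F.solve 1 (λ y → (F.con (ℤ.+ 1) F.:+ F.con (ℤ.+ 1)) F.:* y F.:= y F.:- (F.:- y)) F.refl y₀)
            (F.x≈y⇒x-y≈0 e)))

          pair : ∀ y → δ (y F.* y) w ≈ δ y y₀ + δ y (F.- y₀)
          pair y with y Fq.≟ y₀
          ... | yes y≈y₀ = begin
            δ (y F.* y) w     ≈⟨ δ-≈ (F.trans (F.*-cong y≈y₀ y≈y₀) y₀²≈w) ⟩
            1#                ≈⟨ +-identityʳ 1# ⟨
            1# + 0#           ≈⟨ +-congˡ (δ-≉ λ e → y₀≉-y₀ (F.trans (F.sym y≈y₀) e)) ⟨
            1# + δ y (F.- y₀) ∎
          ... | no y≉y₀ with y Fq.≟ (F.- y₀)
          ...   | yes y≈-y₀ = trans (δ-≈ (F.trans (F.*-cong y≈-y₀ y≈-y₀) (F.trans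
                  (F.solve 1 (λ y → (F.:- y) F.:* (F.:- y) F.:= y F.:* y) F.refl y₀) y₀²≈w)))
                  (sym (+-identityˡ 1#))
          ...   | no  y≉-y₀ = trans (δ-≉ λ e → y≉-y₀ (F.x-y≈0⇒x≈y (F.x≉0⇒xy≈0⇒y≈0
                  (λ e′ → y≉y₀ (F.x-y≈0⇒x≈y e′)) (F.trans
                    (F.solve 2 (λ y z → (y F.:- z) F.:* (y F.:- (F.:- z)) F.:= y F.:* y F.:- z F.:* z) F.refl y y₀)
                    (F.x≈y⇒x-y≈0 (F.trans e (F.sym y₀²≈w)))))))
                  (sym (+-identityˡ 0#))

      -- Group the y by their square w; `square-count` gives the size of each group.
      Σᶠ-squares : ∀ {f} → Congruent f → Σᶠ (λ y → f (y F.* y)) ≈ Σᶠ f + Σᶠ (λ w → f w * φ ^∧ w)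
      Σᶠ-squares {f} f-cong = begin
        Σᶠ (λ y → f (y F.* y))                       ≈⟨ Σᶠ-cong (λ y → trans (Σᶠ-single
            (λ e → *-cong (f-cong e) (δ-cong F.refl e)) (y F.* y)
            (λ w w≉ → trans (*-congˡ (δ-≉ λ e → w≉ (F.sym e))) (zeroʳ _)))
          (trans (*-congˡ (δ-≈ F.refl)) (*-identityʳ _))) ⟨
        Σᶠ (λ y → Σᶠ λ w → f w * δ (y F.* y) w)      ≈⟨ Σᶠ-comm (λ y w → f w * δ (y F.* y) w) ⟩
        Σᶠ (λ w → Σᶠ λ y → f w * δ (y F.* y) w)      ≈⟨ Σᶠ-cong (λ w → trans (sym (Σᶠ-*ˡ (f w) _)) (trans
            (*-congˡ (square-count w)) (trans (distribˡ _ _ _) (+-congʳ (*-identityʳ _))))) ⟩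
        Σᶠ (λ w → f w + f w * φ ^∧ w)                ≈⟨ Σᶠ-∙ f (λ w → f w * φ ^∧ w) ⟩
        Σᶠ f + Σᶠ (λ w → f w * φ ^∧ w)               ∎

  private
    inv₀ : F.Carrier → F.Carrier
    inv₀ = ExtF.extend F.0# (proj₁ ∘ F._⁻¹)

    ⁻¹-cong : ∀ {u v} → proj₁ u F.≈ proj₁ v → proj₁ (u F.⁻¹) F.≈ proj₁ (v F.⁻¹)
    ⁻¹-cong {u} {v} = AbelianGroup.⁻¹-cong F.unitGroup {u} {v}

    inv₀-cong : ∀ {x y} → x F.≈ y → inv₀ x F.≈ inv₀ y
    inv₀-cong = ExtF.extend-cong F.0# (λ {u} {v} → ⁻¹-cong {u} {v})

    inv₀-unit : ∀ u → inv₀ (proj₁ u) F.≈ proj₁ (u F.⁻¹)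
    inv₀-unit = ExtF.extend-unit F.0# (λ {u} {v} → ⁻¹-cong {u} {v})

    inv₀-0 : ∀ {x} → x F.≈ F.0# → inv₀ x F.≈ F.0#
    inv₀-0 = ExtF.extend-0 F.0# (λ {u} {v} → ⁻¹-cong {u} {v})

    inv₀-involutive : ∀ x → inv₀ (inv₀ x) F.≈ x
    inv₀-involutive x with Fq.≈0∨unit x
    ... | inj₁ x≈0 = F.trans (inv₀-0 (inv₀-0 x≈0)) (F.sym x≈0)
    ... | inj₂ x#0 = F.trans (inv₀-cong (inv₀-unit (x , x#0))) (F.trans (inv₀-unit ((x , x#0) F.⁻¹))
      (GroupProperties.⁻¹-involutive F.multiplicativeGroup (x , x#0)))

    -- Unlike x · x⁻¹ = 1, this form of the inverse law survives the convention 1 / 0 = 0, so the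
    -- computation of 1 - y² in `Σh` needs no case distinction.
    inv₀-regular : ∀ x → inv₀ x F.≈ x F.* (inv₀ x F.* inv₀ x)
    inv₀-regular x with Fq.≈0∨unit x
    ... | inj₁ x≈0 = F.trans (inv₀-0 x≈0) (F.sym (F.trans (F.*-congʳ x≈0) (F.zeroˡ _)))
    ... | inj₂ x#0 = F.trans (F.sym (F.*-identityˡ _)) (F.trans (F.*-congʳ (F.sym
      (F.trans (F.*-congˡ (inv₀-unit (x , x#0))) (F.*-inverseʳ (x , x#0))))) (F.*-assoc _ _ _))

  h : F.Unit → F.Carrier
  h u = proj₁ u F.+ F.fromℕ 2 F.+ proj₁ (u F.⁻¹)

  h-cong : ∀ {u v} → proj₁ u F.≈ proj₁ v → h u F.≈ h v
  h-cong {u} {v} e = F.+-cong (F.+-congʳ e) (⁻¹-cong {u} {v} e)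

  x*h≈[x+1]² : ∀ u → proj₁ u F.* h u F.≈ (proj₁ u F.+ F.1#) F.* (proj₁ u F.+ F.1#)
  x*h≈[x+1]² u@(x , _) = F.trans (F.*-congˡ (F.+-congʳ (F.+-congˡ F.fromℕ2≈1+1))) (F.trans
    (F.solve 2 (λ x y → x F.:* (x F.:+ (F.con (ℤ.+ 1) F.:+ F.con (ℤ.+ 1)) F.:+ y)
      F.:= x F.:* x F.:+ (x F.:+ x) F.:+ x F.:* y) F.refl x _)
    (F.trans (F.+-congˡ (F.*-inverseʳ u)) (F.solve 1 (λ x → x F.:* x F.:+ (x F.:+ x) F.:+ F.con (ℤ.+ 1)
      F.:= (x F.:+ F.con (ℤ.+ 1)) F.:* (x F.:+ F.con (ℤ.+ 1))) F.refl x)))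

  -- The substitution y = 1 − 2 / (x + 1) turns 1 − y² into 4 x / (x + 1)², the
  -- inverse of h x / 4; with 1 / 0 = 0 it is a bijection of the whole field.
  Σh : (2#0 : F.1# F.+ F.1# F.# F.0#) → ∀ {¼} → ¼ F.* ((F.1# F.+ F.1#) F.* (F.1# F.+ F.1#)) F.≈ F.1# → ∀ χ →
       sumOver Fq.units (λ u → χ ^∧ (h u F.* ¼)) ≈ Σᶠ (λ y → conj χ ^∧ (F.1# F.- y F.* y))
  Σh 2#0 {¼} ¼*4≈1 χ = begin
    sumOver Fq.units (λ u → χ ^∧ (h u F.* ¼))        ≈⟨ sumOver-units _ ⟩
    Σᶠ (Ext.extend 0# (λ u → χ ^∧ (h u F.* ¼)))      ≈⟨ Σᶠ-cong pointwise ⟩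
    Σᶠ (λ x → f (-2ᶠ F.* inv₀ (x F.+ F.1#) F.+ F.1#))  ≈⟨ Σᶠ-translate
      (λ e → f-cong (F.+-congʳ (F.*-congˡ (inv₀-cong e)))) F.1# ⟨
    Σᶠ (λ x → f (-2ᶠ F.* inv₀ x F.+ F.1#))            ≈⟨ Σᶠ-reindex {λ x → f (-2ᶠ F.* x F.+ F.1#)} inv₀ inv₀
      (λ e → f-cong (F.+-congʳ (F.*-congˡ e))) inv₀-cong inv₀-cong inv₀-involutive inv₀-involutive ⟨
    Σᶠ (λ x → f (-2ᶠ F.* x F.+ F.1#))                 ≈⟨ Σᶠ-scale {λ x → f (x F.+ F.1#)} (λ e → f-cong (F.+-congʳ e)) (-2ᶠ , -2ᶠ#0) ⟨
    Σᶠ (λ x → f (x F.+ F.1#))                        ≈⟨ Σᶠ-translate f-cong F.1# ⟨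
    Σᶠ f                                             ∎
    where
    2ᶠ = F.1# F.+ F.1#
    -2ᶠ = F.- 2ᶠ

    -2ᶠ#0 : -2ᶠ F.# F.0#
    -2ᶠ#0 = Fq.≉0⇒#0 λ e → F.#⇒≉ 2#0 (F.trans (F.sym (F.-‿involutive 2ᶠ)) (F.trans (F.-‿cong e) F.-0#≈0#))

    f : F.Carrier → Carrier
    f y = conj χ ^∧ (F.1# F.- y F.* y)

    f-cong : Congruent f
    f-cong e = ^∧-cong (conj χ) (F.+-congˡ (F.-‿cong (F.*-cong e e)))

    -- 1 - (1 - 2v)² = 4 (v - v²), and v = (x + 1) v² replaces v - v² by x v².
    argument : ∀ x → let v = inv₀ (x F.+ F.1#); y = -2ᶠ F.* v F.+ F.1# in
               F.1# F.- y F.* y F.≈ (2ᶠ F.* 2ᶠ) F.* (x F.* (v F.* v))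
    argument x = F.trans (F.solve 1 (λ v → let one = F.con (ℤ.+ 1); y = (F.:- (one F.:+ one)) F.:* v F.:+ one in
        one F.:- y F.:* y F.:= ((one F.:+ one) F.:* (one F.:+ one)) F.:* (v F.:- v F.:* v)) F.refl v)
      (F.*-congˡ (F.trans (F.+-congʳ (inv₀-regular (x F.+ F.1#)))
        (F.solve 2 (λ x v → (x F.:+ F.con (ℤ.+ 1)) F.:* (v F.:* v) F.:- v F.:* v F.:= x F.:* (v F.:* v)) F.refl x v)))
      where v = inv₀ (x F.+ F.1#)

    pointwise : ∀ x → Ext.extend 0# (λ u → χ ^∧ (h u F.* ¼)) x ≈ f (-2ᶠ F.* inv₀ (x F.+ F.1#) F.+ F.1#)
    pointwise x = trans (cases (Fq.≈0∨unit x)) (^∧-cong (conj χ) (F.sym (argument x)))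
      where
      v = inv₀ (x F.+ F.1#)

      hχ-cong : ∀ {u u′} → proj₁ u F.≈ proj₁ u′ → χ ^∧ (h u F.* ¼) ≈ χ ^∧ (h u′ F.* ¼)
      hχ-cong {u} {u′} e = ^∧-cong χ (F.*-congʳ (h-cong {u} {u′} e))

      -- x = 0 goes to y = -1 and x = -1 to y = 1, where 1 - y² = 0. The left side is 0 there as
      -- well, by the extension and by h(-1) = 0.
      cases : x F.≈ F.0# ⊎ x F.# F.0# →
              Ext.extend 0# (λ u → χ ^∧ (h u F.* ¼)) x ≈ conj χ ^∧ ((2ᶠ F.* 2ᶠ) F.* (x F.* (v F.* v)))
      cases (inj₁ x≈0) = trans (Ext.extend-0 0# (λ {u} {u′} → hχ-cong {u} {u′}) x≈0)
        (sym (^∧-0 (conj χ) (F.trans (F.*-congˡ (F.trans (F.*-congʳ x≈0) (F.zeroˡ _))) (F.zeroʳ _))))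
      cases (inj₂ x#0) = trans (Ext.extend-unit 0# (λ {u} {u′} → hχ-cong {u} {u′}) (x , x#0))
        (split (Fq.≈0∨unit (x F.+ F.1#)))
        where
        split : x F.+ F.1# F.≈ F.0# ⊎ x F.+ F.1# F.# F.0# →
                χ ^∧ (h (x , x#0) F.* ¼) ≈ conj χ ^∧ ((2ᶠ F.* 2ᶠ) F.* (x F.* (v F.* v)))
        split (inj₁ x+1≈0) = trans (^∧-0 χ (F.trans (F.*-congʳ h≈0) (F.zeroˡ _)))
          (sym (^∧-0 (conj χ) (F.trans (F.*-congˡ (F.trans (F.*-congˡ
            (F.trans (F.*-congʳ (inv₀-0 x+1≈0)) (F.zeroˡ _))) (F.zeroʳ _))) (F.zeroʳ _))))
          where
          h≈0 : h (x , x#0) F.≈ F.0#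
          h≈0 = F.x≉0⇒xy≈0⇒y≈0 (F.#⇒≉ x#0) (F.trans (x*h≈[x+1]² (x , x#0))
            (F.trans (F.*-congʳ x+1≈0) (F.zeroˡ _)))
        split (inj₂ x+1#0) = sym (^∧-conj χ (F.trans
          (F.solve 5 (λ t x v h q → (t F.:* (x F.:* (v F.:* v))) F.:* (h F.:* q)
            F.:= (q F.:* t) F.:* ((x F.:* h) F.:* (v F.:* v))) F.refl (2ᶠ F.* 2ᶠ) x v (h (x , x#0)) ¼)
          (F.trans (F.*-cong ¼*4≈1 (F.trans (F.*-congʳ (x*h≈[x+1]² (x , x#0))) (F.trans
            (F.solve 2 (λ s v → (s F.:* s) F.:* (v F.:* v) F.:= (s F.:* v) F.:* (s F.:* v)) F.refl (x F.+ F.1#) v)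
            (F.trans (F.*-cong sv≈1 sv≈1) (F.*-identityˡ _))))) (F.*-identityˡ _))))
          where
          sv≈1 : (x F.+ F.1#) F.* v F.≈ F.1#
          sv≈1 = F.trans (F.*-congˡ (inv₀-unit (_ , x+1#0))) (F.*-inverseʳ (_ , x+1#0))

-- Faithfulness of a generator of the character group, and orthogonality.

module DualGroup (F : HeytingField c ℓ r) {n} (card : HasCardinality F (suc n)) (n≢0 : n ≢ 0)
                 (K : HeytingField c′ ℓ′ r′) where
  private
    module F where
      open FieldNotions F public
      open FieldProperties F public
    module Fq where
      open FiniteField F card public
      open FiniteFieldProperties F card public
  open FieldNotions K
  open FieldProperties K
  open CharacterSums F card K
  open QuadraticCharacter F card K using (δ; δ-≈; δ-≉)
  open AbelianGroup characterGroup using ()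
    renaming (Carrier to Character; _⁻¹ to conj; group to charGroup)
  open SemiringSum semiring using (sum; sum-cong-≋; sum-init-last; sum-replicate; *-distribˡ-sum; sum-replicate-zero)
  open PrimitiveRoot F card n≢0
  open OrderProperties F using (IsOrder)
  open OrderProperties K using (xᵐ≈1⇒xᵏ≈1)
  module Kˣ = GroupNotions multiplicativeGroup
  module Ch = GroupNotions charGroup
  open ≈-Reasoning setoid

  ^ℤ-value : ∀ x m → proj₁ (x Kˣ.^ℤ (ℤ.+ m)) ≡ proj₁ x ^ m
  ^ℤ-value x zero    = ≡.refl
  ^ℤ-value x (suc m) = ≡.cong (proj₁ x *_) (^ℤ-value x m)

  power : Character → ℕ → Character
  power χ m = χ Ch.^ℤ (ℤ.+ m)

  power-value : ∀ χ m u → power χ m ⟨ u ⟩ ≡ (χ ⟨ u ⟩) ^ m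
  power-value χ zero    u = ≡.refl
  power-value χ (suc m) u = ≡.cong (χ ⟨ u ⟩ *_) (power-value χ m u)

  negative-power-value : ∀ χ m u → (χ Ch.^ℤ (ℤ.- (ℤ.+ m))) ⟨ u ⟩ ≈ conj (power χ m) ⟨ u ⟩
  -- The negative of 0 is again `ℤ.+ 0`, so here 1 is compared with 1⁻¹.
  negative-power-value χ zero    u = sym (GroupProperties.ε⁻¹≈ε multiplicativeGroup)
  negative-power-value χ (suc m) u = refl

  -- `IsGenerator` provides integer exponents; a negative one is handled through its inverse, whose
  -- m-th power is 1.
  integer-power≈1 : ∀ χ j u m → (χ ⟨ u ⟩) ^ m ≈ 1# → ((χ Ch.^ℤ j) ⟨ u ⟩) ^ m ≈ 1#
  integer-power≈1 χ (ℤ.+ a) u m e = begin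
    (power χ a ⟨ u ⟩) ^ m   ≡⟨ ≡.cong (_^ m) (power-value χ a u) ⟩
    ((χ ⟨ u ⟩) ^ a) ^ m     ≈⟨ ^-comm _ a m ⟩
    ((χ ⟨ u ⟩) ^ m) ^ a     ≈⟨ trans (^-congˡ a e) (1^n≈1 a) ⟩
    1#                      ∎
  integer-power≈1 χ ℤ.-[1+ a ] u m e = begin
    y ^ m                                ≈⟨ *-identityˡ _ ⟨
    1# * y ^ m                           ≈⟨ *-congʳ (integer-power≈1 χ (ℤ.+ suc a) u m e) ⟨
    (power χ (suc a) ⟨ u ⟩) ^ m * y ^ m  ≈⟨ ^-distrib-* _ y m ⟨
    (power χ (suc a) ⟨ u ⟩ * y) ^ m      ≈⟨ ^-congˡ m (*-inverseʳ (Hom.⟦ power χ (suc a) ⟧ u)) ⟩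
    1# ^ m                               ≈⟨ 1^n≈1 m ⟩
    1#                                   ∎
    where y = (χ Ch.^ℤ ℤ.-[1+ a ]) ⟨ u ⟩

  module _ (η : Unit) (η-order : Kˣ.HasOrder η n) {g} (g#0 : g F.# F.0#) (g-order : IsOrder g n) where
    open Kˣ.HasOrder η-order

    private
      y = proj₁ η

      yⁿ≈1 : y ^ n ≈ 1#
      yⁿ≈1 = trans (reflexive (≡.sym (^ℤ-value η n))) xⁿ≈ε

      log : F.Unit → ℕ
      log u = proj₁ (discrete-log g#0 g-order (proj₂ u))

      u≈g^log : ∀ u → proj₁ u F.≈ g F.^ log u
      u≈g^log u = proj₂ (proj₂ (discrete-log g#0 g-order (proj₂ u)))

      ≤-transfer : ∀ {a b} → a ≤ b → g F.^ a F.≈ g F.^ b → y ^ a ≈ y ^ b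
      ≤-transfer {a} {b} a≤b e = begin
        y ^ a                  ≈⟨ *-identityʳ _ ⟨
        y ^ a * 1#             ≈⟨ *-congˡ (xᵐ≈1⇒xᵏ≈1 (gᵃ≈gᵇ⇒n∣b∸a g#0 g-order a≤b e) yⁿ≈1) ⟨
        y ^ a * y ^ (b ∸ a)    ≈⟨ ^-homo-* y a (b ∸ a) ⟨
        y ^ (a ℕ.+ (b ∸ a))    ≡⟨ ≡.cong (y ^_) (ℕ.m+[n∸m]≡n a≤b) ⟩
        y ^ b                  ∎

      transfer : ∀ a b → g F.^ a F.≈ g F.^ b → y ^ a ≈ y ^ b
      transfer a b e = [ (λ a≤b → ≤-transfer a≤b e) , (λ b≤a → sym (≤-transfer b≤a (F.sym e))) ]′ (ℕ.≤-total a b)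

      value : F.Unit → Unit
      value u = y ^ log u , ^#0 (log u) (proj₂ η)

      value-cong : ∀ {u v} → proj₁ u F.≈ proj₁ v → y ^ log u ≈ y ^ log v
      value-cong {u} {v} e = transfer (log u) (log v)
        (F.trans (F.sym (u≈g^log u)) (F.trans e (u≈g^log v)))

      value-* : ∀ u v → y ^ log (u F.*ᵘ v) ≈ y ^ log u * y ^ log v
      value-* u v = trans (transfer (log (u F.*ᵘ v)) (log u ℕ.+ log v)
        (F.trans (F.sym (u≈g^log (u F.*ᵘ v))) (F.trans (F.*-cong (u≈g^log u) (u≈g^log v))
          (F.sym (F.^-homo-* g (log u) (log v)))))) (^-homo-* y (log u) (log v))

      value-1 : y ^ log (F.1# , F.1#0) ≈ 1#
      value-1 = transfer (log (F.1# , F.1#0)) 0 (F.sym (u≈g^log (F.1# , F.1#0)))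

    -- The character gⁱ ↦ ηⁱ, well defined since gᵃ = gᵇ forces n ∣ b - a and ηⁿ = 1.
    χ₀ : Character
    χ₀ = record
      { ⟦_⟧ = value
      ; isGroupHomomorphism = record
        { isMonoidHomomorphism = record
          { isMagmaHomomorphism = record
            { isRelHomomorphism = record { cong = λ {u} {v} → value-cong {u} {v} } ; homo = value-* }
          ; ε-homo = value-1 }
        ; ⁻¹-homo = λ u → GroupProperties.inverseˡ-unique multiplicativeGroup (value (u F.⁻¹)) (value u)
            (trans (sym (value-* (u F.⁻¹) u)) (trans
              (value-cong {(u F.⁻¹) F.*ᵘ u} {F.1# , F.1#0} (AbelianGroup.inverseˡ F.unitGroup u)) value-1)) } }

    module _ {ω} (ω-generates : Ch.IsGenerator ω) where

      -- χ₀ is a power of ω, and its value η at g has order n.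
      generator-faithful : ∀ m → 0 ℕ.< m → m ℕ.< n → ¬ ((ω ⟨ g , g#0 ⟩) ^ m ≈ 1#)
      generator-faithful m 0<m m<n e = minimal m 0<m m<n (begin
        proj₁ (η Kˣ.^ℤ (ℤ.+ m))      ≡⟨ ^ℤ-value η m ⟩
        y ^ m                        ≈⟨ ^-congˡ m (trans (sym (*-identityʳ y)) (transfer 1 (log (g , g#0))
                                          (F.trans (F.*-identityʳ g) (u≈g^log (g , g#0))))) ⟩
        (χ₀ ⟨ g , g#0 ⟩) ^ m         ≈⟨ ^-congˡ m (proj₂ (ω-generates χ₀) (g , g#0)) ⟩
        ((ω Ch.^ℤ j) ⟨ g , g#0 ⟩) ^ m ≈⟨ integer-power≈1 ω j (g , g#0) m e ⟩
        1#                           ∎)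
        where j = proj₁ (ω-generates χ₀)

      power-nontrivial : ∀ m → 0 ℕ.< m → m ℕ.< n → ¬ (∀ u → power ω m ⟨ u ⟩ ≈ 1#)
      power-nontrivial m 0<m m<n trivial = generator-faithful m 0<m m<n
        (trans (reflexive (≡.sym (power-value ω m (g , g#0)))) (trivial (g , g#0)))

      generator-injective : ∀ u → ω ⟨ u ⟩ ≈ 1# → proj₁ u F.≈ F.1#
      generator-injective u e with discrete-log g#0 g-order (proj₂ u)
      ... | zero  , _   , u≈1 = u≈1
      ... | suc i , i<n , u≈gⁱ = contradiction (trans (^-congˡ (suc i) (sym (^∧-unit ω (g , g#0))))
              (trans (sym (^∧-^ ω g (suc i))) (trans (^∧-cong ω (F.sym u≈gⁱ)) (trans (^∧-unit ω u) e)))) (generator-faithful (suc i) (ℕ.s≤s ℕ.z≤n) i<n)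

      private
        geometric : ∀ {z} → z ^ n ≈ 1# → ¬ (z ≈ 1#) → sum {n} (λ i → z ^ toℕ i) ≈ 0#
        geometric {z} zⁿ≈1 z≉1 = ax≈x⇒x≈0 z≉1 (go n zⁿ≈1)
          where
          go : ∀ n → z ^ n ≈ 1# → z * sum {n} (λ i → z ^ toℕ i) ≈ sum {n} (λ i → z ^ toℕ i)
          go zero _ = zeroʳ z
          go (suc n) zⁿ≈1 = begin
            z * sum {suc n} (λ i → z ^ toℕ i)         ≈⟨ *-distribˡ-sum {suc n} z (λ i → z ^ toℕ i) ⟩
            sum {suc n} (λ i → z ^ suc (toℕ i))       ≈⟨ sum-init-last {n} (λ i → z ^ suc (toℕ i)) ⟩
            sum {n} (λ i → z ^ suc (toℕ (Fin.inject₁ i))) + z ^ suc (toℕ (Fin.fromℕ n))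
              ≈⟨ +-cong (sum-cong-≋ {n} λ i → reflexive (≡.cong (λ j → z ^ suc j) (Fin.toℕ-inject₁ i)))
                        (trans (reflexive (≡.cong (λ j → z ^ suc j) (Fin.toℕ-fromℕ n))) zⁿ≈1) ⟩
            sum {n} (λ i → z ^ suc (toℕ i)) + 1#      ≈⟨ +-comm _ _ ⟩
            sum {suc n} (λ i → z ^ toℕ i)             ∎

      -- At a unit x ≠ 1 the sum is geometric with ratio ω(x), an n-th root of unity other than 1.
      -- At x = 0 every term vanishes, that of the trivial character included.
      orthogonality : ∀ x → sum {n} (λ i → power ω (toℕ i) ^∧ x) ≈ fromℕ n * δ x F.1#
      orthogonality x with Fq.≈0∨unit x
      ... | inj₁ x≈0 = begin
        sum {n} (λ i → power ω (toℕ i) ^∧ x)  ≈⟨ sum-cong-≋ {n} (λ i → ^∧-0 (power ω (toℕ i)) x≈0) ⟩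
        sum {n} (λ _ → 0#)                    ≈⟨ sum-replicate-zero n ⟩
        0#                                    ≈⟨ zeroʳ _ ⟨
        fromℕ n * 0#                          ≈⟨ *-congˡ (δ-≉ λ e → F.1≉0 (F.trans (F.sym e) x≈0)) ⟨
        fromℕ n * δ x F.1#                    ∎
      ... | inj₂ x#0 = trans (sum-cong-≋ {n} λ i → trans (^∧-unit (power ω (toℕ i)) u)
                                (reflexive (power-value ω (toℕ i) u))) (cases (x Fq.≟ F.1#))
        where
        u : F.Unit
        u = x , x#0

        ωu : ω ⟨ u ⟩ ≈ ω ^∧ x
        ωu = sym (^∧-unit ω u)

        ωuⁿ≈1 : (ω ⟨ u ⟩) ^ n ≈ 1#
        ωuⁿ≈1 = trans (trans (^-congˡ n ωu) (sym (^∧-^ ω x n))) (^∧-1 ω (Fq.fermat x#0))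

        cases : Dec (x F.≈ F.1#) → sum {n} (λ i → (ω ⟨ u ⟩) ^ toℕ i) ≈ fromℕ n * δ x F.1#
        cases (yes x≈1) = begin
          sum {n} (λ i → (ω ⟨ u ⟩) ^ toℕ i)  ≈⟨ sum-cong-≋ {n} (λ i → trans
            (^-congˡ (toℕ i) (trans ωu (^∧-1 ω x≈1))) (1^n≈1 (toℕ i))) ⟩
          sum {n} (λ _ → 1#)                 ≈⟨ sum-replicate n ⟩
          fromℕ n                            ≈⟨ *-identityʳ _ ⟨
          fromℕ n * 1#                       ≈⟨ *-congˡ (δ-≈ x≈1) ⟨
          fromℕ n * δ x F.1#                 ∎
        cases (no x≉1) = begin
          sum {n} (λ i → (ω ⟨ u ⟩) ^ toℕ i)  ≈⟨ geometric ωuⁿ≈1 (λ e → x≉1 (generator-injective u e)) ⟩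
          0#                                 ≈⟨ zeroʳ _ ⟨
          fromℕ n * 0#                       ≈⟨ *-congˡ (δ-≉ x≉1) ⟨
          fromℕ n * δ x F.1#                 ∎

-- The point count.

module PointCount {p k n} (p-prime : Prime p) (p≢2 : p ≢ 2) (1≤1+k : 1 ≤ suc k) (q≡p^1+k : suc n ≡ p ℕ.^ suc k)
            (F : HeytingField c ℓ r) (card : HasCardinality F (suc n)) (K : HeytingField c′ ℓ′ r′) where
  private
    module F where
      open FieldNotions F public
      open FieldProperties F public
    module Fq where
      open FiniteField F card public
      open FiniteFieldProperties F card public
    module Ext = ExtendFromUnits F card (HeytingField.setoid K)

  qpp : OddPrimePower (suc n)
  qpp = record { p = p ; k = suc k ; p-prime = p-prime ; p-odd = p≢2 ; k≥1 = 1≤1+k ; q≡p^k = q≡p^1+k }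

  n≢0 : n ≢ 0
  n≢0 ≡.refl = ℕ.<-irrefl ≡.refl (OddPrimePower.1<q qpp)

  open FieldNotions K
  open FieldProperties K
  open ListSum K
  open ListSumProperties K
  open SemiringSum semiring using (sum; sum-cong-≋)
  open CharacterSums F card K
  open QuadraticCharacter F card K
  open DualGroup F card n≢0 K
  open TraceProperties F card {p} {k} p-prime q≡p^1+k
  open PrimitiveRoot F card n≢0 using (discrete-log)
  open OrderProperties F using (IsOrder)
  open Fq.Trace p (suc k) using (tr; trace)
  open AbelianGroup characterGroup using ()
    renaming (Carrier to Character; _∙_ to _·_; _⁻¹ to conj)
  open Characters qpp F card K using (gaussSum; q-1; 1-q; H)
  open ≈-Reasoning setoid

  2#0 : F.1# F.+ F.1# F.# F.0#
  2#0 = Fq.≉0⇒#0 λ e → p≢2 (ℕ.≤-antisym (∣⇒≤ (fromℕm≈0⇒p∣m {2} (F.trans F.fromℕ2≈1+1 e))) 1<p)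

  4≈2*2 : F.fromℕ 4 F.≈ (F.1# F.+ F.1#) F.* (F.1# F.+ F.1#)
  4≈2*2 = F.trans (F.fromℕ-* 2 2) (F.*-cong F.fromℕ2≈1+1 F.fromℕ2≈1+1)

  4#0 : F.fromℕ 4 F.# F.0#
  4#0 = Fq.≉0⇒#0 λ e → F.#⇒≉ 2#0 (F.x≉0⇒xy≈0⇒y≈0 (F.#⇒≉ 2#0) (F.trans (F.sym 4≈2*2) e))

  ¼ : F.Carrier
  ¼ = proj₁ ((F.fromℕ 4 , 4#0) F.⁻¹)

  4*¼≈1 : F.fromℕ 4 F.* ¼ F.≈ F.1#
  4*¼≈1 = F.*-inverseʳ (F.fromℕ 4 , 4#0)

  S : Character → Carrier
  S χ = sumOver Fq.units (λ u → χ ^∧ (h u F.* ¼))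

  -- The Jacobi sum J(φ, χ⁻¹).
  J : Character → Character → Carrier
  J φ χ = Σᶠ (λ w → conj χ ^∧ (F.1# F.- w) * φ ^∧ w)

  δ-⇔ : ∀ {x x′ y y′} → (x F.≈ x′ → y F.≈ y′) → (y F.≈ y′ → x F.≈ x′) → δ x x′ ≈ δ y y′
  δ-⇔ {x} {x′} f f⁻¹ with x Fq.≟ x′
  ... | yes e = sym (δ-≈ (f e))
  ... | no ne = sym (δ-≉ (λ e → ne (f⁻¹ e)))

  private
    Πh : ∀ {d} → Vec F.Unit d → F.Carrier
    Πh xs = Fq.product (Vec.map h xs)

  -- Multiplication by the units ¼ᵈ and t brings the equation into the form z = 1, which
  -- orthogonality detects.
  indicator-onX : ∀ {d} t (xs : Vec F.Unit d) →
                  indicator (Fq.onX? t xs) ≈ δ (Πh xs F.* ¼ F.^ d F.* proj₁ t) F.1#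
  indicator-onX {d} t xs = δ-⇔
    (λ e → F.trans (F.*-congʳ (F.*-congʳ e)) rhs*≈1)
    (λ e → F.*-cancelˡ t (F.*-cancelˡ (¼ F.^ d , F.^#0 d (proj₂ ((F.fromℕ 4 , 4#0) F.⁻¹))) (F.trans
      (F.trans (swap (Πh xs)) e) (F.trans (F.sym rhs*≈1) (F.sym (swap _))))))
    where
    t⁻¹ = proj₁ (t F.⁻¹)

    swap : ∀ z → ¼ F.^ d F.* (proj₁ t F.* z) F.≈ z F.* ¼ F.^ d F.* proj₁ t
    swap z = F.solve 3 (λ c t z → c F.:* (t F.:* z) F.:= z F.:* c F.:* t) F.refl (¼ F.^ d) (proj₁ t) z

    rhs*≈1 : F.fromℕ 4 F.^ d F.* t⁻¹ F.* ¼ F.^ d F.* proj₁ t F.≈ F.1#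
    rhs*≈1 = F.trans (F.solve 4 (λ a s c t → a F.:* s F.:* c F.:* t F.:= (a F.:* c) F.:* (t F.:* s)) F.refl
        (F.fromℕ 4 F.^ d) t⁻¹ (¼ F.^ d) (proj₁ t))
      (F.trans (F.*-cong (F.trans (F.sym (F.^-distrib-* (F.fromℕ 4) ¼ d)) (F.trans (F.^-congˡ d 4*¼≈1) (F.1^n≈1 d)))
        (F.*-inverseʳ t)) (F.*-identityˡ _))

  -- χ is multiplicative and ¼ᵈ provides one ¼ per coordinate, so the sum factors.
  sumOver-tuples : ∀ χ d → sumOver (Fq.tuples d) (λ xs → χ ^∧ (Πh xs F.* ¼ F.^ d)) ≈ S χ ^ d
  sumOver-tuples χ zero    = trans (+-identityʳ _) (^∧-1 χ (F.*-identityʳ F.1#))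
  sumOver-tuples χ (suc d) = begin
    sumOver (Fq.tuples (suc d)) (λ xs → χ ^∧ (Πh xs F.* ¼ F.^ suc d))
      ≈⟨ sumOver-cartesianProductWith _∷_ Fq.units (Fq.tuples d) _ ⟩
    sumOver Fq.units (λ u → sumOver (Fq.tuples d) (λ xs → χ ^∧ (h u F.* Πh xs F.* (¼ F.* ¼ F.^ d))))
      ≈⟨ sumOver-cong Fq.units (λ u → trans (sumOver-cong (Fq.tuples d) (λ xs → trans
           (^∧-cong χ (F.solve 4 (λ a b c e → a F.:* b F.:* (c F.:* e) F.:= (a F.:* c) F.:* (b F.:* e)) F.refl _ _ _ _))
           (^∧-* χ _ _))) (sym (*-distribˡ-sumOver _ (Fq.tuples d) _))) ⟩
    sumOver Fq.units (λ u → χ ^∧ (h u F.* ¼) * sumOver (Fq.tuples d) (λ xs → χ ^∧ (Πh xs F.* ¼ F.^ d)))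
      ≈⟨ *-distribʳ-sumOver _ Fq.units _ ⟨
    S χ * sumOver (Fq.tuples d) (λ xs → χ ^∧ (Πh xs F.* ¼ F.^ d))  ≈⟨ *-congˡ (sumOver-tuples χ d) ⟩
    S χ * S χ ^ d  ∎

  count : ∀ {ω} → (∀ x → sum {n} (λ i → power ω (toℕ i) ^∧ x) ≈ fromℕ n * δ x F.1#) → ∀ d t →
          fromℕ n * fromℕ (Fq.numberOfPoints d t) ≈ sum {n} (λ i → S (power ω (toℕ i)) ^ d * power ω (toℕ i) ⟨ t ⟩)
  count {ω} orthogonal d t = begin
    fromℕ n * fromℕ (Fq.numberOfPoints d t)
      ≈⟨ *-congˡ (fromℕ-length-filter (Fq.onX? t) (Fq.tuples d)) ⟩
    fromℕ n * sumOver (Fq.tuples d) (indicator ∘ Fq.onX? t)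
      ≈⟨ *-distribˡ-sumOver _ (Fq.tuples d) _ ⟩
    sumOver (Fq.tuples d) (λ xs → fromℕ n * indicator (Fq.onX? t xs))
      ≈⟨ sumOver-cong (Fq.tuples d) (λ xs → trans (*-congˡ (indicator-onX t xs)) (sym (orthogonal _))) ⟩
    sumOver (Fq.tuples d) (λ xs → sum {n} (λ i → power ω (toℕ i) ^∧ (Πh xs F.* ¼ F.^ d F.* proj₁ t)))
      ≈⟨ sumOver-sum {n = n} (Fq.tuples d) (λ xs i → power ω (toℕ i) ^∧ (Πh xs F.* ¼ F.^ d F.* proj₁ t)) ⟩
    sum {n} (λ i → sumOver (Fq.tuples d) (λ xs → power ω (toℕ i) ^∧ (Πh xs F.* ¼ F.^ d F.* proj₁ t)))
      ≈⟨ sum-cong-≋ {n} (λ i → factor (power ω (toℕ i))) ⟩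
    sum {n} (λ i → S (power ω (toℕ i)) ^ d * power ω (toℕ i) ⟨ t ⟩)  ∎
    where
    factor : ∀ χ → sumOver (Fq.tuples d) (λ xs → χ ^∧ (Πh xs F.* ¼ F.^ d F.* proj₁ t)) ≈ S χ ^ d * χ ⟨ t ⟩
    factor χ = begin
      sumOver (Fq.tuples d) (λ xs → χ ^∧ (Πh xs F.* ¼ F.^ d F.* proj₁ t))
        ≈⟨ sumOver-cong (Fq.tuples d) (λ xs → trans (^∧-* χ _ _) (*-congˡ (^∧-unit χ t))) ⟩
      sumOver (Fq.tuples d) (λ xs → χ ^∧ (Πh xs F.* ¼ F.^ d) * χ ⟨ t ⟩)
        ≈⟨ *-distribʳ-sumOver _ (Fq.tuples d) _ ⟨
      sumOver (Fq.tuples d) (λ xs → χ ^∧ (Πh xs F.* ¼ F.^ d)) * χ ⟨ t ⟩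
        ≈⟨ *-congʳ (sumOver-tuples χ d) ⟩
      S χ ^ d * χ ⟨ t ⟩  ∎

  module _ {g} (g#0 : g F.# F.0#) (g-order : IsOrder g n)
           (η : Unit) (η-order : Kˣ.HasOrder η n) (ω : Character) (ω-generates : Ch.IsGenerator ω)
           (φ : Character) (φ-order : Ch.HasOrder φ 2) (ζ : Unit) (ζ-order : Kˣ.HasOrder ζ p) where

    private
      ψ : F.Carrier → Carrier
      ψ x = proj₁ ζ ^ tr x

      ζᵖ≈1 : proj₁ ζ ^ p ≈ 1#
      ζᵖ≈1 = trans (reflexive (≡.sym (^ℤ-value ζ p))) (Kˣ.HasOrder.xⁿ≈ε ζ-order)

      tr≡ : ∀ {x m} → m ℕ.< p → F.fromℕ m F.≈ trace x → tr x ≡ m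
      tr≡ {x} m<p e = fromℕ-injective (tr<p x) m<p (F.trans (fromℕ-tr x) (F.sym e))

      ψ-cong : Congruent ψ
      ψ-cong {x} {y} x≈y = reflexive (≡.cong (proj₁ ζ ^_)
        (tr≡ (tr<p y) (F.trans (fromℕ-tr y) (trace-cong (F.sym x≈y)))))

      ≤-ζ-cong : ∀ {a b} → a ≤ b → F.fromℕ a F.≈ F.fromℕ b → proj₁ ζ ^ a ≈ proj₁ ζ ^ b
      ≤-ζ-cong {a} a≤b e with m , ≡.refl ← fromℕ-congruent a≤b e = sym (trans (^-homo-* (proj₁ ζ) a (p ℕ.* m))
        (trans (*-congˡ (xᵐ≈1⇒xᵐⁿ≈1 p m ζᵖ≈1)) (*-identityʳ _)))

      -- Equality in F is congruence modulo p, and ζᵖ = 1. This is needed because `tr (x + y)` and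
      -- `tr x + tr y` agree only modulo p.
      ζ-cong : ∀ a b → F.fromℕ a F.≈ F.fromℕ b → proj₁ ζ ^ a ≈ proj₁ ζ ^ b
      ζ-cong a b e = [ (λ a≤b → ≤-ζ-cong a≤b e) , (λ b≤a → sym (≤-ζ-cong b≤a (F.sym e))) ]′ (ℕ.≤-total a b)

      ψ-+ : ∀ x y → ψ (x F.+ y) ≈ ψ x * ψ y
      ψ-+ x y = trans (ζ-cong (tr (x F.+ y)) (tr x ℕ.+ tr y) (F.trans (fromℕ-tr (x F.+ y)) (F.trans (trace-+ x y)
        (F.sym (F.trans (F.fromℕ-+ (tr x) (tr y)) (F.+-cong (fromℕ-tr x) (fromℕ-tr y)))))))
        (^-homo-* (proj₁ ζ) (tr x) (tr y))

      ψ-0 : ψ F.0# ≈ 1#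
      ψ-0 = reflexive (≡.cong (proj₁ ζ ^_) (tr≡ (ℕ.<⇒≤ 1<p) (F.sym (RingProperties.x+x≈x⇒x≈0 F.ring _
        (F.trans (F.sym (trace-+ F.0# F.0#)) (trace-cong (F.+-identityˡ F.0#)))))))

      -- At an element of nonzero trace the exponent lies strictly between 0 and p, the order of ζ.
      ψ-nontrivial : ¬ (ψ (proj₁ trace≉0) ≈ 1#)
      ψ-nontrivial ψ≈1 = Kˣ.HasOrder.minimal ζ-order (tr x₀) (ℕ.n≢0⇒n>0 tr≢0) (tr<p x₀)
        (trans (reflexive (^ℤ-value ζ (tr x₀))) ψ≈1)
        where
        x₀ = proj₁ trace≉0

        tr≢0 : tr x₀ ≢ 0
        tr≢0 e = proj₂ trace≉0 (F.trans (F.sym (fromℕ-tr x₀)) (F.reflexive (≡.cong F.fromℕ e)))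

      φ-nontrivial : ¬ (∀ u → φ ⟨ u ⟩ ≈ 1#)
      φ-nontrivial trivial = Ch.HasOrder.minimal φ-order 1 (ℕ.s≤s ℕ.z≤n) (ℕ.s≤s (ℕ.s≤s ℕ.z≤n))
        (λ u → trans (*-identityʳ _) (trivial u))

      φ²≈1 : ∀ u → φ ⟨ u ⟩ * φ ⟨ u ⟩ ≈ 1#
      φ²≈1 u = trans (*-congˡ (sym (*-identityʳ _))) (Ch.HasOrder.xⁿ≈ε φ-order u)

    open GaussSums F card K ψ

    gaussSum≈G : ∀ χ → gaussSum ζ χ ≈ G χ
    gaussSum≈G χ = trans (sumOver-units _) (Σᶠ-cong pointwise)
      where
      term-cong : ∀ {u v} → proj₁ u F.≈ proj₁ v → χ ⟨ u ⟩ * ψ (proj₁ u) ≈ χ ⟨ v ⟩ * ψ (proj₁ v)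
      term-cong {u} {v} e = *-cong (Hom.⟦⟧-cong χ {u} {v} e) (ψ-cong e)

      pointwise : ∀ x → Ext.extend 0# (λ u → χ ⟨ u ⟩ * ψ (proj₁ u)) x ≈ χ ^∧ x * ψ x
      pointwise x = [ (λ x≈0 → trans (Ext.extend-0 0# (λ {u} {v} → term-cong {u} {v}) x≈0)
                                 (sym (trans (*-congʳ (^∧-0 χ x≈0)) (zeroˡ _))))
                    , (λ x#0 → trans (Ext.extend-unit 0# (λ {u} {v} → term-cong {u} {v}) (x , x#0))
                                 (*-congʳ (sym (^∧-unit χ (x , x#0))))) ]′ (Fq.≈0∨unit x)

    G-ext : ∀ {χ χ′} → (∀ u → χ ⟨ u ⟩ ≈ χ′ ⟨ u ⟩) → G χ ≈ G χ′
    G-ext {χ} {χ′} e = Σᶠ-cong λ x → *-congʳ (^∧-ext {χ} {χ′} e x)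

    -1ᵘ : F.Unit
    -1ᵘ = F.-1-unit

    -- G-product with χ⁻¹(w − 1) replaced by χ(−1) χ⁻¹(1 − w).
    Gφ*J : ∀ χ → G φ * J φ χ ≈ χ ⟨ -1ᵘ ⟩ * (G (φ · χ) * G (conj χ))
    Gφ*J χ = begin
      G φ * J φ χ
        ≈⟨ *-congˡ (Σᶠ-cong λ w → trans (*-congʳ (flip w)) (*-assoc _ _ _)) ⟩
      G φ * Σᶠ (λ w → χ ⟨ -1ᵘ ⟩ * (conj χ ^∧ (w F.- F.1#) * φ ^∧ w))
        ≈⟨ *-congˡ (Σᶠ-*ˡ _ _) ⟨
      G φ * (χ ⟨ -1ᵘ ⟩ * Σᶠ (λ w → conj χ ^∧ (w F.- F.1#) * φ ^∧ w))
        ≈⟨ solve 3 (λ a b c → a :* (b :* c) := b :* (a :* c)) refl _ _ _ ⟩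
      χ ⟨ -1ᵘ ⟩ * (G φ * Σᶠ (λ w → conj χ ^∧ (w F.- F.1#) * φ ^∧ w))
        ≈⟨ *-congˡ (G-product ψ-cong ψ-+ ψ-0 ψ-nontrivial {φ} φ-nontrivial φ²≈1 χ) ⟨
      χ ⟨ -1ᵘ ⟩ * (G (φ · χ) * G (conj χ))  ∎
      where
      -1*-1≈1 : F.- F.1# F.* F.- F.1# F.≈ F.1#
      -1*-1≈1 = F.solve 0 ((F.:- F.con (ℤ.+ 1)) F.:* (F.:- F.con (ℤ.+ 1)) F.:= F.con (ℤ.+ 1)) F.refl

      flip : ∀ w → conj χ ^∧ (F.1# F.- w) ≈ χ ⟨ -1ᵘ ⟩ * conj χ ^∧ (w F.- F.1#)
      flip w = begin
        conj χ ^∧ (F.1# F.- w)                        ≈⟨ ^∧-cong (conj χ) (F.solve 1 (λ w →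
          F.con (ℤ.+ 1) F.:- w F.:= (F.:- F.con (ℤ.+ 1)) F.:* (w F.:- F.con (ℤ.+ 1))) F.refl w) ⟩
        conj χ ^∧ (F.- F.1# F.* (w F.- F.1#))         ≈⟨ ^∧-* (conj χ) _ _ ⟩
        conj χ ^∧ (F.- F.1#) * conj χ ^∧ (w F.- F.1#) ≈⟨ *-congʳ (trans (^∧-conj χ -1*-1≈1) (^∧-unit χ -1ᵘ)) ⟩
        χ ⟨ -1ᵘ ⟩ * conj χ ^∧ (w F.- F.1#)            ∎

    S≈Σ+J : ∀ χ → S χ ≈ Σᶠ (conj χ ^∧_) + J φ χ
    S≈Σ+J χ = begin
      S χ                                        ≈⟨ Σh 2#0 (F.trans (F.*-congˡ (F.sym 4≈2*2))
                                                      (F.trans (F.*-comm _ _) 4*¼≈1)) χ ⟩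
      Σᶠ (λ y → conj χ ^∧ (F.1# F.- y F.* y))    ≈⟨ Σᶠ-squares φ generates g#0 φ-nontrivial φ²≈1 2#0 f-cong ⟩
      Σᶠ (λ w → conj χ ^∧ (F.1# F.- w)) + J φ χ  ≈⟨ +-congʳ (Σᶠ-reindex (λ w → F.1# F.- w) (λ w → F.1# F.- w)
        (^∧-cong (conj χ)) (λ e → F.+-congˡ (F.-‿cong e)) (λ e → F.+-congˡ (F.-‿cong e)) involutive involutive) ⟨
      Σᶠ (conj χ ^∧_) + J φ χ                    ∎
      where
      generates : ∀ {x} → x F.# F.0# → ∃ λ i → x F.≈ g F.^ i
      generates x#0 = let i , _ , e = discrete-log g#0 g-order x#0 in i , e

      f-cong : Congruent (λ w → conj χ ^∧ (F.1# F.- w))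
      f-cong e = ^∧-cong (conj χ) (F.+-congˡ (F.-‿cong e))

      involutive : ∀ w → F.1# F.- (F.1# F.- w) F.≈ w
      involutive w = F.solve 1 (λ w → F.con (ℤ.+ 1) F.:- (F.con (ℤ.+ 1) F.:- w) F.:= w) F.refl w

    module _ (char0 : CharacteristicZero) where

      Gφ#0 : G φ # 0#
      Gφ#0 = *≈1⇒#0 {G φ} {v * G φ} (begin
        v * G φ * G φ                                ≈⟨ *-assoc _ _ _ ⟩
        v * (G φ * G φ)                              ≈⟨ *-congˡ (G-square ψ-cong ψ-+ ψ-0 ψ-nontrivial {φ} φ-nontrivial φ²≈1) ⟩
        v * (φ ^∧ (F.- F.1#) * fromℕ (suc n))        ≈⟨ *-congˡ (*-congʳ (^∧-unit φ -1ᵘ)) ⟩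
        v * (φ ⟨ -1ᵘ ⟩ * fromℕ (suc n))              ≈⟨ AbelianGroup.inverseˡ unitGroup w ⟩
        1#                                           ∎)
        where
        w : Unit
        w = Hom.⟦ φ ⟧ -1ᵘ *ᵘ (fromℕ (suc n) , char0 n)

        v = proj₁ (w ⁻¹)

      gφ#0 : gaussSum ζ φ # 0#
      gφ#0 = HeytingProperties.#-congʳ heytingCommutativeRing (sym (gaussSum≈G φ)) Gφ#0

      conj-trivial : ∀ {χ} → (∀ u → χ ⟨ u ⟩ ≈ 1#) → ∀ u → conj χ ⟨ u ⟩ ≈ 1#
      conj-trivial {χ} trivial u = trans (sym (*-identityˡ _)) (trans (*-congʳ (sym (trivial u)))
        (*-inverseʳ (Hom.⟦ χ ⟧ u)))

      -- In `Gφ*J` the factor g(φ) cancels and leaves the Gauss sum of the trivial character. The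
      -- value agrees with the sum of φ(w) over w ≠ 1, which is -φ(1).
      J-trivial : ∀ {χ} → (∀ u → χ ⟨ u ⟩ ≈ 1#) → J φ χ ≈ - 1#
      J-trivial {χ} trivial = *-cancelˡ (G φ , Gφ#0) (begin
        G φ * J φ χ                                ≈⟨ Gφ*J χ ⟩
        χ ⟨ -1ᵘ ⟩ * (G (φ · χ) * G (conj χ))       ≈⟨ *-cong (trivial -1ᵘ) (*-cong
          (G-ext {φ · χ} {φ} λ u → trans (*-congˡ (trivial u)) (*-identityʳ _))
          (G-trivial ψ-cong ψ-+ ψ-0 ψ-nontrivial {conj χ} (conj-trivial {χ} trivial))) ⟩
        1# * (G φ * - 1#)                          ≈⟨ *-identityˡ _ ⟩
        G φ * - 1#                                 ∎)

      -- The value is the number of units other than -1, the only zero of h.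
      S-trivial : ∀ {χ} → (∀ u → χ ⟨ u ⟩ ≈ 1#) → S χ ≈ fromℕ (suc n) - fromℕ 2
      S-trivial {χ} trivial = begin
        S χ                            ≈⟨ S≈Σ+J χ ⟩
        Σᶠ (conj χ ^∧_) + J φ χ        ≈⟨ +-cong (Σᶠ-𝟙 {conj χ} (conj-trivial {χ} trivial)) (J-trivial {χ} trivial) ⟩
        fromℕ n - 1#                   ≈⟨ solve 1 (λ m → m :- con (ℤ.+ 1)
          := (con (ℤ.+ 1) :+ m) :- (con (ℤ.+ 1) :+ con (ℤ.+ 1))) refl (fromℕ n) ⟩
        (1# + fromℕ n) - (1# + 1#)     ≈⟨ +-congˡ (-‿cong fromℕ2≈1+1) ⟨
        fromℕ (suc n) - fromℕ 2        ∎

      S-nontrivial : ∀ {χ} → ¬ (∀ u → χ ⟨ u ⟩ ≈ 1#) → S χ ≈ J φ χ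
      S-nontrivial {χ} nontrivial = begin
        S χ                       ≈⟨ S≈Σ+J χ ⟩
        Σᶠ (conj χ ^∧_) + J φ χ   ≈⟨ +-congʳ (Σᶠ-nontrivial {conj χ} λ trivial → nontrivial λ u →
          trans (sym (*-identityʳ _)) (trans (*-congˡ (sym (trivial u))) (*-inverseʳ (Hom.⟦ χ ⟧ u)))) ⟩
        0# + J φ χ                ≈⟨ +-identityˡ _ ⟩
        J φ χ                     ∎

      module _ (d : ℕ) (t : F.Unit) where

        private
          χ : ℕ → Character
          χ = power ω

          [-1]^d : F.Unit
          [-1]^d = GroupNotions._^ℤ_ F.multiplicativeGroup F.-1-unit (ℤ.+ d)

          [-1]^d-value : ∀ d → proj₁ (GroupNotions._^ℤ_ F.multiplicativeGroup F.-1-unit (ℤ.+ d)) ≡ (F.- F.1#) F.^ d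
          [-1]^d-value zero    = ≡.refl
          [-1]^d-value (suc d) = ≡.cong (F.- F.1# F.*_) ([-1]^d-value d)

          ratio : ℕ → Carrier
          ratio m = gaussSum ζ (φ · χ m) * gaussSum ζ (ω Ch.^ℤ (ℤ.- (ℤ.+ m))) / (gaussSum ζ φ , gφ#0)

          -- Valid at m = 0 as well, where both sides are -1; it is S, not the Gauss sum quotient,
          -- that deviates from J there.
          ratio≈J : ∀ m → χ m ⟨ -1ᵘ ⟩ * ratio m ≈ J φ (χ m)
          ratio≈J m = *-cancelˡ (G φ , Gφ#0) (begin
            G φ * (χ m ⟨ -1ᵘ ⟩ * ratio m)
              ≈⟨ *-cong (sym (gaussSum≈G φ)) (*-congˡ (*-congʳ (*-cong (gaussSum≈G (φ · χ m)) (trans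
                   (gaussSum≈G (ω Ch.^ℤ (ℤ.- (ℤ.+ m))))
                   (G-ext {ω Ch.^ℤ (ℤ.- (ℤ.+ m))} {conj (χ m)} (negative-power-value ω m)))))) ⟩
            gaussSum ζ φ * (χ m ⟨ -1ᵘ ⟩ * (G (φ · χ m) * G (conj (χ m)) / gφ))
              ≈⟨ solve 4 (λ a b c e → a :* (b :* (c :* e)) := (b :* c) :* (a :* e)) refl _ _ _ _ ⟩
            χ m ⟨ -1ᵘ ⟩ * (G (φ · χ m) * G (conj (χ m))) * (gaussSum ζ φ * proj₁ (gφ ⁻¹))
              ≈⟨ trans (*-congˡ (*-inverseʳ gφ)) (*-identityʳ _) ⟩
            χ m ⟨ -1ᵘ ⟩ * (G (φ · χ m) * G (conj (χ m)))  ≈⟨ Gφ*J (χ m) ⟨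
            G φ * J φ (χ m)  ∎)
            where
            gφ : Unit
            gφ = gaussSum ζ φ , gφ#0

          -- The (-1)ᵈ in the argument of ω contributes χ(-1)ᵈ, which is exactly what turns the d-th
          -- power of the quotient into that of J.
          H-term : ∀ m → ratio m ^ d * (ω ⟨ [-1]^d F.*ᵘ t ⟩) ^ m ≈ J φ (χ m) ^ d * χ m ⟨ t ⟩
          H-term m = begin
            ratio m ^ d * (ω ⟨ [-1]^d F.*ᵘ t ⟩) ^ m        ≡⟨ ≡.cong (ratio m ^ d *_) (power-value ω m ([-1]^d F.*ᵘ t)) ⟨
            ratio m ^ d * χ m ⟨ [-1]^d F.*ᵘ t ⟩            ≈⟨ *-congˡ (Hom.homo (χ m) [-1]^d t) ⟩
            ratio m ^ d * (χ m ⟨ [-1]^d ⟩ * χ m ⟨ t ⟩)     ≈⟨ *-congˡ (*-congʳ (begin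
              χ m ⟨ [-1]^d ⟩                  ≈⟨ ^∧-unit (χ m) [-1]^d ⟨
              χ m ^∧ proj₁ [-1]^d             ≈⟨ ^∧-cong (χ m) (F.reflexive ([-1]^d-value d)) ⟩
              χ m ^∧ ((F.- F.1#) F.^ d)       ≈⟨ ^∧-^ (χ m) _ d ⟩
              (χ m ^∧ (F.- F.1#)) ^ d         ≈⟨ ^-congˡ d (^∧-unit (χ m) -1ᵘ) ⟩
              (χ m ⟨ -1ᵘ ⟩) ^ d               ∎)) ⟩
            ratio m ^ d * ((χ m ⟨ -1ᵘ ⟩) ^ d * χ m ⟨ t ⟩)
              ≈⟨ solve 3 (λ a b c → a :* (b :* c) := (b :* a) :* c) refl _ _ _ ⟩
            (χ m ⟨ -1ᵘ ⟩) ^ d * ratio m ^ d * χ m ⟨ t ⟩    ≈⟨ *-congʳ (^-distrib-* _ _ d) ⟨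
            (χ m ⟨ -1ᵘ ⟩ * ratio m) ^ d * χ m ⟨ t ⟩        ≈⟨ *-congʳ (^-congˡ d (ratio≈J m)) ⟩
            J φ (χ m) ^ d * χ m ⟨ t ⟩                      ∎

          -- S and J differ at m = 0 only; this isolates the correction S(1)ᵈ - J(1)ᵈ.
          sum-change-first : ∀ {n} {f g : ℕ → Carrier} → n ≢ 0 → (∀ m → 0 ℕ.< m → m ℕ.< n → f m ≈ g m) →
                             sum {n} (f ∘ toℕ) ≈ (f 0 - g 0) + sum {n} (g ∘ toℕ)
          sum-change-first {zero}  n≢0 _ = contradiction ≡.refl n≢0
          sum-change-first {suc n} {f} {g} _ f≈g = trans
            (+-congˡ (sum-cong-≋ {n} λ i → f≈g (suc (toℕ i)) (ℕ.s≤s ℕ.z≤n) (ℕ.s≤s (Fin.toℕ<n i))))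
            (solve 3 (λ a b s → a :+ s := (a :- b) :+ (b :+ s)) refl (f 0) (g 0) _)

          trivial₀ : ∀ u → χ 0 ⟨ u ⟩ ≈ 1#
          trivial₀ u = refl

          -- `b` is the correction S(1)ᵈ - J(1)ᵈ, and `U` is the sum in `H` without its prefactor.
          s b Q U : Carrier
          s = (- 1#) ^ d
          b = (fromℕ (suc n) - fromℕ 2) ^ d - s
          Q = fromℕ (suc n) - 1#
          U = sumOver (List.upTo n) (λ m → ratio m ^ d * (ω ⟨ [-1]^d F.*ᵘ t ⟩) ^ m)

          s*s≈1 : s * s ≈ 1#
          s*s≈1 = trans (sym (^-distrib-* (- 1#) (- 1#) d)) (trans (^-congˡ d
            (solve 0 ((:- con (ℤ.+ 1)) :* (:- con (ℤ.+ 1)) := con (ℤ.+ 1)) refl)) (1^n≈1 d))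

          nN≈b+U : fromℕ n * fromℕ (Fq.numberOfPoints d t) ≈ b + U
          nN≈b+U = begin
            fromℕ n * fromℕ (Fq.numberOfPoints d t)
              ≈⟨ count {ω} (orthogonality η η-order g#0 g-order ω-generates) d t ⟩
            sum {n} (λ i → S (χ (toℕ i)) ^ d * χ (toℕ i) ⟨ t ⟩)
              ≈⟨ sum-change-first {n} {λ m → S (χ m) ^ d * χ m ⟨ t ⟩} {λ m → J φ (χ m) ^ d * χ m ⟨ t ⟩} n≢0
                   (λ m 0<m m<n → *-congʳ (^-congˡ d (S-nontrivial {χ m}
                     (power-nontrivial η η-order g#0 g-order ω-generates m 0<m m<n)))) ⟩
            (S (χ 0) ^ d * 1# - J φ (χ 0) ^ d * 1#) + sum {n} (λ i → J φ (χ (toℕ i)) ^ d * χ (toℕ i) ⟨ t ⟩)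
              ≈⟨ +-cong (+-cong (trans (*-identityʳ _) (^-congˡ d (S-trivial {χ 0} trivial₀)))
                                (-‿cong (trans (*-identityʳ _) (^-congˡ d (J-trivial {χ 0} trivial₀)))))
                        (sum-cong-≋ {n} λ i → sym (H-term (toℕ i))) ⟩
            b + sum {n} (λ i → ratio (toℕ i) ^ d * (ω ⟨ [-1]^d F.*ᵘ t ⟩) ^ toℕ i)
              ≡⟨ ≡.cong (b +_) (sumOver-upTo (λ m → ratio m ^ d * (ω ⟨ [-1]^d F.*ᵘ t ⟩) ^ m) n) ⟨
            b + U  ∎

        numberOfPoints-formula : fromℕ (Fq.numberOfPoints d t)
          ≈ ((fromℕ (suc n) - fromℕ 2) ^ d - (- 1#) ^ d) / q-1 char0 - (- 1#) ^ d * H char0 ζ ω φ gφ#0 d t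
        numberOfPoints-formula = *-cancelˡ (q-1 char0) (begin
          Q * fromℕ (Fq.numberOfPoints d t)           ≈⟨ *-congʳ (solve 1 (λ m →
            (con (ℤ.+ 1) :+ m) :- con (ℤ.+ 1) := m) refl (fromℕ n)) ⟩
          fromℕ n * fromℕ (Fq.numberOfPoints d t)     ≈⟨ nN≈b+U ⟩
          -- The solver knows nothing of inverses, so Q Q′ = 1 and Q⁻ Q⁻′ = 1 are inserted by hand.
          -- The minus sign before `H` comes from 1 - q = -(q - 1), and its two signs (-1)ᵈ from s²
          -- = 1.
          b + U                                       ≈⟨ +-cong (trans (sym (*-identityʳ b)) (*-congˡ (sym Q/Q)))
            (trans (sym (*-identityˡ U)) (*-congʳ (trans (sym s*s≈1) (trans (sym (*-identityʳ _)) (*-congˡ (sym 1-q/1-q)))))) ⟩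
          b * (Q * Q′) + s * s * (Q⁻ * Q⁻′) * U       ≈⟨ solve 7 (λ b m Q′ s Q⁻′ U o →
              b :* ((m :- o) :* Q′) :+ s :* s :* ((o :- m) :* Q⁻′) :* U
              := (m :- o) :* (b :* Q′ :- s :* (s :* Q⁻′ :* U))) refl b (fromℕ (suc n)) Q′ s Q⁻′ U 1# ⟩
          Q * (b * Q′ - s * (s * Q⁻′ * U))            ∎)
          where
          Q′  = proj₁ (q-1 char0 ⁻¹)
          Q⁻  = proj₁ (1-q char0)
          Q⁻′ = proj₁ (1-q char0 ⁻¹)

          Q/Q : Q * Q′ ≈ 1#
          Q/Q = *-inverseʳ (q-1 char0)

          1-q/1-q : Q⁻ * Q⁻′ ≈ 1#
          1-q/1-q = *-inverseʳ (1-q char0)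

theorem4p1 :
  ∀ {c ℓ r c′ ℓ′ r′} {q : ℕ} (qpp : OddPrimePower q)
  (F : HeytingField c ℓ r) (card : HasCardinality F q)
  (K : HeytingField c′ ℓ′ r′) →
  let open OddPrimePower qpp using (p)
      module F = FieldNotions F
      open FiniteField F card using (numberOfPoints)
      open FieldNotions K
      open Characters qpp F card K
      module Kˣ = GroupNotions multiplicativeGroup
      module Ch = GroupNotions charGroup
  in
  (char0 : CharacteristicZero) →
  (∃ λ η → Kˣ.HasOrder η (q ∸ 1)) →
  (d : ℕ) → 2 ≤ d →
  (t : F.Unit) →
  (ω : Character) → Ch.IsGenerator ω →
  (φ : Character) → Ch.HasOrder φ 2 →
  (ζ : Unit) → Kˣ.HasOrder ζ p →
  Σ (gaussSum ζ φ # 0#) λ gφ#0 →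
    fromℕ (numberOfPoints d t)
      ≈ ((fromℕ q - fromℕ 2) ^ d - (- 1#) ^ d) / q-1 char0
        - (- 1#) ^ d * H char0 ζ ω φ gφ#0 d t
-- Matching on q and k exposes n = q - 1, the order of the unit group, and the exponent k of the
-- highest conjugate in the trace.
theorem4p1 {q = zero} qpp = contradiction (OddPrimePower.1<q qpp) λ ()
theorem4p1 {q = suc n} record { k = zero ; k≥1 = () }
theorem4p1 {q = suc n} record { k = suc k ; p-prime = p-prime ; p-odd = p≢2 ; k≥1 = 1≤k ; q≡p^k = q≡p^k }
           F card K char0 (η , η-order) d _ t ω ω-generates φ φ-order ζ ζ-order =
  let g , g#0 , g-order = PrimitiveRoot.primitive-root F card n≢0 in
  gφ#0 g#0 g-order η η-order ω ω-generates φ φ-order ζ ζ-order char0 ,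
  numberOfPoints-formula g#0 g-order η η-order ω ω-generates φ φ-order ζ ζ-order char0 d t
  where open PointCount p-prime p≢2 1≤k q≡p^k F card K
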